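{- Let $k = p_1p_2\cdots p_t \geq 6$ be even, where $p_1,\dots,p_t$ are primes, not necessarily distinct. Let $1 \leq i \leq t-1$ and suppose at least one of $p_1,\dots,p_i$ equals $2$. If $u \equiv 1 \pmod{p_1p_2\cdots p_i}$ and $g$ is odd with $g \equiv p_{i+1}p_{i+2}\cdots p_t \pmod{2p_{i+1}p_{i+2}\cdots p_t}$, then there exists a $k$-ARCS of $(K_u \times K_g)(2)$.
   Context: $u,g$ are positive integers. For graphs $G,H$, the tensor product $G \times H$ has vertex set $V(G)\times V(H)$, with $(g_1,h_1)$ adjacent to $(g_2,h_2)$ iff $g_1g_2 \in E(G)$ and $h_1h_2 \in E(H)$. For a graph $G$ and positive integer $\lambda$, $G(\lambda)$ is the multigraph obtained by replacing each edge of $G$ by $\lambda$ parallel edges. $K_n$ is the complete graph on $n$ vertices. $(K_u \times K_g)(\lambda)$ is regarded as a $u$-partite multigraph with partite sets $V_i = \{i\}\times V(K_g)$. A partial $C_k$-factor of $(K_u \times K_g)(\lambda)$ is a subgraph which, for some $i$, is a spanning subgraph of $(K_u \times K_g)(\lambda)\setminus V_i$ all of whose components are cycles of length $k$. A $k$-ARCS of $(K_u \times K_g)(\lambda)$ is a partition of its edge multiset into partial $C_k$-factors. -}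

module Defs where

open import Data.Nat using (ℕ; zero; suc; _+_; _*_; _≤_)
open import Data.Nat.Primality using (Prime)
open import Data.Integer as ℤ using (ℤ; +_; _-_)
open import Data.Integer.Divisibility as ℤD using ()
open import Data.Fin using (Fin)
open import Data.Fin.Properties using () renaming (_≟_ to _≟F_)
open import Data.Product using (Σ; ∃; _×_; _,_; proj₁; proj₂)
open import Data.Product.Properties using (≡-dec)
open import Data.Sum using (_⊎_)
open import Data.List using (List; []; _∷_; zip; _++_; length; filter; concat; concatMap)
open import Data.List.Relation.Unary.All using (All)
open import Data.List.Relation.Unary.Unique.Propositional using (Unique)
open import Relation.Binary.PropositionalEquality using (_≡_; _≢_)
open import Relation.Binary.Definitions using (DecidableEquality)
open import Relation.Nullary using (Dec; yes; no; ¬_)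
open import Relation.Nullary.Decidable using (_⊎-dec_)

_≡_[mod_] : ℕ → ℕ → ℕ → Set
a ≡ b [mod m ] = (+ m) ℤD.∣ ((+ a) - (+ b))

-- Vertices of K_u × K_g: pairs (i , x), with partite set V_i = {i} × V(K_g).
Vertex : ℕ → ℕ → Set
Vertex u g = Fin u × Fin g

_≟V_ : ∀ {u g} → DecidableEquality (Vertex u g)
_≟V_ = ≡-dec _≟F_ _≟F_

Adj : ∀ {u g} → Vertex u g → Vertex u g → Set
Adj (a , x) (b , y) = (a ≢ b) × (x ≢ y)

cycEdges : ∀ {A : Set} → List A → List (A × A)
cycEdges []       = []
cycEdges (x ∷ xs) = zip (x ∷ xs) (xs ++ x ∷ [])

-- A list of vertices describes a k-cycle of K_u × K_g (hence of (K_u × K_g)(λ)):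
-- exactly k distinct vertices, cyclically consecutive ones adjacent.
IsCycle : ∀ {u g} → ℕ → List (Vertex u g) → Set
IsCycle k c = (length c ≡ k) × Unique c × All (λ e → Adj (proj₁ e) (proj₂ e)) (cycEdges c)

occ : ∀ {u g} → Vertex u g → List (Vertex u g) → ℕ
occ v xs = length (filter (λ w → w ≟V v) xs)

-- A partial C_k-factor, given as a list of k-cycles: for some i, the cycles
-- are vertex-disjoint and cover exactly the vertices outside V_i.
IsPartialCkFactor : ∀ u g → ℕ → List (List (Vertex u g)) → Set
IsPartialCkFactor u g k F =
  All (IsCycle k) F ×
  ∃ λ (i : Fin u) → ∀ (v : Vertex u g) →
     (proj₁ v ≡ i → occ v (concat F) ≡ 0) × (proj₁ v ≢ i → occ v (concat F) ≡ 1)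

edgeMult : ∀ {u g} → List (List (List (Vertex u g))) → Vertex u g → Vertex u g → ℕ
edgeMult R x y =
  length (filter (λ e → (e ≟E (x , y)) ⊎-dec (e ≟E (y , x)))
                 (concatMap (concatMap cycEdges) R))
  where
  _≟E_ : DecidableEquality _
  _≟E_ = ≡-dec _≟V_ _≟V_

-- A k-ARCS of (K_u × K_g)(λ): a list of partial C_k-factors whose edges
-- partition the edge multiset, i.e. every edge of K_u × K_g is used exactly λ times.
IsARCS : ∀ u g (k λm : ℕ) → List (List (List (Vertex u g))) → Set
IsARCS u g k λm R =
  All (IsPartialCkFactor u g k) R ×
  (∀ (x y : Vertex u g) → Adj x y → edgeMult R x y ≡ λm)

ARCSExists : ∀ u g (k λm : ℕ) → Set
ARCSExists u g k λm = ∃ λ R → IsARCS u g k λm R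

{-# OPTIONS --safe #-}
module Submission where

open import Defs
open import Data.Nat using (ℕ; zero; suc; _+_; _*_; _∸_; _≤_; _<_; z≤n; s≤s; NonZero; _%_; _/_)
import Data.Nat.Properties as ℕₚ
open import Data.Nat.Divisibility using (_∣_; divides; ∣-trans; n∣m*n)
open import Data.Nat.DivMod using (m≡m%n+[m/n]*n; [m+n]%n≡m%n; n%n≡0)
open import Data.Nat.ListAction using (product)
open import Data.Nat.ListAction.Properties using (product-++; ∈⇒∣product; product≢0)
open import Data.Nat.Primality using (Prime; prime⇒nonZero)
open import Data.Nat.Tactic.RingSolver using () renaming (solve-∀ to ℕ-solve)
open import Data.Integer using (ℤ; -[1+_]; -_; _-_; ∣_∣; _%ℕ_; _/ℕ_) renaming (+_ to ⁺_; _+_ to _+ᶻ_; _*_ to _*ᶻ_)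
import Data.Integer.Properties as ℤₚ
open import Data.Integer.DivMod using (n%ℕd<d; a≡a%ℕn+[a/ℕn]*n)
import Data.Integer.Divisibility.Signed as Signed
open import Data.Integer.Tactic.RingSolver using (solve-∀)
open import Data.Fin using (Fin; zero; suc; toℕ; fromℕ<; _↑ˡ_; _↑ʳ_; combine)
import Data.Fin.Properties as Finₚ
open import Data.Product using (Σ; _×_; _,_; proj₁; proj₂; uncurry)
open import Data.Sum using (_⊎_; inj₁; inj₂)
open import Data.Unit using (⊤; tt)
open import Data.Empty using (⊥; ⊥-elim)
open import Data.List using (List; []; _∷_; _++_; map; concat; concatMap; applyUpTo; length; zip; filter; take; drop; allFin; tabulate)
open import Data.List.Properties using (length-++; length-map; length-applyUpTo; ++-identityʳ; take++drop≡id)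
open import Data.List.Membership.Propositional using (_∈_; find)
open import Data.List.Membership.Propositional.Properties using (∈-concatMap⁻; ∈-map⁻)
open import Data.List.Relation.Unary.All as All using (All; []; _∷_)
import Data.List.Relation.Unary.All.Properties as Allₚ
open import Data.List.Relation.Unary.AllPairs using ([]; _∷_)
open import Data.List.Relation.Unary.Any using (here; there)
open import Data.List.Relation.Unary.Unique.Propositional using (Unique)
open import Function using (_∘_)
open import Relation.Binary.PropositionalEquality
open import Relation.Nullary using (Dec; yes; no; ¬_)
open import Relation.Unary using (Decidable)
open ≡-Reasoning

-- Write p₁⋯pᵢ = 2h, b = pᵢ₊₁⋯p_t, g = mb and u = 1 + 2hs; here b is odd since g is.
--
-- Base. The multigraph K_u(2) splits into 2-factors of K_u minus a vertex, all of whose cycles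
-- have length 2h.  The points are ∞ and s groups that are copies of ℤ/2h.  A near-Hamiltonian
-- decomposition of K_{2h+1}(2) is used on one group together with ∞, and a 2h-cycle
-- factorization of K_{2h,2h}(2) on two groups.  For odd s the groups are matched by x + y = 2c,
-- the hole lying in the unmatched group c.  For even s no group is left over, so vertices
-- are moved between groups: in one class of factors every group but one receives the missing
-- vertex of the preceding group; the extra edges this uses are released by putting ∞ in place of
-- that vertex in the factors matching the two groups.  The factorization of
-- K_{2h,2h}(2) is chosen so that both modifications concern the same edges.
--
-- Lifting. Let f ≠ 0 in ℤ/m × ℤ/b.  A 2h-cycle of K_u lifts to cycles of K_u × K_g by adding f
-- along odd arcs, subtracting f along even arcs, but subtracting ψ(f) along the last arc, where ψ
-- permutes the nonzero elements and f - ψ(f) = (0, ±1).  Going round b times closes up, so the lifts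
-- have length 2hb, and as f varies each arc of K_u receives every nonzero difference once.

-- The sign rule along a base cycle relies on its even length 2h: f and -f alternate, so one turn
-- uses only two second coordinates. If ψ were the identity, every lift would close after a single
-- turn; the defect f - ψ(f) = (0, ±1) generates ℤ/b, so exactly b turns are needed. For the last
-- arc to see every difference once, ψ must permute the nonzero differences. Lowering the ℤ/b part
-- by one does this off the line {0} × ℤ/b, but on that line it would send (0, 1) to 0. There the b
-- - 1 nonzero elements are exchanged in neighbouring pairs instead, which is where the oddness of b
-- enters.
--
-- Summing arbitrary weights turns every multiplicity statement into a reindexing of finite sums and
-- replaces disjointness arguments. Distinctness of the vertices of a lift and adjacency of
-- consecutive ones are not followed through the construction: they are read off from the final
-- counts, since a vertex counted at most once cannot repeat and a pair of multiplicity 0 cannot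
-- occur. A symmetric weight summed over ordered pairs counts each edge twice, which is how λ = 2 is
-- expressed.

private variable
  A B : Set

-- Finite sums over initial segments, lists, walks and `Fin n`

+-exchange : ∀ a b c d → (a + b) + (c + d) ≡ (a + c) + (b + d)
+-exchange = ℕ-solve

∑ : ℕ → (ℕ → ℕ) → ℕ
∑ zero    f = 0
∑ (suc n) f = f 0 + ∑ n (f ∘ suc)

∑-cong : ∀ n {f g : ℕ → ℕ} → (∀ i → f i ≡ g i) → ∑ n f ≡ ∑ n g
∑-cong zero    e = refl
∑-cong (suc n) e = cong₂ _+_ (e 0) (∑-cong n (e ∘ suc))

∑-cong-< : ∀ n {f g : ℕ → ℕ} → (∀ i → i < n → f i ≡ g i) → ∑ n f ≡ ∑ n g
∑-cong-< zero    e = refl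
∑-cong-< (suc n) e = cong₂ _+_ (e 0 (s≤s z≤n)) (∑-cong-< n (λ i lt → e (suc i) (s≤s lt)))

∑-+ : ∀ n (f g : ℕ → ℕ) → ∑ n (λ i → f i + g i) ≡ ∑ n f + ∑ n g
∑-+ zero    f g = refl
∑-+ (suc n) f g = trans (cong (_ +_) (∑-+ n (f ∘ suc) (g ∘ suc))) (+-exchange (f 0) (g 0) _ _)

∑-0 : ∀ n → ∑ n (λ _ → 0) ≡ 0
∑-0 zero    = refl
∑-0 (suc n) = ∑-0 n

∑-swap : ∀ m n (f : ℕ → ℕ → ℕ) → ∑ m (λ i → ∑ n (f i)) ≡ ∑ n (λ j → ∑ m (λ i → f i j))
∑-swap zero    n f = sym (∑-0 n)
∑-swap (suc m) n f = trans (cong (∑ n (f 0) +_) (∑-swap m n (f ∘ suc))) (sym (∑-+ n (f 0) _))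

∑-snoc : ∀ n (f : ℕ → ℕ) → ∑ (suc n) f ≡ ∑ n f + f n
∑-snoc zero    f = ℕₚ.+-comm (f 0) 0
∑-snoc (suc n) f = trans (cong (f 0 +_) (∑-snoc n (f ∘ suc))) (sym (ℕₚ.+-assoc (f 0) _ _))

∑-split : ∀ m n (f : ℕ → ℕ) → ∑ (m + n) f ≡ ∑ m f + ∑ n (λ i → f (m + i))
∑-split zero    n f = refl
∑-split (suc m) n f = trans (cong (f 0 +_) (∑-split m n (f ∘ suc))) (sym (ℕₚ.+-assoc (f 0) _ _))

∑-double : ∀ n (f : ℕ → ℕ) → ∑ (n + n) f ≡ ∑ n (λ i → f (i + i) + f (suc (i + i)))
∑-double zero    f = refl
∑-double (suc n) f = begin
  f 0 + ∑ (n + suc n) (f ∘ suc)                    ≡⟨ cong (λ k → f 0 + ∑ k (f ∘ suc)) (ℕₚ.+-suc n n) ⟩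
  f 0 + (f 1 + ∑ (n + n) (λ i → f (suc (suc i))))          ≡⟨ ℕₚ.+-assoc (f 0) _ _ ⟨
  f 0 + f 1 + ∑ (n + n) (λ i → f (suc (suc i)))            ≡⟨ cong (f 0 + f 1 +_) (∑-double n (λ i → f (suc (suc i)))) ⟩
  f 0 + f 1 + ∑ n (λ i → f (suc (suc (i + i))) + f (suc (suc (suc (i + i)))))
    ≡⟨ cong (f 0 + f 1 +_) (∑-cong n λ i → cong (λ k → f (suc k) + f (suc (suc k))) (sym (ℕₚ.+-suc i i))) ⟩
  f 0 + f 1 + ∑ n (λ i → f (suc i + suc i) + f (suc (suc i + suc i))) ∎

∑-reverse : ∀ n (f : ℕ → ℕ) → ∑ n (λ i → f (n ∸ suc i)) ≡ ∑ n f
∑-reverse zero    f = refl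
∑-reverse (suc n) f = trans (cong (f n +_) (∑-reverse n f)) (trans (ℕₚ.+-comm (f n) _) (sym (∑-snoc n f)))

sumOver : (A → ℕ) → List A → ℕ
sumOver f []       = 0
sumOver f (x ∷ xs) = f x + sumOver f xs

sumOver-cong : {f g : A → ℕ} → (∀ x → f x ≡ g x) → ∀ xs → sumOver f xs ≡ sumOver g xs
sumOver-cong e []       = refl
sumOver-cong e (x ∷ xs) = cong₂ _+_ (e x) (sumOver-cong e xs)

sumOver-+ : (f g : A → ℕ) → ∀ xs → sumOver (λ x → f x + g x) xs ≡ sumOver f xs + sumOver g xs
sumOver-+ f g []       = refl
sumOver-+ f g (x ∷ xs) = trans (cong (_ +_) (sumOver-+ f g xs)) (+-exchange (f x) (g x) _ _)

sumOver-++ : (f : A → ℕ) → ∀ xs ys → sumOver f (xs ++ ys) ≡ sumOver f xs + sumOver f ys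
sumOver-++ f []       ys = refl
sumOver-++ f (x ∷ xs) ys = trans (cong (f x +_) (sumOver-++ f xs ys)) (sym (ℕₚ.+-assoc (f x) _ _))

sumOver-0 : (xs : List A) → sumOver (λ _ → 0) xs ≡ 0
sumOver-0 []       = refl
sumOver-0 (_ ∷ xs) = sumOver-0 xs

sumOver-map : (f : B → ℕ) (g : A → B) → ∀ xs → sumOver f (map g xs) ≡ sumOver (f ∘ g) xs
sumOver-map f g []       = refl
sumOver-map f g (x ∷ xs) = cong (f (g x) +_) (sumOver-map f g xs)

sumOver-concat : (f : A → ℕ) → ∀ xss → sumOver f (concat xss) ≡ sumOver (sumOver f) xss
sumOver-concat f []         = refl
sumOver-concat f (xs ∷ xss) = trans (sumOver-++ f xs _) (cong (_ +_) (sumOver-concat f xss))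

sumOver-concatMap : (f : B → ℕ) (g : A → List B) → ∀ xs → sumOver f (concatMap g xs) ≡ sumOver (sumOver f ∘ g) xs
sumOver-concatMap f g xs = trans (sumOver-concat f (map g xs)) (sumOver-map (sumOver f) g xs)

sumOver-applyUpTo : (f : A → ℕ) (g : ℕ → A) → ∀ n → sumOver f (applyUpTo g n) ≡ ∑ n (f ∘ g)
sumOver-applyUpTo f g zero    = refl
sumOver-applyUpTo f g (suc n) = cong (f (g 0) +_) (sumOver-applyUpTo f (g ∘ suc) n)

sumOver-swap : (f : A → B → ℕ) → ∀ xs ys → sumOver (λ x → sumOver (f x) ys) xs ≡ sumOver (λ y → sumOver (λ x → f x y) xs) ys
sumOver-swap f []       []       = refl
sumOver-swap f []       (y ∷ ys) = sumOver-swap f [] ys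
sumOver-swap f (x ∷ xs) ys       = trans (cong (_ +_) (sumOver-swap f xs ys)) (sym (sumOver-+ (f x) _ ys))

-- `chain F xs q` adds F over the edges of the walk xs followed by q.
chain : (A → A → ℕ) → List A → A → ℕ
chain F []           q = 0
chain F (x ∷ [])     q = F x q
chain F (x ∷ y ∷ xs) q = F x y + chain F (y ∷ xs) q

cycleSum : (A → A → ℕ) → List A → ℕ
cycleSum F []       = 0
cycleSum F (x ∷ xs) = chain F (x ∷ xs) x

chain-++ : (F : A → A → ℕ) → ∀ xs y ys q → chain F (xs ++ y ∷ ys) q ≡ chain F xs y + chain F (y ∷ ys) q
chain-++ F []            y ys q = refl
chain-++ F (x ∷ [])      y ys q = refl
chain-++ F (x ∷ x' ∷ xs) y ys q = trans (cong (F x x' +_) (chain-++ F (x' ∷ xs) y ys q)) (sym (ℕₚ.+-assoc (F x x') _ _))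

chain-map : (F : B → B → ℕ) (g : A → B) → ∀ xs q → chain F (map g xs) (g q) ≡ chain (λ x y → F (g x) (g y)) xs q
chain-map F g []           q = refl
chain-map F g (x ∷ [])     q = refl
chain-map F g (x ∷ y ∷ xs) q = cong (_ +_) (chain-map F g (y ∷ xs) q)

cycleSum-map : (F : B → B → ℕ) (g : A → B) → ∀ xs → cycleSum F (map g xs) ≡ cycleSum (λ x y → F (g x) (g y)) xs
cycleSum-map F g []       = refl
cycleSum-map F g (x ∷ xs) = chain-map F g (x ∷ xs) x

chain-applyUpTo : (F : A → A → ℕ) (f : ℕ → A) → ∀ n → chain F (applyUpTo f n) (f n) ≡ ∑ n (λ i → F (f i) (f (suc i)))
chain-applyUpTo F f zero          = refl
chain-applyUpTo F f (suc zero)    = ℕₚ.+-comm 0 _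
chain-applyUpTo F f (suc (suc n)) = cong (_ +_) (chain-applyUpTo F (f ∘ suc) (suc n))

weave : (f g : ℕ → A) → ℕ → List A
weave f g zero    = []
weave f g (suc n) = f 0 ∷ g 0 ∷ weave (f ∘ suc) (g ∘ suc) n

length-weave : (f g : ℕ → A) → ∀ n → length (weave f g n) ≡ n + n
length-weave f g zero    = refl
length-weave f g (suc n) = cong suc (trans (cong suc (length-weave (f ∘ suc) (g ∘ suc) n)) (sym (ℕₚ.+-suc n n)))

sumOver-weave : (φ : A → ℕ) (f g : ℕ → A) → ∀ n → sumOver φ (weave f g n) ≡ ∑ n (φ ∘ f) + ∑ n (φ ∘ g)
sumOver-weave φ f g zero    = refl
sumOver-weave φ f g (suc n) = trans (cong (λ k → φ (f 0) + (φ (g 0) + k)) (sumOver-weave φ (f ∘ suc) (g ∘ suc) n))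
                                    (lem (φ (f 0)) (φ (g 0)) _ _)
  where
  lem : ∀ a b c d → a + (b + (c + d)) ≡ (a + c) + (b + d)
  lem = ℕ-solve

chain-weave : (F : A → A → ℕ) (f g : ℕ → A) → ∀ n →
  chain F (weave f g n) (f n) ≡ ∑ n (λ i → F (f i) (g i) + F (g i) (f (suc i)))
chain-weave F f g zero          = refl
chain-weave F f g (suc zero)    = ℕₚ.+-comm 0 _
chain-weave F f g (suc (suc n)) = trans (cong (λ k → F (f 0) (g 0) + (F (g 0) (f 1) + k)) (chain-weave F (f ∘ suc) (g ∘ suc) (suc n)))
                                        (sym (ℕₚ.+-assoc (F (f 0) (g 0)) _ _))

cycleSum-weave : (F : A → A → ℕ) (f g : ℕ → A) → ∀ n → f n ≡ f 0 →
  cycleSum F (weave f g n) ≡ ∑ n (λ i → F (f i) (g i) + F (g i) (f (suc i)))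
cycleSum-weave F f g zero    e = refl
cycleSum-weave F f g (suc n) e = trans (cong (chain F (weave f g (suc n))) (sym e)) (chain-weave F f g (suc n))

∑F : ∀ {n} → (Fin n → ℕ) → ℕ
∑F {zero}  f = 0
∑F {suc n} f = f zero + ∑F (f ∘ suc)

∑F-cong : ∀ {n} {f g : Fin n → ℕ} → (∀ i → f i ≡ g i) → ∑F f ≡ ∑F g
∑F-cong {zero}  e = refl
∑F-cong {suc n} e = cong₂ _+_ (e zero) (∑F-cong (e ∘ suc))

∑F-↑ : ∀ m {n} (f : Fin (m + n) → ℕ) → ∑F f ≡ ∑F {m} (λ i → f (i ↑ˡ n)) + ∑F (λ j → f (m ↑ʳ j))
∑F-↑ zero    f = refl
∑F-↑ (suc m) f = trans (cong (f zero +_) (∑F-↑ m (f ∘ suc))) (sym (ℕₚ.+-assoc (f zero) _ _))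

∑F-combine : ∀ m {n} (f : Fin (m * n) → ℕ) → ∑F f ≡ ∑F {m} (λ i → ∑F {n} (λ j → f (combine i j)))
∑F-combine zero        f = refl
∑F-combine (suc m) {n} f = trans (∑F-↑ n f) (cong (∑F (λ j → f (j ↑ˡ (m * n))) +_) (∑F-combine m (λ k → f (n ↑ʳ k))))

∑F-∑ : ∀ n (f : ℕ → ℕ) → ∑F {n} (f ∘ toℕ) ≡ ∑ n f
∑F-∑ zero    f = refl
∑F-∑ (suc n) f = cong (f 0 +_) (∑F-∑ n (f ∘ suc))

-- Sums over residues modulo n

residue-unique : ∀ n {r r'} (q q' : ℤ) → r < n → r' < n → ⁺ r +ᶻ q *ᶻ ⁺ n ≡ ⁺ r' +ᶻ q' *ᶻ ⁺ n → r ≡ r'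
residue-unique n {r} {r'} q q' r<n r'<n e = ℤₚ.+-injective (ℤₚ.i-j≡0⇒i≡j (⁺ r) (⁺ r') (ℤₚ.∣i∣≡0⇒i≡0 zero-diff))
  where
  rearrange : ∀ (a b c d N : ℤ) → a +ᶻ c *ᶻ N ≡ b +ᶻ d *ᶻ N → a - b ≡ (d - c) *ᶻ N
  rearrange a b c d N eq = trans (lhs a b c N) (trans (cong (λ k → k - b - c *ᶻ N) eq) (rhs b c d N))
    where
    lhs : ∀ (a b c N : ℤ) → a - b ≡ a +ᶻ c *ᶻ N - b - c *ᶻ N
    lhs = solve-∀
    rhs : ∀ (b c d N : ℤ) → b +ᶻ d *ᶻ N - b - c *ᶻ N ≡ (d - c) *ᶻ N
    rhs = solve-∀
  diff : ∣ ⁺ r - ⁺ r' ∣ ≡ ∣ q' - q ∣ * n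
  diff = trans (cong ∣_∣ (rearrange (⁺ r) (⁺ r') q q' (⁺ n) e)) (ℤₚ.abs-* (q' - q) (⁺ n))
  bound : ∣ ⁺ r - ⁺ r' ∣ < n
  bound = subst (_< n) (cong ∣_∣ (sym (ℤₚ.m-n≡m⊖n r r'))) (ℕₚ.≤-<-trans (ℤₚ.∣m⊝n∣≤m⊔n r r') (ℕₚ.⊔-pres-<m r<n r'<n))
  small : ∀ k → ∣ ⁺ r - ⁺ r' ∣ ≡ k * n → ∣ ⁺ r - ⁺ r' ∣ ≡ 0
  small zero    eq = eq
  small (suc k) eq = ⊥-elim (ℕₚ.<-irrefl refl (ℕₚ.<-≤-trans bound (subst (n ≤_) (sym eq) (ℕₚ.m≤m+n n (k * n)))))
  zero-diff : ∣ ⁺ r - ⁺ r' ∣ ≡ 0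
  zero-diff = small ∣ q' - q ∣ diff

-- Indices live in ℤ and are reduced only here. Equalities of indices become ring identities, and
-- reindexing modulo n becomes a statement about `Periodic` functions on ℤ.
ι : ∀ n .{{_ : NonZero n}} → ℤ → Fin n
ι n z = fromℕ< (n%ℕd<d z n)

%ℕ-unique : ∀ n .{{_ : NonZero n}} z q {r} → r < n → z ≡ ⁺ r +ᶻ q *ᶻ ⁺ n → z %ℕ n ≡ r
%ℕ-unique n z q r<n e = residue-unique n (z /ℕ n) q (n%ℕd<d z n) r<n (trans (sym (a≡a%ℕn+[a/ℕn]*n z n)) e)

ι-toℕ : ∀ n .{{_ : NonZero n}} (i : Fin n) → ι n (⁺ toℕ i) ≡ i
ι-toℕ n i = trans (Finₚ.fromℕ<-cong _ (toℕ i) (%ℕ-unique n (⁺ toℕ i) (⁺ 0) (Finₚ.toℕ<n i) (lem (⁺ toℕ i) (⁺ n))) _ (Finₚ.toℕ<n i))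
                  (Finₚ.fromℕ<-toℕ i _)
  where
  lem : ∀ (a b : ℤ) → a ≡ a +ᶻ ⁺ 0 *ᶻ b
  lem = solve-∀

Periodic : {A : Set} → ℕ → (ℤ → A) → Set
Periodic n f = ∀ z → f (z +ᶻ ⁺ n) ≡ f z

ι-periodic : ∀ n .{{_ : NonZero n}} → Periodic n (ι n)
ι-periodic n z = Finₚ.fromℕ<-cong _ _ (%ℕ-unique n (z +ᶻ ⁺ n) (z /ℕ n +ᶻ ⁺ 1) (n%ℕd<d z n)
    (trans (cong (_+ᶻ ⁺ n) (a≡a%ℕn+[a/ℕn]*n z n)) (lem (⁺ (z %ℕ n)) (z /ℕ n) (⁺ n)))) _ _
  where
  lem : ∀ (a b c : ℤ) → a +ᶻ b *ᶻ c +ᶻ c ≡ a +ᶻ (b +ᶻ ⁺ 1) *ᶻ c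
  lem = solve-∀

∑ℤ : ℕ → (ℤ → ℕ) → ℕ
∑ℤ n f = ∑ n (λ t → f (⁺ t))

∑ℤ-cong : ∀ n {f g : ℤ → ℕ} → (∀ z → f z ≡ g z) → ∑ℤ n f ≡ ∑ℤ n g
∑ℤ-cong n e = ∑-cong n (λ t → e (⁺ t))

∑F-ι : ∀ n .{{_ : NonZero n}} (f : Fin n → ℕ) → ∑F f ≡ ∑ℤ n (f ∘ ι n)
∑F-ι n f = trans (∑F-cong (λ i → cong f (sym (ι-toℕ n i)))) (∑F-∑ n (λ t → f (ι n (⁺ t))))

∑ℤ-shift1 : ∀ n (f : ℤ → ℕ) → Periodic n f → ∑ℤ n (λ z → f (z +ᶻ ⁺ 1)) ≡ ∑ℤ n f
∑ℤ-shift1 n f p = ℕₚ.+-cancelˡ-≡ (f (⁺ 0)) _ _ (begin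
  f (⁺ 0) + ∑ n (λ t → f (⁺ t +ᶻ ⁺ 1)) ≡⟨ cong (f (⁺ 0) +_) (∑-cong n (λ t → cong (λ k → f (⁺ k)) (ℕₚ.+-comm t 1))) ⟩
  ∑ (suc n) (λ t → f (⁺ t))            ≡⟨ ∑-snoc n (λ t → f (⁺ t)) ⟩
  ∑ n (λ t → f (⁺ t)) + f (⁺ n)        ≡⟨ ℕₚ.+-comm _ (f (⁺ n)) ⟩
  f (⁺ n) + ∑ℤ n f                     ≡⟨ cong (_+ ∑ℤ n f) (trans (cong f (sym (ℤₚ.+-identityˡ (⁺ n)))) (p (⁺ 0))) ⟩
  f (⁺ 0) + ∑ℤ n f                     ∎)

Periodic-shift : ∀ {A : Set} n (f : ℤ → A) k → Periodic n f → Periodic n (λ z → f (z +ᶻ k))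
Periodic-shift n f k p z = trans (cong f (lem z (⁺ n) k)) (p (z +ᶻ k))
  where
  lem : ∀ (a b c : ℤ) → a +ᶻ b +ᶻ c ≡ a +ᶻ c +ᶻ b
  lem = solve-∀

∑ℤ-shift : ∀ n (f : ℤ → ℕ) → Periodic n f → ∀ k → ∑ℤ n (λ z → f (z +ᶻ k)) ≡ ∑ℤ n f
∑ℤ-shift n f p (⁺ k) = up k
  where
  up : ∀ k → ∑ℤ n (λ z → f (z +ᶻ ⁺ k)) ≡ ∑ℤ n f
  up zero    = ∑ℤ-cong n (λ z → cong f (ℤₚ.+-identityʳ z))
  up (suc k) = trans (∑ℤ-cong n (λ z → cong f (sym (ℤₚ.+-assoc z (⁺ 1) (⁺ k)))))
                     (trans (∑ℤ-shift1 n (λ z → f (z +ᶻ ⁺ k)) (Periodic-shift n f (⁺ k) p)) (up k))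
∑ℤ-shift n f p -[1+ k ] = sym (trans (∑ℤ-cong n (λ z → cong f (lem z (-[1+ k ]))))
    (∑ℤ-shift n (λ z → f (z +ᶻ -[1+ k ])) (Periodic-shift n f (-[1+ k ]) p) (⁺ suc k)))
  where
  lem : ∀ (a b : ℤ) → a ≡ a +ᶻ - b +ᶻ b
  lem = solve-∀

-- Reversing the order of summation turns the reflection into a translation, to which `∑ℤ-shift`
-- applies.
∑ℤ-reflect : ∀ n (f : ℤ → ℕ) → Periodic n f → ∀ k → ∑ℤ n (λ z → f (k - z)) ≡ ∑ℤ n f
∑ℤ-reflect n f p k = trans (sym (∑-reverse n (λ t → f (k - ⁺ t))))
    (trans (∑-cong-< n λ i i<n → cong f (lem i<n)) (∑ℤ-shift n f p (k +ᶻ ⁺ 1 - ⁺ n)))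
  where
  ring-lem : ∀ (k n i : ℤ) → k - (n - (⁺ 1 +ᶻ i)) ≡ i +ᶻ (k +ᶻ ⁺ 1 - n)
  ring-lem = solve-∀
  lem : ∀ {i} → i < n → k - ⁺ (n ∸ suc i) ≡ ⁺ i +ᶻ (k +ᶻ ⁺ 1 - ⁺ n)
  lem {i} i<n = trans (cong (λ j → k - j) (sym (trans (ℤₚ.m-n≡m⊖n n (suc i)) (ℤₚ.⊖-≥ i<n)))) (ring-lem k (⁺ n) (⁺ i))

-- Base factorizations and lifts, specified by weighted sums

Symmetric : (A → A → ℕ) → Set
Symmetric F = ∀ x y → F x y ≡ F y x

-- Multiplicities are encoded by identities between sums with arbitrary weights: `covers` says that each
-- point except the hole is used once, `edges` that each edge is used twice.
record NearFactorization (u a : ℕ) : Set where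
  field
    factors : List (Fin u × List (List (Fin u)))
    lengths : All (λ p → All (λ C → length C ≡ a) (proj₂ p)) factors
    covers  : All (λ p → ∀ f → sumOver (sumOver f) (proj₂ p) + f (proj₁ p) ≡ ∑F f) factors
    edges   : ∀ F → Symmetric F →
              sumOver (λ p → sumOver (cycleSum F) (proj₂ p)) factors + ∑F (λ x → F x x) ≡ ∑F (λ x → ∑F (F x))

-- In round r of the copy y, even positions of a base cycle get the second coordinate z y r and odd
-- positions w y r.
record Lift (g m b : ℕ) : Set where
  field
    z w     : ℕ → ℕ → Fin g
    z-wrap  : ∀ y → z y b ≡ z y 0
    z-cover : ∀ f → ∑ m (λ y → ∑ b (λ r → f (z y r))) ≡ ∑F f
    w-cover : ∀ f → ∑ m (λ y → ∑ b (λ r → f (w y r))) ≡ ∑F f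

liftSum : ∀ {g m b} → List (Lift g m b) → (Lift g m b → ℕ → ℕ → ℕ) → ℕ
liftSum {m = m} {b} Ls G = sumOver (λ L → ∑ m (λ y → ∑ b (λ r → G L y r))) Ls

record LiftSystem (g m b : ℕ) : Set where
  open Lift
  field
    lifts : List (Lift g m b)
    D     : (Fin g → Fin g → ℕ) → ℕ
    zw    : ∀ H → liftSum lifts (λ L y r → H (z L y r) (w L y r)) ≡ D H
    wz    : ∀ H → liftSum lifts (λ L y r → H (w L y r) (z L y r)) ≡ D H
    wz⁺   : ∀ H → liftSum lifts (λ L y r → H (w L y r) (z L y (suc r))) ≡ D H
    total : ∀ H → D H + ∑F (λ x → H x x) ≡ ∑F (λ x → ∑F (H x))

liftSum-cong : ∀ {g m b} (Ls : List (Lift g m b)) {G G' : Lift g m b → ℕ → ℕ → ℕ} →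
  (∀ L y r → G L y r ≡ G' L y r) → liftSum Ls G ≡ liftSum Ls G'
liftSum-cong {m = m} {b} Ls e = sumOver-cong (λ L → ∑-cong m (λ y → ∑-cong b (e L y))) Ls

∑∑-+ : ∀ m b (G G' : ℕ → ℕ → ℕ) →
  ∑ m (λ y → ∑ b (λ r → G y r + G' y r)) ≡ ∑ m (λ y → ∑ b (G y)) + ∑ m (λ y → ∑ b (G' y))
∑∑-+ m b G G' = trans (∑-cong m (λ y → ∑-+ b (G y) (G' y))) (∑-+ m _ _)

liftSum-+ : ∀ {g m b} (Ls : List (Lift g m b)) (G G' : Lift g m b → ℕ → ℕ → ℕ) →
  liftSum Ls (λ L y r → G L y r + G' L y r) ≡ liftSum Ls G + liftSum Ls G'
liftSum-+ {m = m} {b} Ls G G' = trans (sumOver-cong (λ L → ∑∑-+ m b (G L) (G' L)) Ls) (sumOver-+ _ _ Ls)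

alternate : A → A → List B → List (B × A)
alternate z w []       = []
alternate z w (v ∷ vs) = (v , z) ∷ alternate w z vs

length-alternate : (z w : A) (C : List B) → length (alternate z w C) ≡ length C
length-alternate z w []      = refl
length-alternate z w (v ∷ C) = cong suc (length-alternate w z C)

Even : List A → Set
Even []           = ⊤
Even (x ∷ [])     = ⊥
Even (x ∷ y ∷ xs) = Even xs

even-length : ∀ h (xs : List A) → length xs ≡ h + h → Even xs
even-length zero    []           e = tt
even-length (suc h) []           e = tt
even-length (suc h) (x ∷ [])     e with () ← trans e (cong suc (ℕₚ.+-suc h h))
even-length (suc h) (x ∷ y ∷ xs) e =
  even-length h xs (ℕₚ.suc-injective (ℕₚ.suc-injective (trans e (cong suc (ℕₚ.+-suc h h)))))

-- The roles of `p` and `q` are exchanged at each vertex of `C`, so the induction needs two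
-- arbitrary sequences that both cover `Fin g`.
∑∑-alternate : ∀ {g m b} (p q : ℕ → ℕ → Fin g)
  → (∀ f → ∑ m (λ y → ∑ b (λ r → f (p y r))) ≡ ∑F f)
  → (∀ f → ∑ m (λ y → ∑ b (λ r → f (q y r))) ≡ ∑F f)
  → (f : A × Fin g → ℕ) (C : List A)
  → ∑ m (λ y → ∑ b (λ r → sumOver f (alternate (p y r) (q y r) C))) ≡ sumOver (λ v → ∑F (λ x → f (v , x))) C
∑∑-alternate {m = m} {b} p q cp cq f []      = trans (∑-cong m (λ _ → ∑-0 b)) (∑-0 m)
∑∑-alternate {m = m} {b} p q cp cq f (v ∷ C) =
  trans (∑∑-+ m b _ _) (cong₂ _+_ (cp (λ x → f (v , x))) (∑∑-alternate {m = m} {b} q p cq cp f C))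

chain-concat : (F : A → A → ℕ) (hd : ℕ → A) (tl : ℕ → List A) → ∀ n →
  chain F (concat (applyUpTo (λ r → hd r ∷ tl r) n)) (hd n) ≡ ∑ n (λ r → chain F (hd r ∷ tl r) (hd (suc r)))
chain-concat F hd tl zero          = refl
chain-concat F hd tl (suc zero)    = trans (cong (λ l → chain F l (hd 1)) (++-identityʳ (hd 0 ∷ tl 0))) (ℕₚ.+-comm 0 _)
chain-concat F hd tl (suc (suc n)) =
  trans (chain-++ F (hd 0 ∷ tl 0) (hd 1) _ (hd (suc (suc n))))
        (cong (chain F (hd 0 ∷ tl 0) (hd 1) +_) (chain-concat F (hd ∘ suc) (tl ∘ suc) (suc n)))

cycleSum-concat : (F : A → A → ℕ) (hd : ℕ → A) (tl : ℕ → List A) → ∀ n → hd n ≡ hd 0 →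
  cycleSum F (concat (applyUpTo (λ r → hd r ∷ tl r) n)) ≡ ∑ n (λ r → chain F (hd r ∷ tl r) (hd (suc r)))
cycleSum-concat F hd tl zero    e = refl
cycleSum-concat F hd tl (suc n) e =
  trans (cong (chain F (concat (applyUpTo (λ r → hd r ∷ tl r) (suc n)))) (sym e)) (chain-concat F hd tl (suc n))

-- Indicators of vertices and edges

∑F-0 : ∀ {n} → ∑F {n} (λ _ → 0) ≡ 0
∑F-0 {zero}  = refl
∑F-0 {suc n} = ∑F-0 {n}

∑F-+ : ∀ {n} (f g : Fin n → ℕ) → ∑F (λ i → f i + g i) ≡ ∑F f + ∑F g
∑F-+ {zero}  f g = refl
∑F-+ {suc n} f g = trans (cong (f zero + g zero +_) (∑F-+ (f ∘ suc) (g ∘ suc)))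
                         (+-exchange (f zero) (g zero) (∑F (f ∘ suc)) (∑F (g ∘ suc)))

∑F-*ˡ : ∀ {n} c (f : Fin n → ℕ) → ∑F (λ i → c * f i) ≡ c * ∑F f
∑F-*ˡ {zero}  c f = sym (ℕₚ.*-zeroʳ c)
∑F-*ˡ {suc n} c f = trans (cong (c * f zero +_) (∑F-*ˡ c (f ∘ suc))) (sym (ℕₚ.*-distribˡ-+ c (f zero) (∑F (f ∘ suc))))

∑F-zero : ∀ {n} {f : Fin n → ℕ} → (∀ i → f i ≡ 0) → ∑F f ≡ 0
∑F-zero {n} e = trans (∑F-cong e) (∑F-0 {n})

∑F-single : ∀ {n} (f : Fin n → ℕ) i → (∀ j → j ≢ i → f j ≡ 0) → ∑F f ≡ f i
∑F-single {suc n} f zero    e = trans (cong (f zero +_) (∑F-zero (λ j → e (suc j) (λ ())))) (ℕₚ.+-identityʳ _)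
∑F-single {suc n} f (suc i) e = trans (cong (_+ ∑F (f ∘ suc)) (e zero (λ ())))
  (∑F-single (f ∘ suc) i (λ j j≢i → e (suc j) (λ { refl → j≢i refl })))

∑F-diagonal : ∀ {n} (H : Fin n → Fin n → ℕ) → (∀ x y → x ≢ y → H x y ≡ 0) → ∑F (λ x → ∑F (H x)) ≡ ∑F (λ x → H x x)
∑F-diagonal H e = ∑F-cong (λ x → ∑F-single (H x) x (λ y y≢x → e x y (λ x≡y → y≢x (sym x≡y))))

𝟙 : {P : Set} → Dec P → ℕ
𝟙 (yes _) = 1
𝟙 (no _)  = 0

𝟙-yes : {P : Set} (d : Dec P) → P → 𝟙 d ≡ 1
𝟙-yes (yes _) p = refl
𝟙-yes (no ¬p) p = ⊥-elim (¬p p)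

𝟙-no : {P : Set} (d : Dec P) → ¬ P → 𝟙 d ≡ 0
𝟙-no (yes p) ¬p = ⊥-elim (¬p p)
𝟙-no (no _)  ¬p = refl

length-filter : {P : A → Set} (P? : Decidable P) (xs : List A) → length (filter P? xs) ≡ sumOver (λ x → 𝟙 (P? x)) xs
length-filter P? []       = refl
length-filter P? (x ∷ xs) with P? x
... | yes _ = cong suc (length-filter P? xs)
... | no  _ = length-filter P? xs

f≤sumOver : (f : A → ℕ) {x : A} {xs : List A} → x ∈ xs → f x ≤ sumOver f xs
f≤sumOver f (here refl) = ℕₚ.m≤m+n _ _
f≤sumOver f (there i)   = ℕₚ.≤-trans (f≤sumOver f i) (ℕₚ.m≤n+m _ _)

sumOver-cycEdges : (F : A → A → ℕ) (C : List A) → sumOver (uncurry F) (cycEdges C) ≡ cycleSum F C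
sumOver-cycEdges F []       = refl
sumOver-cycEdges F (x ∷ xs) = go x xs x
  where
  go : ∀ x xs q → sumOver (uncurry F) (zip (x ∷ xs) (xs ++ q ∷ [])) ≡ chain F (x ∷ xs) q
  go x []       q = ℕₚ.+-comm (F x q) 0
  go x (y ∷ xs) q = cong (F x y +_) (go y xs q)

module _ {u g : ℕ} where

  δ : Vertex u g → Vertex u g → ℕ
  δ v x = 𝟙 (x ≟V v)

  δ-≢ : ∀ v x → x ≢ v → δ v x ≡ 0
  δ-≢ v x = 𝟙-no (x ≟V v)

  δ-≡ : ∀ v → δ v v ≡ 1
  δ-≡ v = 𝟙-yes (v ≟V v) refl

  ∑δ-row : ∀ a b x → x ≢ a → ∑F (λ z → δ (a , b) (x , z)) ≡ 0
  ∑δ-row a b x x≢a = ∑F-zero (λ z → δ-≢ (a , b) (x , z) (λ e → x≢a (cong proj₁ e)))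

  ∑δ-own : ∀ a b → ∑F (λ z → δ (a , b) (a , z)) ≡ 1
  ∑δ-own a b = trans (∑F-single _ b (λ z z≢b → δ-≢ (a , b) (a , z) (λ e → z≢b (cong proj₂ e)))) (δ-≡ (a , b))

  ∑∑δ : ∀ v → ∑F (λ x → ∑F (λ z → δ v (x , z))) ≡ 1
  ∑∑δ (a , b) = trans (∑F-single _ a (λ x → ∑δ-row a b x)) (∑δ-own a b)

  occ-sum : ∀ v xs → occ v xs ≡ sumOver (δ v) xs
  occ-sum v xs = length-filter (λ w → w ≟V v) xs

  unique : (xs : List (Vertex u g)) → (∀ v → sumOver (δ v) xs ≤ 1) → Unique xs
  unique []       e = []
  unique (x ∷ xs) e = All.tabulate (λ {y} y∈xs x≡y → absurd y y∈xs x≡y) ∷ unique xs (λ v → ℕₚ.≤-trans (ℕₚ.m≤n+m _ _) (e v))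
    where
    absurd : ∀ y → y ∈ xs → x ≡ y → ⊥
    absurd y y∈xs refl with e x
    ... | le rewrite δ-≡ x = ℕₚ.<-irrefl refl (ℕₚ.≤-trans (s≤s (subst (_≤ sumOver (δ x) xs) (δ-≡ x) (f≤sumOver (δ x) y∈xs))) le)

  -- For p ≠ q this is the indicator of the edge {p,q}; the product form lets the sums factor.
  pairing : Vertex u g → Vertex u g → Vertex u g → Vertex u g → ℕ
  pairing p q a b = δ p a * δ q b + δ q a * δ p b

  pairing-sym : ∀ p q → Symmetric (pairing p q)
  pairing-sym p q a b = lem (δ p a) (δ q b) (δ q a) (δ p b)
    where
    lem : ∀ x y z w → x * y + z * w ≡ w * z + y * x
    lem = ℕ-solve

  pairing-0 : ∀ p q a b → ¬ (a ≡ p × b ≡ q) → ¬ (a ≡ q × b ≡ p) → pairing p q a b ≡ 0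
  pairing-0 p q a b n₁ n₂ = cong₂ _+_ (prod p q n₁) (prod q p n₂)
    where
    prod : ∀ p q → ¬ (a ≡ p × b ≡ q) → δ p a * δ q b ≡ 0
    prod p q n with a ≟V p
    ... | no _ = refl
    ... | yes e₁ with b ≟V q
    ...   | no _   = refl
    ...   | yes e₂ = ⊥-elim (n (e₁ , e₂))

  pairing-self : ∀ p q → 1 ≤ pairing p q p q
  pairing-self p q rewrite δ-≡ p | δ-≡ q = s≤s z≤n

∑∑ : ∀ {u g} → (Vertex u g → ℕ) → ℕ
∑∑ f = ∑F (λ x → ∑F (λ z → f (x , z)))

∑∑-+F : ∀ {u g} (f h : Vertex u g → ℕ) → ∑∑ (λ v → f v + h v) ≡ ∑∑ f + ∑∑ h
∑∑-+F f h = trans (∑F-cong (λ x → ∑F-+ (λ z → f (x , z)) (λ z → h (x , z))))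
                    (∑F-+ (λ x → ∑F (λ z → f (x , z))) (λ x → ∑F (λ z → h (x , z))))

∑∑-* : ∀ {u g} c (f : Vertex u g → ℕ) → ∑∑ (λ v → c * f v) ≡ c * ∑∑ f
∑∑-* {u} {g} c f = trans (∑F-cong (λ x → ∑F-*ˡ c (λ z → f (x , z)))) (∑F-*ˡ c (λ x → ∑F (λ z → f (x , z))))

∑∑-cong : ∀ {u g} {f h : Vertex u g → ℕ} → (∀ v → f v ≡ h v) → ∑∑ f ≡ ∑∑ h
∑∑-cong e = ∑F-cong (λ x → ∑F-cong (λ z → e (x , z)))

-- Each of the two orders of the pair contributes 1. This 2 becomes the multiplicity λ of the
-- theorem.
∑∑-pairing : ∀ {u g} (p q : Vertex u g) → ∑∑ (λ a → ∑∑ (pairing p q a)) ≡ 2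
∑∑-pairing p q = begin
  ∑∑ (λ a → ∑∑ (pairing p q a))             ≡⟨ ∑∑-cong (λ a → trans (∑∑-+F (λ b → δ p a * δ q b) (λ b → δ q a * δ p b)) (cong₂ _+_ (inner p q a) (inner q p a))) ⟩
  ∑∑ (λ a → δ p a + δ q a)                  ≡⟨ ∑∑-+F (δ p) (δ q) ⟩
  ∑∑ (δ p) + ∑∑ (δ q)                       ≡⟨ cong₂ _+_ (∑∑δ p) (∑∑δ q) ⟩
  2                                         ∎
  where
  inner : ∀ p q a → ∑∑ (λ b → δ p a * δ q b) ≡ δ p a
  inner p q a = trans (∑∑-* (δ p a) (δ q)) (trans (cong (δ p a *_) (∑∑δ q)) (ℕₚ.*-identityʳ _))

∑F-swap : ∀ {m n} (f : Fin m → Fin n → ℕ) → ∑F (λ x → ∑F (f x)) ≡ ∑F (λ y → ∑F (λ x → f x y))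
∑F-swap {zero}  {n} f = sym (∑F-0 {n})
∑F-swap {suc m} f = trans (cong (∑F (f zero) +_) (∑F-swap (f ∘ suc))) (sym (∑F-+ (f zero) _))

-- Lifting a base factorization to the tensor product

module Tensor {u g m b h : ℕ} (nf : NearFactorization u (h + h)) (ls : LiftSystem g m b) where
  open NearFactorization nf
  open Lift
  open LiftSystem ls

  V : Set
  V = Vertex u g

  -- The walk goes `b` times around `C`, with fixed second coordinates `z` and `w` during one round.
  -- For `C` of even length a round starts at `z` and ends at `w`, so the arc to the next round
  -- joins `w L y r` to `z L y (suc r)`.
  liftCycle : Lift g m b → List (Fin u) → ℕ → List V
  liftCycle L C y = concat (applyUpTo (λ r → alternate (z L y r) (w L y r) C) b)

  liftFactor : List (List (Fin u)) → Lift g m b → List (List V)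
  liftFactor Cs L = concatMap (λ C → applyUpTo (liftCycle L C) m) Cs

  arcs : List (List (List V))
  arcs = concatMap (λ p → map (liftFactor (proj₂ p)) lifts) factors

  length-liftCycle : ∀ L C y → length (liftCycle L C y) ≡ b * length C
  length-liftCycle L C y = go b (z L y) (w L y)
    where
    go : ∀ n (p q : ℕ → Fin g) → length (concat (applyUpTo (λ r → alternate (p r) (q r) C) n)) ≡ n * length C
    go zero    p q = refl
    go (suc n) p q = trans (length-++ (alternate (p 0) (q 0) C)) (cong₂ _+_ (length-alternate (p 0) (q 0) C) (go n (p ∘ suc) (q ∘ suc)))

  sumOver-liftCycle : ∀ (f : V → ℕ) L C y → sumOver f (liftCycle L C y) ≡ ∑ b (λ r → sumOver f (alternate (z L y r) (w L y r) C))
  sumOver-liftCycle f L C y = trans (sumOver-concat f (applyUpTo (λ r → alternate (z L y r) (w L y r) C) b))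
                                    (sumOver-applyUpTo (sumOver f) _ b)

  sumOver-liftFactor : ∀ (f : V → ℕ) L Cs → sumOver f (concat (liftFactor Cs L)) ≡ sumOver (sumOver (λ v → ∑F (λ x → f (v , x)))) Cs
  sumOver-liftFactor f L Cs = begin
    sumOver f (concat (liftFactor Cs L))                                   ≡⟨ sumOver-concat f (liftFactor Cs L) ⟩
    sumOver (sumOver f) (liftFactor Cs L)                                  ≡⟨ sumOver-concatMap (sumOver f) _ Cs ⟩
    sumOver (λ C → sumOver (sumOver f) (applyUpTo (liftCycle L C) m)) Cs   ≡⟨ sumOver-cong step Cs ⟩
    sumOver (sumOver (λ v → ∑F (λ x → f (v , x)))) Cs                      ∎
    where
    step : ∀ C → sumOver (sumOver f) (applyUpTo (liftCycle L C) m) ≡ sumOver (λ v → ∑F (λ x → f (v , x))) C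
    step C = trans (sumOver-applyUpTo (sumOver f) (liftCycle L C) m)
      (trans (∑-cong m (sumOver-liftCycle f L C))
             (∑∑-alternate {m = m} {b} (z L) (w L) (z-cover L) (w-cover L) f C))

  cover-liftFactor : ∀ c Cs → (∀ f → sumOver (sumOver f) Cs + f c ≡ ∑F f) → ∀ L (f : V → ℕ) →
    sumOver f (concat (liftFactor Cs L)) + ∑F (λ x → f (c , x)) ≡ ∑∑ f
  cover-liftFactor c Cs cov L f = trans (cong (_+ ∑F (λ x → f (c , x))) (sumOver-liftFactor f L Cs)) (cov (λ v → ∑F (λ x → f (v , x))))

  module Edges (F : V → V → ℕ) where

    -- By `total`, this is the weight of all pairs (a , x), (c , y) with x ≠ y; for a ≠ c these are
    -- the edges of the tensor product lying over the base arc from a to c.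
    F̄ : Fin u → Fin u → ℕ
    F̄ a c = D (λ x y → F (a , x) (c , y))

    -- Parity is that of the position in the base cycle. Arcs leaving even positions are summed by
    -- `zw`, arcs leaving odd positions by `wz`, and only the arc entering the next round by `wz⁺`.
    -- Evenness of the remaining list guarantees that this last arc starts at a `w`.
    even-chain : ∀ C q → Even C →
      liftSum lifts (λ L y r → chain F (alternate (z L y r) (w L y r) C) (q , z L y (suc r))) ≡ chain F̄ C q
    odd-chain : ∀ v C q → Even C →
      liftSum lifts (λ L y r → chain F (alternate (w L y r) (z L y r) (v ∷ C)) (q , z L y (suc r))) ≡ chain F̄ (v ∷ C) q
    even-chain []           q e = trans (sumOver-cong (λ L → trans (∑-cong m (λ _ → ∑-0 b)) (∑-0 m)) lifts) (sumOver-0 lifts)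
    even-chain (v ∷ v' ∷ C) q e = trans (liftSum-+ lifts _ _) (cong₂ _+_ (zw (λ x y → F (v , x) (v' , y))) (odd-chain v' C q e))
    odd-chain v []            q e = wz⁺ (λ x y → F (v , x) (q , y))
    odd-chain v (v' ∷ v″ ∷ C) q e = trans (liftSum-+ lifts _ _) (cong₂ _+_ (wz (λ x y → F (v , x) (v' , y))) (even-chain (v' ∷ v″ ∷ C) q e))

    cycleSum-lifts : ∀ C → Even C → sumOver (λ L → ∑ m (λ y → cycleSum F (liftCycle L C y))) lifts ≡ cycleSum F̄ C
    cycleSum-lifts [] e = trans (sumOver-cong (λ L → trans (∑-cong m (λ y → cong (cycleSum F) (empty (z L y) (w L y) b))) (∑-0 m)) lifts) (sumOver-0 lifts)
      where
      empty : ∀ (p q : ℕ → Fin g) n → concat (applyUpTo (λ r → alternate {B = Fin u} (p r) (q r) []) n) ≡ []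
      empty p q zero    = refl
      empty p q (suc n) = empty (p ∘ suc) (q ∘ suc) n
    cycleSum-lifts (v ∷ C) e = trans
      (sumOver-cong (λ L → ∑-cong m (λ y →
        cycleSum-concat F (λ r → v , z L y r) (λ r → alternate (w L y r) (z L y r) C) b (cong (v ,_) (z-wrap L y)))) lifts)
      (even-chain (v ∷ C) v e)

    edgeSum-arcs : sumOver (sumOver (cycleSum F)) arcs ≡ sumOver (λ p → sumOver (cycleSum F̄) (proj₂ p)) factors
    edgeSum-arcs = trans (sumOver-concatMap (sumOver (cycleSum F)) _ factors) (onFactors factors lengths)
      where
      onCycles : ∀ Cs → All (λ C → length C ≡ h + h) Cs →
        sumOver (λ L → sumOver (cycleSum F) (liftFactor Cs L)) lifts ≡ sumOver (cycleSum F̄) Cs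
      onCycles []       []       = sumOver-0 lifts
      onCycles (C ∷ Cs) (l ∷ ls) = begin
        sumOver (λ L → sumOver (cycleSum F) (applyUpTo (liftCycle L C) m ++ liftFactor Cs L)) lifts
          ≡⟨ sumOver-cong (λ L → trans (sumOver-++ (cycleSum F) (applyUpTo (liftCycle L C) m) (liftFactor Cs L))
               (cong (_+ sumOver (cycleSum F) (liftFactor Cs L)) (sumOver-applyUpTo (cycleSum F) (liftCycle L C) m))) lifts ⟩
        sumOver (λ L → ∑ m (λ y → cycleSum F (liftCycle L C y)) + sumOver (cycleSum F) (liftFactor Cs L)) lifts
          ≡⟨ sumOver-+ _ _ lifts ⟩
        sumOver (λ L → ∑ m (λ y → cycleSum F (liftCycle L C y))) lifts + sumOver (λ L → sumOver (cycleSum F) (liftFactor Cs L)) lifts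
          ≡⟨ cong₂ _+_ (cycleSum-lifts C (even-length h C l)) (onCycles Cs ls) ⟩
        cycleSum F̄ C + sumOver (cycleSum F̄) Cs ∎
      onFactors : ∀ ps → All (λ p → All (λ C → length C ≡ h + h) (proj₂ p)) ps →
        sumOver (λ p → sumOver (sumOver (cycleSum F)) (map (liftFactor (proj₂ p)) lifts)) ps
          ≡ sumOver (λ p → sumOver (cycleSum F̄) (proj₂ p)) ps
      onFactors []       []       = refl
      onFactors (p ∷ ps) (l ∷ ls) = cong₂ _+_
        (trans (sumOver-map (sumOver (cycleSum F)) (liftFactor (proj₂ p)) lifts) (onCycles (proj₂ p) l))
        (onFactors ps ls)

    module _ (F-sym : Symmetric F) where

      -- Reversing an arc exchanges `zw` and `wz`, and both sum to `D`.
      F̄-sym : Symmetric F̄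
      F̄-sym a c = trans (sym (zw _)) (trans (liftSum-cong lifts (λ L y r → F-sym _ _)) (wz (λ x y → F (c , x) (a , y))))

      edge-identity : sumOver (sumOver (cycleSum F)) arcs + ∑F (λ x → F̄ x x) ≡ ∑F (λ x → ∑F (F̄ x))
      edge-identity = trans (cong (_+ ∑F (λ x → F̄ x x)) edgeSum-arcs) (edges F̄ F̄-sym)

  D-0 : ∀ H → (∀ x y → x ≢ y → H x y ≡ 0) → D H ≡ 0
  D-0 H e = ℕₚ.+-cancelʳ-≡ (∑F (λ x → H x x)) (D H) 0 (trans (total H) (∑F-diagonal H e))

  D-all : ∀ H → (∀ x → H x x ≡ 0) → D H ≡ ∑F (λ x → ∑F (H x))
  D-all H e = trans (sym (ℕₚ.+-identityʳ (D H))) (trans (cong (D H +_) (sym (∑F-zero e))) (total H))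

  edgeSum : V → V → ℕ
  edgeSum p q = sumOver (sumOver (cycleSum (pairing p q))) arcs

  module _ (p q : V) where
    open Edges (pairing p q)

    -- For nonadjacent p, q the projected weight `F̄` vanishes off the diagonal, so `edge-identity`
    -- has the same diagonal sum on both sides.
    edgeSum-nonadjacent : ¬ Adj p q → edgeSum p q ≡ 0
    edgeSum-nonadjacent ¬adj = cancel (trans (edge-identity (pairing-sym p q)) (∑F-diagonal F̄ off))
      where
      cancel : edgeSum p q + ∑F (λ x → F̄ x x) ≡ ∑F (λ x → F̄ x x) → edgeSum p q ≡ 0
      cancel e = ℕₚ.+-cancelʳ-≡ (∑F (λ x → F̄ x x)) (edgeSum p q) 0 e
      off : ∀ x y → x ≢ y → F̄ x y ≡ 0
      off x y x≢y = D-0 _ (λ i j i≢j → pairing-0 p q (x , i) (y , j)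
        (λ { (refl , refl) → ¬adj (x≢y , i≢j) })
        (λ { (refl , refl) → ¬adj ((λ e → x≢y (sym e)) , (λ e → i≢j (sym e))) }))

    edgeSum-adjacent : Adj p q → edgeSum p q ≡ 2
    edgeSum-adjacent (p₁≢q₁ , p₂≢q₂) = begin
      edgeSum p q                                                     ≡⟨ ℕₚ.+-identityʳ _ ⟨
      edgeSum p q + 0                                                 ≡⟨ cong (edgeSum p q +_) (∑F-zero diag) ⟨
      edgeSum p q + ∑F (λ x → F̄ x x)                                  ≡⟨ edge-identity (pairing-sym p q) ⟩
      -- Since p₂ ≠ q₂, the weight vanishes when the second coordinates agree, so `D` may be
      -- replaced by the full double sum; `diag` used p₁ ≠ q₁ in the same way.
      ∑F (λ x → ∑F (F̄ x))                                             ≡⟨ ∑F-cong (λ x → ∑F-cong (λ y → D-all _ (λ i → pairing-0 p q (x , i) (y , i)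
                                                                          (λ { (refl , refl) → p₂≢q₂ refl }) (λ { (refl , refl) → p₂≢q₂ refl })))) ⟩
      ∑F (λ x → ∑F (λ y → ∑F (λ i → ∑F (λ j → pairing p q (x , i) (y , j)))))  ≡⟨ ∑F-cong (λ x → ∑F-swap (λ y i → ∑F (λ j → pairing p q (x , i) (y , j)))) ⟩
      ∑∑ (λ a → ∑∑ (pairing p q a))                                   ≡⟨ ∑∑-pairing p q ⟩
      2                                                               ∎
      where
      diag : ∀ x → F̄ x x ≡ 0
      diag x = trans (D-all _ (λ i → none i i)) (∑F-zero (λ i → ∑F-zero (none i)))
        where
        none : ∀ i j → pairing p q (x , i) (x , j) ≡ 0
        none i j = pairing-0 p q (x , i) (x , j) (λ { (refl , refl) → p₁≢q₁ refl }) (λ { (refl , refl) → p₁≢q₁ refl })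

  adjacent? : ∀ (p q : V) → Dec (Adj p q)
  adjacent? (a , x) (c , y) with a Finₚ.≟ c | x Finₚ.≟ y
  ... | yes e  | _      = no (λ (n , _) → n e)
  ... | no  _  | yes e  = no (λ (_ , n) → n e)
  ... | no  n₁ | no  n₂ = yes (n₁ , n₂)

  -- A consecutive pair of any cycle contributes at least 1 to its own `edgeSum`, which would be 0
  -- if the pair were not adjacent.
  arcs-adjacent : ∀ {Fc C e} → Fc ∈ arcs → C ∈ Fc → e ∈ cycEdges C → Adj (proj₁ e) (proj₂ e)
  arcs-adjacent {Fc} {C} {p , q} Fc∈ C∈ e∈ with adjacent? p q
  ... | yes adj = adj
  ... | no ¬adj = ⊥-elim (ℕₚ.<-irrefl refl (ℕₚ.≤-trans (pairing-self p q) (subst (pairing p q p q ≤_) (edgeSum-nonadjacent p q ¬adj)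
      (ℕₚ.≤-trans (f≤sumOver (uncurry (pairing p q)) e∈)
      (ℕₚ.≤-trans (ℕₚ.≤-reflexive (sumOver-cycEdges (pairing p q) C))
      (ℕₚ.≤-trans (f≤sumOver (cycleSum (pairing p q)) C∈) (f≤sumOver (sumOver (cycleSum (pairing p q))) Fc∈)))))))

  edgeMult-edgeSum : ∀ p q → p ≢ q → edgeMult arcs p q ≡ edgeSum p q
  edgeMult-edgeSum p q p≢q = begin
    edgeMult arcs p q                                                        ≡⟨ length-filter _ (concatMap (concatMap cycEdges) arcs) ⟩
    sumOver _ (concatMap (concatMap cycEdges) arcs)                          ≡⟨ sumOver-cong (λ e → indicator e _) (concatMap (concatMap cycEdges) arcs) ⟩
    sumOver (uncurry (pairing p q)) (concatMap (concatMap cycEdges) arcs)    ≡⟨ sumOver-concatMap _ (concatMap cycEdges) arcs ⟩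
    sumOver (λ Fc → sumOver (uncurry (pairing p q)) (concatMap cycEdges Fc)) arcs
      ≡⟨ sumOver-cong (λ Fc → trans (sumOver-concatMap _ cycEdges Fc) (sumOver-cong (sumOver-cycEdges (pairing p q)) Fc)) arcs ⟩
    edgeSum p q                                                              ∎
    where
    indicator : ∀ e (d : Dec (e ≡ (p , q) ⊎ e ≡ (q , p))) → 𝟙 d ≡ uncurry (pairing p q) e
    indicator (a , c) (yes (inj₁ refl)) rewrite δ-≡ p | δ-≡ q | δ-≢ q p p≢q = refl
    indicator (a , c) (yes (inj₂ refl)) rewrite δ-≡ p | δ-≡ q | δ-≢ p q (λ e → p≢q (sym e)) = refl
    indicator (a , c) (no n)            = sym (pairing-0 p q a c (λ { (refl , refl) → n (inj₁ refl) }) (λ { (refl , refl) → n (inj₂ refl) }))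

  isFactor : ∀ {c Cs L} → (c , Cs) ∈ factors → L ∈ lifts → liftFactor Cs L ∈ arcs → IsPartialCkFactor u g (b * (h + h)) (liftFactor Cs L)
  isFactor {c} {Cs} {L} p∈ L∈ Fc∈ = All.tabulate isCycle , c , λ v → (λ { refl → outside v refl }) , inside v
    where
    cov : ∀ (f : V → ℕ) → sumOver f (concat (liftFactor Cs L)) + ∑F (λ x → f (c , x)) ≡ ∑∑ f
    cov = cover-liftFactor c Cs (All.lookup covers p∈) L
    count : ∀ v → sumOver (δ v) (concat (liftFactor Cs L)) + ∑F (λ x → δ v (c , x)) ≡ 1
    count v = trans (cov (δ v)) (∑∑δ v)
    outside : ∀ v → proj₁ v ≡ c → occ v (concat (liftFactor Cs L)) ≡ 0
    outside (_ , i) refl = trans (occ-sum (c , i) (concat (liftFactor Cs L)))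
      (ℕₚ.+-cancelʳ-≡ 1 (sumOver (δ (c , i)) (concat (liftFactor Cs L))) 0
        (trans (cong (sumOver (δ (c , i)) (concat (liftFactor Cs L)) +_) (sym (∑δ-own c i))) (count (c , i))))
    inside : ∀ v → proj₁ v ≢ c → occ v (concat (liftFactor Cs L)) ≡ 1
    inside (a , i) a≢c = trans (occ-sum (a , i) (concat (liftFactor Cs L))) (trans (sym (ℕₚ.+-identityʳ _))
      (trans (cong (sumOver (δ (a , i)) (concat (liftFactor Cs L)) +_) (sym (∑δ-row a i c (λ e → a≢c (sym e))))) (count (a , i))))
    lengthOf : ∀ {C} → C ∈ liftFactor Cs L → length C ≡ b * (h + h)
    lengthOf = All.lookup (lengths-lift Cs (All.lookup lengths p∈))
      where
      lengths-lift : ∀ Cs → All (λ C → length C ≡ h + h) Cs → All (λ C → length C ≡ b * (h + h)) (liftFactor Cs L)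
      lengths-lift []       []       = []
      lengths-lift (C ∷ Cs) (l ∷ ls) = Allₚ.++⁺ (Allₚ.applyUpTo⁺₂ (liftCycle L C) m (λ y → trans (length-liftCycle L C y) (cong (b *_) l))) (lengths-lift Cs ls)
    isCycle : ∀ {C} → C ∈ liftFactor Cs L → IsCycle (b * (h + h)) C
    -- A vertex occurs at most once in the whole factor, hence at most once in each of its cycles.
    isCycle {C} C∈ = lengthOf C∈ , unique C (λ v → ℕₚ.≤-trans (f≤sumOver (sumOver (δ v)) C∈)
        (ℕₚ.≤-trans (ℕₚ.≤-reflexive (sym (sumOver-concat (δ v) (liftFactor Cs L))))
        (ℕₚ.≤-trans (ℕₚ.m≤m+n _ _) (ℕₚ.≤-reflexive (count v)))))
      , All.tabulate (λ e∈ → arcs-adjacent Fc∈ C∈ e∈)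

  tensor : ARCSExists u g (b * (h + h)) 2
  tensor = arcs , All.tabulate factorOf , λ p q adj → trans (edgeMult-edgeSum p q (λ { refl → proj₁ adj refl })) (edgeSum-adjacent p q adj)
    where
    factorOf : ∀ {Fc} → Fc ∈ arcs → IsPartialCkFactor u g (b * (h + h)) Fc
    factorOf Fc∈ with find (∈-concatMap⁻ (λ p → map (liftFactor (proj₂ p)) lifts) {xs = factors} Fc∈)
    ... | p , p∈ , inMap with ∈-map⁻ (liftFactor (proj₂ p)) inMap
    ...   | L , L∈ , refl = isFactor p∈ L∈ Fc∈

-- The lift system on ℤ/m × ℤ/b

∑-punctured-reflect : ∀ n (f : ℤ → ℕ) → Periodic (suc n) f → ∑ n (λ i → f (- ⁺ suc i)) ≡ ∑ n (λ i → f (⁺ suc i))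
∑-punctured-reflect n f p = ℕₚ.+-cancelˡ-≡ (f (⁺ 0)) _ _
  (trans (cong (f (⁺ 0) +_) (∑-cong n (λ i → cong f (sym (ℤₚ.+-identityˡ (- ⁺ suc i)))))) (∑ℤ-reflect (suc n) f p (⁺ 0)))

module Torus (m b g : ℕ) (γ : ℤ → ℤ → Fin g) (γ-periodic₁ : ∀ x → Periodic m (λ y → γ y x)) (γ-periodic₂ : ∀ y → Periodic b (γ y))
  (∑F-γ : ∀ f → ∑F f ≡ ∑ℤ m (λ y → ∑ℤ b (λ x → f (γ y x)))) where

  ∑γ : (ℤ → ℤ → ℕ) → ℕ
  ∑γ Θ = ∑ℤ m (λ y → ∑ℤ b (Θ y))

  ∑γ-cong : ∀ {Θ Θ'} → (∀ y x → Θ y x ≡ Θ' y x) → ∑γ Θ ≡ ∑γ Θ'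
  ∑γ-cong e = ∑ℤ-cong m (λ y → ∑ℤ-cong b (e y))

  ∑γ-shift : ∀ (f : Fin g → Fin g → ℕ) s t p q →
    ∑γ (λ y x → f (γ (y +ᶻ p) (x +ᶻ q)) (γ (y +ᶻ p +ᶻ s) (x +ᶻ q +ᶻ t))) ≡ ∑γ (λ y x → f (γ y x) (γ (y +ᶻ s) (x +ᶻ t)))
  ∑γ-shift f s t p q = trans
    (∑ℤ-cong m (λ y → ∑ℤ-shift b (λ x → f (γ (y +ᶻ p) x) (γ (y +ᶻ p +ᶻ s) (x +ᶻ t)))
      (λ x → cong₂ f (γ-periodic₂ _ x) (Periodic-shift b (γ _) t (γ-periodic₂ _) x)) q))
    (∑ℤ-shift m (λ y → ∑ℤ b (λ x → f (γ y x) (γ (y +ᶻ s) (x +ᶻ t))))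
      (λ y → ∑ℤ-cong b (λ x → cong₂ f (γ-periodic₁ x y) (Periodic-shift m (λ y → γ y (x +ᶻ t)) s (γ-periodic₁ _) y))) p)

  ∑γ-reflect : ∀ (Θ : ℤ → ℤ → ℕ) → (∀ y → Periodic b (Θ y)) → ∑γ (λ y x → Θ y (- x)) ≡ ∑γ Θ
  ∑γ-reflect Θ p = ∑ℤ-cong m (λ y → trans (∑ℤ-cong b (λ x → cong (Θ y) (sym (ℤₚ.+-identityˡ (- x))))) (∑ℤ-reflect b (Θ y) (p y) (⁺ 0)))

  translate : ∀ p q → ∀ f → ∑γ (λ y x → f (γ (y +ᶻ p) (x +ᶻ q))) ≡ ∑F f
  translate p q f = trans (∑γ-shift (λ a _ → f a) (⁺ 0) (⁺ 0) p q) (sym (∑F-γ f))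

  -- Over one round the second coordinate of z advances by +1 (up) or -1 (down).
  up down : ℤ → ℤ → Lift g m b
  up p q = record
    { z = λ y r → γ (⁺ y) (⁺ r)
    ; w = λ y r → γ (⁺ y +ᶻ p) (⁺ r +ᶻ q)
    ; z-wrap = λ y → γ-periodic₂ (⁺ y) (⁺ 0)
    ; z-cover = λ f → sym (∑F-γ f)
    ; w-cover = translate p q
    }
  down p q = record
    { z = λ y r → γ (⁺ y) (- ⁺ r)
    ; w = λ y r → γ (⁺ y +ᶻ p) (- ⁺ r +ᶻ q)
    ; z-wrap = λ y → trans (sym (γ-periodic₂ (⁺ y) (- ⁺ b))) (cong (γ (⁺ y)) (ℤₚ.+-inverseˡ (⁺ b)))
    ; z-cover = λ f → trans (∑γ-reflect (λ y x → f (γ y x)) (λ y x → cong f (γ-periodic₂ y x))) (sym (∑F-γ f))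
    ; w-cover = λ f → trans (∑γ-reflect (λ y x → f (γ (y +ᶻ p) (x +ᶻ q))) (λ y x → cong f (Periodic-shift b (γ _) q (γ-periodic₂ _) x))) (translate p q f)
    }

  -- The weight of all ordered pairs of points at difference (p, q). The sums over a lift are all of
  -- this form, so a lift system becomes a list of differences.
  K : (Fin g → Fin g → ℕ) → ℤ → ℤ → ℕ
  K H p q = ∑γ (λ y x → H (γ y x) (γ (y +ᶻ p) (x +ᶻ q)))

  K-periodic₁ : ∀ H q → Periodic m (λ p → K H p q)
  K-periodic₁ H q p = ∑γ-cong (λ y x → cong (H (γ y x)) (trans (cong (λ k → γ k (x +ᶻ q)) (sym (ℤₚ.+-assoc y p (⁺ m)))) (γ-periodic₁ _ (y +ᶻ p))))

  K-periodic₂ : ∀ H p → Periodic b (K H p)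
  K-periodic₂ H p q = ∑γ-cong (λ y x → cong (H (γ y x)) (trans (cong (γ (y +ᶻ p)) (sym (ℤₚ.+-assoc x q (⁺ b)))) (γ-periodic₂ _ (x +ᶻ q))))

  K-swap : ∀ H p q e → ∑γ (λ y x → H (γ (y +ᶻ p) (x +ᶻ q)) (γ y (x +ᶻ e))) ≡ K H (- p) (e - q)
  K-swap H p q e = trans (∑γ-cong (λ y x → cong (H (γ (y +ᶻ p) (x +ᶻ q))) (cong₂ γ (lem₁ y p) (lem₂ x q e)))) (∑γ-shift H (- p) (e - q) p q)
    where
    lem₁ : ∀ (y p : ℤ) → y ≡ y +ᶻ p +ᶻ - p
    lem₁ = solve-∀
    lem₂ : ∀ (x q e : ℤ) → x +ᶻ e ≡ x +ᶻ q +ᶻ (e - q)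
    lem₂ = solve-∀

  K-periodic-arg : ∀ (H : Fin g → Fin g → ℕ) p q e y → Periodic b (λ x → H (γ (y +ᶻ p) (x +ᶻ q)) (γ y (x +ᶻ e)))
  K-periodic-arg H p q e y x = cong₂ H (Periodic-shift b (γ _) q (γ-periodic₂ _) x) (Periodic-shift b (γ _) e (γ-periodic₂ _) x)

  module _ (H : Fin g → Fin g → ℕ) where
    open Lift

    sumL : (Lift g m b → ℕ → ℕ → ℕ) → Lift g m b → ℕ
    sumL G L = ∑ m (λ y → ∑ b (λ r → G L y r))

    ZW WZ WZ⁺ : Lift g m b → ℕ → ℕ → ℕ
    ZW  L y r = H (z L y r) (w L y r)
    WZ  L y r = H (w L y r) (z L y r)
    WZ⁺ L y r = H (w L y r) (z L y (suc r))

    up-wz : ∀ p q → sumL WZ (up p q) ≡ K H (- p) (- q)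
    up-wz p q = trans (∑γ-cong (λ y x → cong (λ k → H (γ (y +ᶻ p) (x +ᶻ q)) (γ y k)) (sym (ℤₚ.+-identityʳ x))))
                      (trans (K-swap H p q (⁺ 0)) (cong (K H (- p)) (ℤₚ.+-identityˡ (- q))))

    -- The next round starts one step further, so the last arc has difference -(p, q - 1), that is,
    -- ψ(p, q) = (p, q - 1).
    up-wz⁺ : ∀ p q → sumL WZ⁺ (up p q) ≡ K H (- p) (⁺ 1 - q)
    up-wz⁺ p q = trans (∑-cong m (λ y → ∑-cong b (λ r → cong (λ k → H (γ (⁺ y +ᶻ p) (⁺ r +ᶻ q)) (γ (⁺ y) k)) (ℤₚ.+-comm (⁺ 1) (⁺ r)))))
                       (K-swap H p q (⁺ 1))

    down-zw : ∀ p q → sumL ZW (down p q) ≡ K H p q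
    down-zw p q = ∑γ-reflect (λ y x → H (γ y x) (γ (y +ᶻ p) (x +ᶻ q)))
                    (λ y x → cong₂ H (γ-periodic₂ y x) (Periodic-shift b (γ _) q (γ-periodic₂ _) x))

    down-wz : ∀ p q → sumL WZ (down p q) ≡ K H (- p) (- q)
    down-wz p q = trans (∑γ-reflect (λ y x → H (γ (y +ᶻ p) (x +ᶻ q)) (γ y x))
                          (λ y x → cong₂ H (Periodic-shift b (γ _) q (γ-periodic₂ _) x) (γ-periodic₂ y x)))
                        (up-wz p q)

    -- Here the rounds move backwards, and ψ(p, q) = (p, q + 1).
    down-wz⁺ : ∀ p q → sumL WZ⁺ (down p q) ≡ K H (- p) (- ⁺ 1 - q)
    down-wz⁺ p q = trans (∑-cong m (λ y → ∑-cong b (λ r → cong (λ k → H (γ (⁺ y +ᶻ p) (- ⁺ r +ᶻ q)) (γ (⁺ y) k)) (lem (⁺ r)))))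
                    (trans (∑γ-reflect (λ y x → H (γ (y +ᶻ p) (x +ᶻ q)) (γ y (x +ᶻ - ⁺ 1))) (K-periodic-arg H p q (- ⁺ 1)))
                           (K-swap H p q (- ⁺ 1)))
      where
      lem : ∀ (r : ℤ) → - (⁺ 1 +ᶻ r) ≡ - r +ᶻ - ⁺ 1
      lem = solve-∀

  ∑γ-K : ∀ H → ∑γ (K H) ≡ ∑F (λ x → ∑F (H x))
  ∑γ-K H = begin
    ∑γ (λ p q → ∑γ (λ y x → T p q y x))                                       ≡⟨ ∑-cong m (λ p → ∑-swap b m _) ⟩
    ∑ℤ m (λ p → ∑ℤ m (λ y → ∑ℤ b (λ q → ∑ℤ b (λ x → T p q y x))))             ≡⟨ ∑-swap m m _ ⟩
    ∑ℤ m (λ y → ∑ℤ m (λ p → ∑ℤ b (λ q → ∑ℤ b (λ x → T p q y x))))             ≡⟨ ∑-cong m (λ y → ∑-cong m (λ p → ∑-swap b b _)) ⟩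
    ∑ℤ m (λ y → ∑ℤ m (λ p → ∑ℤ b (λ x → ∑ℤ b (λ q → T p q y x))))             ≡⟨ ∑-cong m (λ y → ∑-swap m b _) ⟩
    ∑γ (λ y x → ∑γ (λ p q → T p q y x))                                       ≡⟨ ∑γ-cong row ⟩
    ∑γ (λ y x → ∑F (H (γ y x)))                                               ≡⟨ ∑F-γ (λ v → ∑F (H v)) ⟨
    ∑F (λ v → ∑F (H v))                                                       ∎
    where
    T : ℤ → ℤ → ℤ → ℤ → ℕ
    T p q y x = H (γ y x) (γ (y +ᶻ p) (x +ᶻ q))
    row : ∀ y x → ∑γ (λ p q → H (γ y x) (γ (y +ᶻ p) (x +ᶻ q))) ≡ ∑F (H (γ y x))
    row y x = trans (∑γ-cong (λ p q → cong (H (γ y x)) (cong₂ γ (ℤₚ.+-comm y p) (ℤₚ.+-comm x q)))) (translate y x (H (γ y x)))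

  K-diagonal : ∀ H → ∑F (λ x → H x x) ≡ K H (⁺ 0) (⁺ 0)
  K-diagonal H = trans (∑F-γ (λ x → H x x)) (∑γ-cong (λ y x → cong (H (γ y x)) (sym (cong₂ γ (ℤₚ.+-identityʳ y) (ℤₚ.+-identityʳ x)))))

-- Here g = mb and b = 2n+1.  The nonzero differences are (i+1,q), with ψ lowering q by one, and (0,j) with
-- ψ exchanging 2j+1 and 2j+2.
module LiftConstruction (m' n : ℕ) where

  m b : ℕ
  m = suc m'
  b = suc (n + n)

  private
    γ : ℤ → ℤ → Fin (m * b)
    γ y x = combine (ι m y) (ι b x)

  open Torus m b (m * b) γ (λ x y → cong (λ i → combine i (ι b x)) (ι-periodic m y)) (λ y x → cong (combine (ι m y)) (ι-periodic b x))
    (λ f → trans (∑F-combine m f) (trans (∑F-ι m (λ i → ∑F {b} (λ j → f (combine i j)))) (∑ℤ-cong m (λ y → ∑F-ι b (λ j → f (combine (ι m y) j))))))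

  outer : ℕ → List (Lift (m * b) m b)
  outer i = applyUpTo (λ q → up (⁺ suc i) (⁺ q)) b

  -- The `up` lift lowers 2j+2 to 2j+1 and the `down` lift raises 2j+1 to 2j+2. The 2n nonzero
  -- elements of ℤ/b are thereby permuted among themselves and none is sent to 0.
  inner : ℕ → List (Lift (m * b) m b)
  inner j = up (⁺ 0) (⁺ suc (suc (j + j))) ∷ down (⁺ 0) (⁺ suc (j + j)) ∷ []

  allLifts : List (Lift (m * b) m b)
  allLifts = concat (applyUpTo outer m') ++ concat (applyUpTo inner n)

  sumOver-allLifts : ∀ (G : Lift (m * b) m b → ℕ) →
    sumOver G allLifts ≡ ∑ m' (λ i → ∑ b (λ q → G (up (⁺ suc i) (⁺ q))))
                       + ∑ n (λ j → G (up (⁺ 0) (⁺ suc (suc (j + j)))) + (G (down (⁺ 0) (⁺ suc (j + j))) + 0))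
  sumOver-allLifts G = trans (sumOver-++ G (concat (applyUpTo outer m')) _) (cong₂ _+_
    (trans (sumOver-concat G (applyUpTo outer m')) (trans (sumOver-applyUpTo (sumOver G) outer m') (∑-cong m' (λ i → sumOver-applyUpTo G (λ q → up (⁺ suc i) (⁺ q)) b))))
    (trans (sumOver-concat G (applyUpTo inner n)) (sumOver-applyUpTo (sumOver G) inner n)))

  Dsum : (Fin (m * b) → Fin (m * b) → ℕ) → ℕ
  Dsum H = ∑ m' (λ i → ∑ℤ b (K H (⁺ suc i))) + ∑ (n + n) (λ i → K H (⁺ 0) (⁺ suc i))

  pairs : ∀ (k : ℕ → ℕ) → ∑ n (λ j → k (suc (j + j)) + (k (j + j) + 0)) ≡ ∑ (n + n) k
  pairs k = trans (∑-cong n (λ j → trans (cong (k (suc (j + j)) +_) (ℕₚ.+-identityʳ _)) (ℕₚ.+-comm (k (suc (j + j))) (k (j + j))))) (sym (∑-double n k))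

  -- The constant `e` is 0 for the arcs inside a round and 1 for the last arc. When the first
  -- coordinate is nonzero, q runs through all of ℤ/b, so reflection in q absorbs `e`.
  reflected-Dsum : ∀ H e → ∑ m' (λ i → ∑ℤ b (λ q → K H (- ⁺ suc i) (e - q))) + ∑ (n + n) (λ i → K H (⁺ 0) (- ⁺ suc i)) ≡ Dsum H
  reflected-Dsum H e = cong₂ _+_
    (trans (∑-cong m' (λ i → ∑ℤ-reflect b (K H (- ⁺ suc i)) (K-periodic₂ H (- ⁺ suc i)) e))
           (∑-punctured-reflect m' (λ p → ∑ℤ b (K H p)) (λ p → ∑ℤ-cong b (λ q → K-periodic₁ H q p))))
    (∑-punctured-reflect (n + n) (K H (⁺ 0)) (K-periodic₂ H (⁺ 0)))

  liftSystem : LiftSystem (m * b) m b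
  liftSystem = record
    { lifts = allLifts
    ; D     = Dsum
    ; zw    = λ H → trans (sumOver-allLifts (sumL H (ZW H))) (cong₂ _+_ refl
        (trans (∑-cong n (λ j → cong (λ k → K H (⁺ 0) (⁺ suc (suc (j + j))) + (k + 0)) (down-zw H (⁺ 0) (⁺ suc (j + j)))))
               (pairs (λ i → K H (⁺ 0) (⁺ suc i)))))
    ; wz    = λ H → trans (sumOver-allLifts (sumL H (WZ H))) (trans (cong₂ _+_
        (∑-cong m' (λ i → ∑-cong b (λ q → trans (up-wz H (⁺ suc i) (⁺ q)) (cong (K H (- ⁺ suc i)) (sym (ℤₚ.+-identityˡ (- ⁺ q)))))))
        (trans (∑-cong n (λ j → cong₂ (λ k l → k + (l + 0)) (up-wz H (⁺ 0) (⁺ suc (suc (j + j)))) (down-wz H (⁺ 0) (⁺ suc (j + j)))))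
               (pairs (λ i → K H (⁺ 0) (- ⁺ suc i)))))
        (reflected-Dsum H (⁺ 0)))
    ; wz⁺   = λ H → trans (sumOver-allLifts (sumL H (WZ⁺ H))) (trans (cong₂ _+_
        (∑-cong m' (λ i → ∑-cong b (λ q → up-wz⁺ H (⁺ suc i) (⁺ q))))
        (trans (∑-cong n (λ j → trans
                 (cong₂ (λ k l → k + (l + 0))
                   (trans (up-wz⁺ H (⁺ 0) (⁺ suc (suc (j + j)))) (cong (K H (⁺ 0)) (lem₁ (⁺ (j + j)))))
                   (trans (down-wz⁺ H (⁺ 0) (⁺ suc (j + j))) (cong (K H (⁺ 0)) (lem₂ (⁺ (j + j))))))
                 -- On the last arc the two lifts of `inner j` have traded their differences, so
                 -- their terms appear in the opposite order.
                 (lem₃ (K H (⁺ 0) (- ⁺ suc (j + j))) _)))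
               (pairs (λ i → K H (⁺ 0) (- ⁺ suc i)))))
        (reflected-Dsum H (⁺ 1)))
    ; total = tot
    }
    where
    lem₁ : ∀ (x : ℤ) → ⁺ 1 - (⁺ 2 +ᶻ x) ≡ - (⁺ 1 +ᶻ x)
    lem₁ = solve-∀
    lem₂ : ∀ (x : ℤ) → - ⁺ 1 - (⁺ 1 +ᶻ x) ≡ - (⁺ 2 +ᶻ x)
    lem₂ = solve-∀
    lem₃ : ∀ x y → x + (y + 0) ≡ y + (x + 0)
    lem₃ = ℕ-solve
    tot : ∀ H → Dsum H + ∑F (λ x → H x x) ≡ ∑F (λ x → ∑F (H x))
    tot H = begin
      Dsum H + ∑F (λ x → H x x)                 ≡⟨ cong (Dsum H +_) (K-diagonal H) ⟩
      Dsum H + K H (⁺ 0) (⁺ 0)                  ≡⟨ rearrange (∑ m' (λ i → ∑ℤ b (K H (⁺ suc i)))) (∑ (n + n) (λ i → K H (⁺ 0) (⁺ suc i))) (K H (⁺ 0) (⁺ 0)) ⟩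
      ∑γ (K H)                                  ≡⟨ ∑γ-K H ⟩
      ∑F (λ x → ∑F (H x))                       ∎
      where
      rearrange : ∀ x y w → x + y + w ≡ w + y + x
      rearrange = ℕ-solve

-- Sums by differences and matchings of an odd cyclic group

⁺-∸ : ∀ {n i} → i < n → ⁺ (n ∸ suc i) ≡ ⁺ n - ⁺ suc i
⁺-∸ {n} {i} i<n = sym (trans (ℤₚ.m-n≡m⊖n n (suc i)) (ℤₚ.⊖-≥ i<n))

module Circulant (N : ℕ) (Φ : ℤ → ℤ → ℕ) (periodicˡ : ∀ y → Periodic N (λ x → Φ x y)) (periodicʳ : ∀ x → Periodic N (Φ x)) where

  -- The weight of all pairs at difference d. A family developed modulo `N` is evaluated by listing
  -- the differences of its base edges.
  Ψ : ℤ → ℕ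
  Ψ d = ∑ℤ N (λ j → Φ j (j +ᶻ d))

  Ψ-shift : ∀ a c → ∑ℤ N (λ j → Φ (j +ᶻ a) (j +ᶻ c)) ≡ Ψ (c - a)
  Ψ-shift a c = trans (∑ℤ-cong N (λ j → cong (Φ (j +ᶻ a)) (lem j a c)))
    (∑ℤ-shift N (λ j → Φ j (j +ᶻ (c - a))) (λ j → trans (periodicˡ _ j) (Periodic-shift N (Φ j) (c - a) (periodicʳ j) j)) a)
    where
    lem : ∀ (j a c : ℤ) → j +ᶻ c ≡ j +ᶻ a +ᶻ (c - a)
    lem = solve-∀

  Ψ-neg : (∀ x y → Φ x y ≡ Φ y x) → ∀ d → Ψ (- d) ≡ Ψ d
  Ψ-neg Φ-sym d = trans (∑ℤ-cong N (λ j → trans (Φ-sym j (j +ᶻ - d)) (cong (Φ (j +ᶻ - d)) (sym (ℤₚ.+-identityʳ j))))) (trans (Ψ-shift (- d) (⁺ 0)) (cong Ψ (lem d)))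
    where
    lem : ∀ (d : ℤ) → ⁺ 0 - - d ≡ d
    lem = solve-∀

  Ψ-periodic : Periodic N Ψ
  Ψ-periodic d = ∑ℤ-cong N (λ j → trans (cong (Φ j) (sym (ℤₚ.+-assoc j d (⁺ N)))) (periodicʳ j (j +ᶻ d)))

  ∑ℤ-Ψ : ∑ℤ N Ψ ≡ ∑ℤ N (λ x → ∑ℤ N (Φ x))
  ∑ℤ-Ψ = trans (∑-swap N N (λ d j → Φ (⁺ j) (⁺ j +ᶻ ⁺ d)))
    (∑ℤ-cong N (λ j → trans (∑ℤ-cong N (λ d → cong (Φ j) (ℤₚ.+-comm j d))) (∑ℤ-shift N (Φ j) (periodicʳ j) j)))

module OddCycle (n : ℕ) where

  N : ℕ
  N = suc (n + n)

  -- The pairs are the orbits of x ↦ 2c - x, whose only fixed point is c because `N` is odd.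
  ∑ℤ-around : ∀ f → Periodic N f → ∀ c →
    ∑ n (λ i → f (c +ᶻ ⁺ suc i) + f (c - ⁺ suc i)) + f c ≡ ∑ℤ N f
  ∑ℤ-around f p c = begin
    ∑ n (λ i → f (c +ᶻ ⁺ suc i) + f (c - ⁺ suc i)) + f c
      ≡⟨ cong (_+ f c) (∑-+ n (λ i → f (c +ᶻ ⁺ suc i)) (λ i → f (c - ⁺ suc i))) ⟩
    ∑ n (λ i → f (c +ᶻ ⁺ suc i)) + ∑ n (λ i → f (c - ⁺ suc i)) + f c
      ≡⟨ cong (λ k → ∑ n (λ i → f (c +ᶻ ⁺ suc i)) + k + f c) (sym (∑-reverse n (λ i → f (c - ⁺ suc i)))) ⟩
    ∑ n (λ i → f (c +ᶻ ⁺ suc i)) + ∑ n (λ i → f (c - ⁺ suc (n ∸ suc i))) + f c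
      ≡⟨ cong (λ k → ∑ n (λ i → f (c +ᶻ ⁺ suc i)) + k + f c) (∑-cong-< n wrap) ⟩
    ∑ n (λ i → f (c +ᶻ ⁺ suc i)) + ∑ n (λ i → f (c +ᶻ ⁺ suc (n + i))) + f c
      ≡⟨ cong (_+ f c) (sym (∑-split n n (λ i → f (c +ᶻ ⁺ suc i)))) ⟩
    ∑ (n + n) (λ i → f (c +ᶻ ⁺ suc i)) + f c
      ≡⟨ ℕₚ.+-comm _ (f c) ⟩
    f c + ∑ (n + n) (λ i → f (c +ᶻ ⁺ suc i))
      ≡⟨ cong₂ _+_ (cong f (sym (ℤₚ.+-identityˡ c))) (∑-cong (n + n) (λ i → cong f (ℤₚ.+-comm c (⁺ suc i)))) ⟩
    ∑ℤ N (λ z → f (z +ᶻ c))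
      ≡⟨ ∑ℤ-shift N f p c ⟩
    ∑ℤ N f ∎
    where
    lem : ∀ (c n i : ℤ) → c - (⁺ 1 +ᶻ (n - (⁺ 1 +ᶻ i))) +ᶻ (⁺ 1 +ᶻ (n +ᶻ n)) ≡ c +ᶻ (⁺ 1 +ᶻ (n +ᶻ i))
    lem = solve-∀
    wrap : ∀ i → i < n → f (c - ⁺ suc (n ∸ suc i)) ≡ f (c +ᶻ ⁺ suc (n + i))
    wrap i i<n = trans (sym (p _)) (cong f (trans (cong (λ k → c - (⁺ 1 +ᶻ k) +ᶻ ⁺ N) (⁺-∸ i<n)) (lem c (⁺ n) (⁺ i))))

  -- The pairs are the orbits of x ↦ 2c + 1 - x. Its fixed point is c + n + 1, as 2(n + 1) ≡ 1
  -- modulo 2n + 1; listing the orbits outwards from there gives the previous lemma.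
  ∑ℤ-around½ : ∀ f → Periodic N f → ∀ c →
    ∑ n (λ i → f (c +ᶻ ⁺ suc i) + f (c - ⁺ i)) + f (c +ᶻ ⁺ suc n) ≡ ∑ℤ N f
  ∑ℤ-around½ f p c = trans (cong (_+ f c') rev) (∑ℤ-around f p c')
    where
    c' : ℤ
    c' = c +ᶻ ⁺ suc n
    lem₁ : ∀ (c n i : ℤ) → c +ᶻ (⁺ 1 +ᶻ (n - (⁺ 1 +ᶻ i))) ≡ c +ᶻ (⁺ 1 +ᶻ n) - (⁺ 1 +ᶻ i)
    lem₁ = solve-∀
    lem₂ : ∀ (c n i : ℤ) → c - (n - (⁺ 1 +ᶻ i)) +ᶻ (⁺ 1 +ᶻ (n +ᶻ n)) ≡ c +ᶻ (⁺ 1 +ᶻ n) +ᶻ (⁺ 1 +ᶻ i)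
    lem₂ = solve-∀
    rev : ∑ n (λ i → f (c +ᶻ ⁺ suc i) + f (c - ⁺ i)) ≡ ∑ n (λ i → f (c' +ᶻ ⁺ suc i) + f (c' - ⁺ suc i))
    rev = trans (sym (∑-reverse n (λ i → f (c +ᶻ ⁺ suc i) + f (c - ⁺ i)))) (∑-cong-< n (λ i i<n → trans (ℕₚ.+-comm (f (c +ᶻ ⁺ suc (n ∸ suc i))) _)
      (cong₂ _+_ (trans (sym (p _)) (cong f (trans (cong (λ k → c - k +ᶻ ⁺ N) (⁺-∸ i<n)) (lem₂ c (⁺ n) (⁺ i)))))
                 (cong f (trans (cong (λ k → c +ᶻ (⁺ 1 +ᶻ k)) (⁺-∸ i<n)) (lem₁ c (⁺ n) (⁺ i)))))))

  module _ (Φ : ℤ → ℤ → ℕ) (Φ-sym : ∀ x y → Φ x y ≡ Φ y x) (Φ-periodic : ∀ x → Periodic N (Φ x)) where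

    Φ-periodicˡ : ∀ y → Periodic N (λ x → Φ x y)
    Φ-periodicˡ y x = trans (Φ-sym (x +ᶻ ⁺ N) y) (trans (Φ-periodic y x) (Φ-sym y x))

    open Circulant N Φ Φ-periodicˡ Φ-periodic

    odds evens : ℕ
    odds  = ∑ n (λ i → Ψ (⁺ suc (i + i)))
    evens = ∑ n (λ i → Ψ (⁺ suc (suc (i + i))))

    -- As `N` is odd, d ↦ N - d exchanges odd and even differences, and d and -d carry the same
    -- weight.
    odds≡evens : odds ≡ evens
    odds≡evens = trans (sym (∑-reverse n (λ i → Ψ (⁺ suc (i + i))))) (∑-cong-< n (λ i i<n →
      trans (sym (Ψ-neg Φ-sym (⁺ suc (n ∸ suc i + (n ∸ suc i))))) (trans (sym (Ψ-periodic (- ⁺ suc (n ∸ suc i + (n ∸ suc i))))) (cong Ψ (trans (cong (λ k → - (⁺ 1 +ᶻ (k +ᶻ k)) +ᶻ ⁺ N) (⁺-∸ i<n)) (lem (⁺ n) (⁺ i)))))))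
      where
      lem : ∀ (n i : ℤ) → - (⁺ 1 +ᶻ ((n - (⁺ 1 +ᶻ i)) +ᶻ (n - (⁺ 1 +ᶻ i)))) +ᶻ (⁺ 1 +ᶻ (n +ᶻ n)) ≡ ⁺ 2 +ᶻ (i +ᶻ i)
      lem = solve-∀

    odds+evens : odds + evens + ∑ℤ N (λ j → Φ j j) ≡ ∑ℤ N (λ x → ∑ℤ N (Φ x))
    odds+evens = begin
      odds + evens + ∑ℤ N (λ j → Φ j j)                   ≡⟨ ℕₚ.+-comm (odds + evens) _ ⟩
      ∑ℤ N (λ j → Φ j j) + (odds + evens)                 ≡⟨ cong₂ _+_ (∑ℤ-cong N (λ j → cong (Φ j) (sym (ℤₚ.+-identityʳ j))))
                                                               (trans (sym (∑-+ n (λ i → Ψ (⁺ suc (i + i))) (λ i → Ψ (⁺ suc (suc (i + i)))))) (sym (∑-double n (λ i → Ψ (⁺ suc i))))) ⟩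
      ∑ℤ N Ψ                                              ≡⟨ ∑ℤ-Ψ ⟩
      ∑ℤ N (λ x → ∑ℤ N (Φ x))                             ∎

    ∑-around : ∑ℤ N (λ j → ∑ n (λ i → Φ (j +ᶻ ⁺ suc i) (j - ⁺ suc i))) ≡ evens
    ∑-around = trans (∑-swap N n (λ j i → Φ (⁺ j +ᶻ ⁺ suc i) (⁺ j - ⁺ suc i)))
      (∑-cong n (λ i → trans (Ψ-shift (⁺ suc i) (- ⁺ suc i)) (trans (cong Ψ (lem (⁺ i))) (Ψ-neg Φ-sym (⁺ suc (suc (i + i)))))))
      where
      lem : ∀ (i : ℤ) → - (⁺ 1 +ᶻ i) - (⁺ 1 +ᶻ i) ≡ - (⁺ 2 +ᶻ (i +ᶻ i))
      lem = solve-∀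

    ∑-around½ : ∑ℤ N (λ j → ∑ n (λ i → Φ (j +ᶻ ⁺ suc i) (j - ⁺ i))) ≡ odds
    ∑-around½ = trans (∑-swap N n (λ j i → Φ (⁺ j +ᶻ ⁺ suc i) (⁺ j - ⁺ i)))
      (∑-cong n (λ i → trans (Ψ-shift (⁺ suc i) (- ⁺ i)) (trans (cong Ψ (lem (⁺ i))) (Ψ-neg Φ-sym (⁺ suc (i + i))))))
      where
      lem : ∀ (i : ℤ) → - i - (⁺ 1 +ᶻ i) ≡ - (⁺ 1 +ᶻ (i +ᶻ i))
      lem = solve-∀

    -- The pairs around all centres realize each even difference 2, 4, ..., 2n once, which is every
    -- nonzero difference once up to sign. Doubling therefore gives the whole off-diagonal sum.
    pairs-around : let X = ∑ℤ N (λ j → ∑ n (λ i → Φ (j +ᶻ ⁺ suc i) (j - ⁺ suc i))) in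
      X + X + ∑ℤ N (λ j → Φ j j) ≡ ∑ℤ N (λ x → ∑ℤ N (Φ x))
    pairs-around = trans (cong (_+ ∑ℤ N (λ j → Φ j j)) (cong₂ _+_ (trans ∑-around (sym odds≡evens)) ∑-around)) odds+evens

    pairs-around½ : let X = ∑ℤ N (λ j → ∑ n (λ i → Φ (j +ᶻ ⁺ suc i) (j - ⁺ i))) in
      X + X + ∑ℤ N (λ j → Φ j j) ≡ ∑ℤ N (λ x → ∑ℤ N (Φ x))
    pairs-around½ = trans (cong (_+ ∑ℤ N (λ j → Φ j j)) (cong₂ _+_ ∑-around½ (trans ∑-around½ odds≡evens))) odds+evens

  -- This is the case h = 1: a cycle of length 2 is an edge traversed there and back, so the near
  -- 1-factorization of K_N by reflections already uses each edge twice.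
  nearMatching : NearFactorization N 2
  nearMatching = record
    { factors = applyUpTo factor N
    ; lengths = Allₚ.applyUpTo⁺₂ factor N (λ c → Allₚ.applyUpTo⁺₂ (pair (⁺ c)) n (λ i → refl))
    ; covers  = Allₚ.applyUpTo⁺₂ factor N (λ c f → begin
        sumOver (sumOver f) (cycles (⁺ c)) + f (P (⁺ c))
          ≡⟨ cong (_+ f (P (⁺ c))) (trans (sumOver-applyUpTo (sumOver f) (pair (⁺ c)) n) (∑-cong n (λ i → cong (f (P (⁺ c +ᶻ ⁺ suc i)) +_) (ℕₚ.+-identityʳ _)))) ⟩
        ∑ n (λ i → f (P (⁺ c +ᶻ ⁺ suc i)) + f (P (⁺ c - ⁺ suc i))) + f (P (⁺ c))
          ≡⟨ ∑ℤ-around (f ∘ P) (λ z → cong f (ι-periodic N z)) (⁺ c) ⟩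
        ∑ℤ N (f ∘ P)
          ≡⟨ ∑F-ι N f ⟨
        ∑F f ∎)
    ; edges   = edges
    }
    where
    P : ℤ → Fin N
    P = ι N
    pair : ℤ → ℕ → List (Fin N)
    pair c i = P (c +ᶻ ⁺ suc i) ∷ P (c - ⁺ suc i) ∷ []
    cycles : ℤ → List (List (Fin N))
    cycles c = applyUpTo (pair c) n
    factor : ℕ → Fin N × List (List (Fin N))
    factor c = P (⁺ c) , cycles (⁺ c)
    edges : ∀ F → Symmetric F →
      sumOver (λ p → sumOver (cycleSum F) (proj₂ p)) (applyUpTo factor N) + ∑F (λ x → F x x) ≡ ∑F (λ x → ∑F (F x))
    edges F F-sym = begin
      sumOver E (applyUpTo factor N) + ∑F (λ x → F x x)
        ≡⟨ cong₂ _+_ (trans (sumOver-applyUpTo E factor N) (∑-cong N (λ c → sumOver-applyUpTo (cycleSum F) (pair (⁺ c)) n)))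
                     (∑F-ι N (λ x → F x x)) ⟩
      ∑ N (λ c → ∑ n (λ i → T c i + F (P (⁺ c - ⁺ suc i)) (P (⁺ c +ᶻ ⁺ suc i)))) + ∑ℤ N (λ j → F (P j) (P j))
        ≡⟨ cong (_+ ∑ℤ N (λ j → F (P j) (P j)))
             (trans (∑-cong N (λ c → trans (∑-cong n (λ i → cong (T c i +_) (F-sym (P (⁺ c - ⁺ suc i)) (P (⁺ c +ᶻ ⁺ suc i))))) (∑-+ n (T c) (T c))))
                    (∑-+ N (λ c → ∑ n (T c)) (λ c → ∑ n (T c)))) ⟩
      ∑ N (λ c → ∑ n (T c)) + ∑ N (λ c → ∑ n (T c)) + ∑ℤ N (λ j → F (P j) (P j))
        ≡⟨ pairs-around (λ x y → F (P x) (P y)) (λ x y → F-sym (P x) (P y)) (λ x y → cong (F (P x)) (ι-periodic N y)) ⟩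
      ∑ℤ N (λ x → ∑ℤ N (λ y → F (P x) (P y)))
        ≡⟨ ∑ℤ-cong N (λ x → sym (∑F-ι N (F (P x)))) ⟩
      ∑ℤ N (λ x → ∑F (F (P x)))
        ≡⟨ ∑F-ι N (λ x → ∑F (F x)) ⟨
      ∑F (λ x → ∑F (F x)) ∎
      where
      E : Fin N × List (List (Fin N)) → ℕ
      E p = sumOver (cycleSum F) (proj₂ p)
      T : ℕ → ℕ → ℕ
      T c i = F (P (⁺ c +ᶻ ⁺ suc i)) (P (⁺ c - ⁺ suc i))

-- Systems on a group and schemes on the set of groups

-- A group of a points.  The paths `near i` miss only `hole i` and together with `round` decompose K_a(2).  The
-- 2-factors `hole i ∷ cross i`, `cross₂ i` decompose the doubled complete bipartite graph on two copies of the
-- group; in them `hole i` of the first copy lies between the ends of `near i` in the second copy.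
record System (a : ℕ) : Set₁ where
  field
    I               : Set
    indices         : List I
    hole left right : I → Fin a
    nearMid         : I → List (Fin a)
    crossMid cross₂ : I → List (Fin a ⊎ Fin a)
    round           : List (Fin a)

  -- The two ends are kept apart from the middle because closing a path through a different vertex
  -- affects only the edges at its ends.
  near : I → List (Fin a)
  near i = left i ∷ nearMid i ++ right i ∷ []

  cross : I → List (Fin a ⊎ Fin a)
  cross i = inj₂ (left i) ∷ crossMid i ++ inj₂ (right i) ∷ []

  field
    ∑-holes       : ∀ f → sumOver (f ∘ hole) indices ≡ ∑F f
    -- Each point is an end of two near paths, counted with multiplicity. Closing all of them
    -- through ∞ thus uses every edge at ∞ twice.
    ∑-ends        : ∀ f → sumOver (λ i → f (left i) + f (right i)) indices ≡ ∑F f + ∑F f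
    near-length   : ∀ i → suc (length (near i)) ≡ a
    cross-length  : ∀ i → suc (length (cross i)) ≡ a
    cross₂-length : ∀ i → length (cross₂ i) ≡ a
    round-length  : length round ≡ a
    near-cover    : ∀ i f → sumOver f (near i) + f (hole i) ≡ ∑F f
    cross-cover   : ∀ i f → sumOver f (inj₁ (hole i) ∷ cross i) + sumOver f (cross₂ i) ≡ ∑F (f ∘ inj₁) + ∑F (f ∘ inj₂)
    round-cover   : ∀ f → sumOver f round ≡ ∑F f
    near-edges    : ∀ G → Symmetric G →
      sumOver (λ i → chain G (left i ∷ nearMid i) (right i)) indices + cycleSum G round + ∑F (λ v → G v v) ≡ ∑F (λ v → ∑F (G v))
    cross-edges   : ∀ G → Symmetric G →
      sumOver (λ i → cycleSum G (inj₁ (hole i) ∷ cross i) + cycleSum G (cross₂ i)) indices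
        ≡ ∑F (λ v → ∑F (λ w → G (inj₁ v) (inj₂ w))) + ∑F (λ v → ∑F (λ w → G (inj₁ v) (inj₂ w)))

-- The part of a factor over one group or two matched groups.  `single∞ x` closes the near path of x through ∞,
-- `single x y` closes it through the hole vertex of y, and `pair∞ x y` is `pair x y` with ∞ in place of the hole
-- vertex of x.
data Item (s : ℕ) : Set where
  single∞ : Fin s → Item s
  single  : Fin s → Fin s → Item s
  pair    : Fin s → Fin s → Item s
  pair∞   : Fin s → Fin s → Item s

module _ {s : ℕ} where

  -- Vertex and edge sums of an item, up to the terms lossV and lossE it lacks.  S is the sum over a group, h its
  -- hole term, o the term of ∞; N, O, R and Φ are the sums over near paths, edges to ∞, edges from hole vertices to
  -- the ends of near paths, and edges between two groups.
  gainV : (S h : Fin s → ℕ) (o : ℕ) → Item s → ℕ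
  gainV S h o (single∞ x)  = S x + o
  gainV S h o (single x y) = S x + h y
  gainV S h o (pair x y)   = S x + S y
  gainV S h o (pair∞ x y)  = S x + S y + o

  lossV : (h : Fin s → ℕ) → Item s → ℕ
  lossV h (single∞ x)  = h x
  lossV h (single x y) = h x
  lossV h (pair x y)   = 0
  lossV h (pair∞ x y)  = h x

  gainE : (N O : Fin s → ℕ) (R Φ : Fin s → Fin s → ℕ) → Item s → ℕ
  gainE N O R Φ (single∞ x)  = N x + (O x + O x)
  gainE N O R Φ (single x y) = N x + R y x
  gainE N O R Φ (pair x y)   = Φ x y + Φ x y
  gainE N O R Φ (pair∞ x y)  = Φ x y + Φ x y + (O y + O y)

  lossE : (R : Fin s → Fin s → ℕ) → Item s → ℕ
  lossE R (single∞ x)  = 0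
  lossE R (single x y) = 0
  lossE R (pair x y)   = 0
  lossE R (pair∞ x y)  = R x y

-- The first component of a row is the group containing the hole. Losses stand on the right to avoid
-- subtraction. As `R` is arbitrary, `coverE` forces the edges spent by `single` items to be exactly
-- those released by `pair∞` items.
record Scheme (s : ℕ) : Set where
  field
    rows    : List (Fin s × List (Item s))
    coverV  : All (λ ρ → ∀ S h o → sumOver (gainV S h o) (proj₂ ρ) + h (proj₁ ρ) ≡ ∑F S + o + sumOver (lossV h) (proj₂ ρ)) rows
    coverE  : ∀ N O R Φ → Symmetric Φ →
      sumOver (λ ρ → sumOver (gainE N O R Φ) (proj₂ ρ)) rows + ∑F (λ x → Φ x x)
        ≡ ∑F (λ x → ∑F (Φ x)) + ∑F N + (∑F O + ∑F O) + sumOver (λ ρ → sumOver (lossE R) (proj₂ ρ)) rows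

-- Assembling the base factorization

cycleSum-closed : (F : A → A → ℕ) → ∀ q x mid y → cycleSum F (q ∷ x ∷ mid ++ y ∷ []) ≡ F q x + chain F (x ∷ mid) y + F y q
cycleSum-closed F q x mid y = trans (cong (F q x +_) (chain-++ F (x ∷ mid) y [] q)) (sym (ℕₚ.+-assoc (F q x) _ _))

sumOver-cancel : ∀ {ρ σ τ : A → ℕ} → (∀ x → ρ x + σ x ≡ τ x) → ∀ xs → sumOver ρ xs + sumOver σ xs ≡ sumOver τ xs
sumOver-cancel {ρ = ρ} {σ} e xs = trans (sym (sumOver-+ ρ σ xs)) (sumOver-cong e xs)

all-map : {P : B → Set} (f : A → B) → (∀ x → P (f x)) → ∀ xs → All P (map f xs)
all-map f p []       = []
all-map f p (x ∷ xs) = p x ∷ all-map f p xs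

all-concatMap : {P : B → Set} (f : A → List B) → (∀ x → All P (f x)) → ∀ xs → All P (concatMap f xs)
all-concatMap f p []       = []
all-concatMap f p (x ∷ xs) = Allₚ.++⁺ (p x) (all-concatMap f p xs)

module Assembly {s a : ℕ} (sys : System a) (sch : Scheme s) where
  open System sys
  open Scheme sch

  u : ℕ
  u = suc (s * a)

  ∞ : Fin u
  ∞ = zero

  pt : Fin s → Fin a → Fin u
  pt x v = suc (combine x v)

  ∑F-pt : ∀ (f : Fin u → ℕ) → ∑F f ≡ f ∞ + ∑F (λ x → ∑F (λ v → f (pt x v)))
  ∑F-pt f = cong (f ∞ +_) (∑F-combine s (f ∘ suc))

  both : Fin s → Fin s → Fin a ⊎ Fin a → Fin u
  both x y (inj₁ v) = pt x v
  both x y (inj₂ w) = pt y w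

  cyclesOf : I → Item s → List (List (Fin u))
  cyclesOf i (single∞ x)  = (∞ ∷ map (pt x) (near i)) ∷ []
  cyclesOf i (single x y) = (pt y (hole i) ∷ map (pt x) (near i)) ∷ []
  cyclesOf i (pair x y)   = map (both x y) (inj₁ (hole i) ∷ cross i) ∷ map (both x y) (cross₂ i) ∷ []
  cyclesOf i (pair∞ x y)  = (∞ ∷ map (both x y) (cross i)) ∷ map (both x y) (cross₂ i) ∷ []

  row : Fin s × List (Item s) → List (Fin u × List (List (Fin u)))
  row (j , items) = map (λ i → pt j (hole i) , concatMap (cyclesOf i) items) indices

  -- The only factor whose hole is ∞; it takes up the edges inside the groups that the near paths
  -- leave over.
  roundFactor : Fin u × List (List (Fin u))
  roundFactor = ∞ , map (λ x → map (pt x) round) (allFin s)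

  factors : List (Fin u × List (List (Fin u)))
  factors = roundFactor ∷ concatMap row rows

  sumOver-allFin : ∀ {n} (f : Fin n → ℕ) → sumOver f (allFin n) ≡ ∑F f
  sumOver-allFin f = go _ (λ i → i) f
    where
    go : ∀ n {m} (g : Fin n → Fin m) (f : Fin m → ℕ) → sumOver f (tabulate g) ≡ ∑F (f ∘ g)
    go zero    g f = refl
    go (suc n) g f = cong (f (g zero) +_) (go n (g ∘ suc) f)

  lengths : All (λ p → All (λ C → length C ≡ a) (proj₂ p)) factors
  lengths = all-map (λ x → map (pt x) round) (λ x → trans (length-map (pt x) round) round-length) (allFin s)
          ∷ all-concatMap row (λ ρ → all-map (λ i → pt (proj₁ ρ) (hole i) , concatMap (cyclesOf i) (proj₂ ρ))
              (λ i → all-concatMap (cyclesOf i) (item i) (proj₂ ρ)) indices) rows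
    where
    item : ∀ i t → All (λ C → length C ≡ a) (cyclesOf i t)
    item i (single∞ x)  = trans (cong suc (length-map (pt x) (near i))) (near-length i) ∷ []
    item i (single x y) = trans (cong suc (length-map (pt x) (near i))) (near-length i) ∷ []
    item i (pair x y)   = trans (length-map (both x y) (inj₁ (hole i) ∷ cross i)) (cross-length i) ∷ trans (length-map (both x y) (cross₂ i)) (cross₂-length i) ∷ []
    item i (pair∞ x y)  = trans (cong suc (length-map (both x y) (cross i))) (cross-length i) ∷ trans (length-map (both x y) (cross₂ i)) (cross₂-length i) ∷ []

  module Cover (f : Fin u → ℕ) where
    S : Fin s → ℕ
    S x = ∑F (λ v → f (pt x v))

    h : I → Fin s → ℕ
    h i x = f (pt x (hole i))

    near-sum : ∀ i x → sumOver f (map (pt x) (near i)) + h i x ≡ S x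
    near-sum i x = trans (cong (_+ h i x) (sumOver-map f (pt x) (near i))) (near-cover i (f ∘ pt x))

    cross-sum : ∀ i x y → h i x + sumOver f (map (both x y) (cross i)) + sumOver f (map (both x y) (cross₂ i)) ≡ S x + S y
    cross-sum i x y = trans (cong₂ (λ p q → h i x + p + q) (sumOver-map f (both x y) (cross i)) (sumOver-map f (both x y) (cross₂ i)))
                            (cross-cover i (f ∘ both x y))

    item : ∀ i t → sumOver (sumOver f) (cyclesOf i t) + lossV (h i) t ≡ gainV S (h i) (f ∞) t
    item i (single∞ x)  = trans (lem (f ∞) (sumOver f (map (pt x) (near i))) (h i x)) (cong (_+ f ∞) (near-sum i x))
      where
      lem : ∀ o c l → o + c + 0 + l ≡ c + l + o
      lem = ℕ-solve
    item i (single x y) = trans (lem (h i y) (sumOver f (map (pt x) (near i))) (h i x)) (cong (_+ h i y) (near-sum i x))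
      where
      lem : ∀ o c l → o + c + 0 + l ≡ c + l + o
      lem = ℕ-solve
    item i (pair x y)   = trans (lem (h i x) (sumOver f (map (both x y) (cross i))) (sumOver f (map (both x y) (cross₂ i)))) (cross-sum i x y)
      where
      lem : ∀ p c d → p + c + (d + 0) + 0 ≡ p + c + d
      lem = ℕ-solve
    item i (pair∞ x y)  = trans (lem (f ∞) (h i x) (sumOver f (map (both x y) (cross i))) (sumOver f (map (both x y) (cross₂ i)))) (cong (_+ f ∞) (cross-sum i x y))
      where
      lem : ∀ o p c d → o + c + (d + 0) + p ≡ p + c + d + o
      lem = ℕ-solve

    cover-row : ∀ i j items → sumOver (gainV S (h i) (f ∞)) items + h i j ≡ ∑F S + f ∞ + sumOver (lossV (h i)) items →
      sumOver (sumOver f) (concatMap (cyclesOf i) items) + h i j ≡ ∑F f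
    cover-row i j items e = ℕₚ.+-cancelʳ-≡ L (C + h i j) (∑F f) (begin
      C + h i j + L                                   ≡⟨ lem C (h i j) L ⟩
      C + L + h i j                                   ≡⟨ cong (λ k → k + L + h i j) (sumOver-concatMap (sumOver f) (cyclesOf i) items) ⟩
      sumOver (sumOver (sumOver f) ∘ cyclesOf i) items + L + h i j
                                                      ≡⟨ cong (_+ h i j) (sumOver-cancel (item i) items) ⟩
      sumOver (gainV S (h i) (f ∞)) items + h i j     ≡⟨ e ⟩
      ∑F S + f ∞ + L                                  ≡⟨ cong (_+ L) (trans (ℕₚ.+-comm (∑F S) (f ∞)) (sym (∑F-pt f))) ⟩
      ∑F f + L                                        ∎)
      where
      L C : ℕ
      L = sumOver (lossV (h i)) items
      C = sumOver (sumOver f) (concatMap (cyclesOf i) items)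
      lem : ∀ c p l → c + p + l ≡ c + l + p
      lem = ℕ-solve

    cover-round : sumOver (sumOver f) (proj₂ roundFactor) + f ∞ ≡ ∑F f
    cover-round = begin
      sumOver (sumOver f) (map (λ x → map (pt x) round) (allFin s)) + f ∞
        ≡⟨ cong (_+ f ∞) (trans (sumOver-map (sumOver f) (λ x → map (pt x) round) (allFin s)) (sumOver-allFin (λ x → sumOver f (map (pt x) round)))) ⟩
      ∑F (λ x → sumOver f (map (pt x) round)) + f ∞
        ≡⟨ cong (_+ f ∞) (∑F-cong (λ x → trans (sumOver-map f (pt x) round) (round-cover (f ∘ pt x)))) ⟩
      ∑F S + f ∞
        ≡⟨ trans (ℕₚ.+-comm (∑F S) (f ∞)) (sym (∑F-pt f)) ⟩
      ∑F f ∎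

  covers : All (λ p → ∀ f → sumOver (sumOver f) (proj₂ p) + f (proj₁ p) ≡ ∑F f) factors
  covers = (λ f → Cover.cover-round f) ∷ Allₚ.concat⁺ (Allₚ.map⁺ (All.map
    (λ {ρ} cov → Allₚ.map⁺ (All.tabulate (λ {i} _ f → Cover.cover-row f i (proj₁ ρ) (proj₂ ρ) (cov (Cover.S f) (Cover.h f i) (f ∞))))) coverV))

  module Edges (F : Fin u → Fin u → ℕ) (F-sym : Symmetric F) where
    N O E∞ diag : Fin s → ℕ
    N x    = sumOver (λ i → chain (λ v w → F (pt x v) (pt x w)) (left i ∷ nearMid i) (right i)) indices
    O x    = ∑F (λ v → F ∞ (pt x v))
    E∞ x   = cycleSum F (map (pt x) round)
    diag x = ∑F (λ v → F (pt x v) (pt x v))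

    -- `R x y` weighs the edges that `pair∞ x y` releases and `single y x` spends.
    R Φ : Fin s → Fin s → ℕ
    R x y = sumOver (λ i → F (pt x (hole i)) (pt y (left i)) + F (pt x (hole i)) (pt y (right i))) indices
    Φ x y = ∑F (λ v → ∑F (λ w → F (pt x v) (pt y w)))

    Φ-sym : Symmetric Φ
    Φ-sym x y = trans (∑F-swap (λ v w → F (pt x v) (pt y w))) (∑F-cong (λ w → ∑F-cong (λ v → F-sym (pt x v) (pt y w))))

    N-identity : ∀ x → N x + E∞ x + diag x ≡ Φ x x
    N-identity x = trans (cong (λ k → N x + k + diag x) (cycleSum-map F (pt x) round)) (near-edges (λ v w → F (pt x v) (pt x w)) (λ v w → F-sym _ _))

    closed : (g : A → Fin u) (q : Fin u) (p : A) (mid : List A) (r : A) →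
      cycleSum F (q ∷ map g (p ∷ mid ++ r ∷ [])) ≡ chain (λ v w → F (g v) (g w)) (p ∷ mid) r + (F q (g p) + F q (g r))
    closed g q p mid r = begin
      cycleSum F (q ∷ g p ∷ map g (mid ++ r ∷ []))     ≡⟨ cong (λ l → cycleSum F (q ∷ g p ∷ l)) (map-snoc mid) ⟩
      cycleSum F (q ∷ g p ∷ map g mid ++ g r ∷ [])     ≡⟨ cycleSum-closed F q (g p) (map g mid) (g r) ⟩
      F q (g p) + chain F (g p ∷ map g mid) (g r) + F (g r) q
                                                       ≡⟨ cong₂ (λ c e → F q (g p) + c + e) (chain-map F g (p ∷ mid) r) (F-sym (g r) q) ⟩
      F q (g p) + chain (λ v w → F (g v) (g w)) (p ∷ mid) r + F q (g r)
                                                       ≡⟨ lem (F q (g p)) _ _ ⟩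
      _ ∎
      where
      lem : ∀ x y z → x + y + z ≡ y + (x + z)
      lem = ℕ-solve
      map-snoc : ∀ mid → map g (mid ++ r ∷ []) ≡ map g mid ++ g r ∷ []
      map-snoc []        = refl
      map-snoc (x ∷ mid) = cong (g x ∷_) (map-snoc mid)

    EI : Item s → ℕ
    EI t = sumOver (λ i → sumOver (cycleSum F) (cyclesOf i t)) indices

    single-sum : ∀ (q : I → Fin u) x → sumOver (λ i → cycleSum F (q i ∷ map (pt x) (near i)) + 0) indices
      ≡ N x + sumOver (λ i → F (q i) (pt x (left i)) + F (q i) (pt x (right i))) indices
    single-sum q x = trans (sumOver-cong (λ i → trans (ℕₚ.+-identityʳ _) (closed (pt x) (q i) (left i) (nearMid i) (right i))) indices) (sumOver-+ _ _ indices)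

    pair-sum : ∀ x y → sumOver (λ i → cycleSum F (map (both x y) (inj₁ (hole i) ∷ cross i)) + cycleSum F (map (both x y) (cross₂ i))) indices ≡ Φ x y + Φ x y
    pair-sum x y = trans (sumOver-cong (λ i → cong₂ _+_ (cycleSum-map F (both x y) (inj₁ (hole i) ∷ cross i)) (cycleSum-map F (both x y) (cross₂ i))) indices)
                         (cross-edges (λ v w → F (both x y v) (both x y w)) (λ v w → F-sym _ _))

    -- Both cycles contain the path `cross i`. Only the edges from the closing vertex to its two
    -- ends differ, and those ends lie in the second group.
    exchange : ∀ x y i → cycleSum F (∞ ∷ map (both x y) (cross i)) + (F (pt x (hole i)) (pt y (left i)) + F (pt x (hole i)) (pt y (right i)))
      ≡ cycleSum F (map (both x y) (inj₁ (hole i) ∷ cross i)) + (F ∞ (pt y (left i)) + F ∞ (pt y (right i)))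
    exchange x y i = trans (cong (_+ e) (closed (both x y) ∞ (inj₂ (left i)) (crossMid i) (inj₂ (right i))))
      (trans (lem c (F ∞ (pt y (left i)) + F ∞ (pt y (right i))) e) (cong (_+ (F ∞ (pt y (left i)) + F ∞ (pt y (right i))))
        (sym (closed (both x y) (pt x (hole i)) (inj₂ (left i)) (crossMid i) (inj₂ (right i))))))
      where
      c e : ℕ
      c = chain (λ v w → F (both x y v) (both x y w)) (inj₂ (left i) ∷ crossMid i) (inj₂ (right i))
      e = F (pt x (hole i)) (pt y (left i)) + F (pt x (hole i)) (pt y (right i))
      lem : ∀ c o e → c + o + e ≡ c + e + o
      lem = ℕ-solve

    item : ∀ t → EI t + lossE R t ≡ gainE N O R Φ t
    item (single∞ x)  = trans (ℕₚ.+-identityʳ _) (trans (single-sum (λ _ → ∞) x) (cong (N x +_) (∑-ends (λ v → F ∞ (pt x v)))))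
    item (single x y) = trans (ℕₚ.+-identityʳ _) (single-sum (λ i → pt y (hole i)) x)
    item (pair x y)   = trans (ℕₚ.+-identityʳ _) (trans (sumOver-cong (λ i → cong (C₁ i +_) (ℕₚ.+-identityʳ _)) indices) (pair-sum x y))
      where
      C₁ : I → ℕ
      C₁ i = cycleSum F (map (both x y) (inj₁ (hole i) ∷ cross i))
    item (pair∞ x y)  = begin
      sumOver (λ i → D₁ i + (C₂ i + 0)) indices + R x y              ≡⟨ sumOver-+ (λ i → D₁ i + (C₂ i + 0)) r indices ⟨
      sumOver (λ i → D₁ i + (C₂ i + 0) + r i) indices                ≡⟨ sumOver-cong step indices ⟩
      sumOver (λ i → C₁ i + C₂ i + o i) indices                      ≡⟨ sumOver-+ (λ i → C₁ i + C₂ i) o indices ⟩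
      sumOver (λ i → C₁ i + C₂ i) indices + sumOver o indices        ≡⟨ cong₂ _+_ (pair-sum x y) (∑-ends (λ v → F ∞ (pt y v))) ⟩
      Φ x y + Φ x y + (O y + O y)                                    ∎
      where
      C₁ C₂ D₁ r o : I → ℕ
      C₁ i = cycleSum F (map (both x y) (inj₁ (hole i) ∷ cross i))
      C₂ i = cycleSum F (map (both x y) (cross₂ i))
      D₁ i = cycleSum F (∞ ∷ map (both x y) (cross i))
      r i  = F (pt x (hole i)) (pt y (left i)) + F (pt x (hole i)) (pt y (right i))
      o i  = F ∞ (pt y (left i)) + F ∞ (pt y (right i))
      lem₁ : ∀ d c r → d + (c + 0) + r ≡ d + r + c
      lem₁ = ℕ-solve
      lem₂ : ∀ d o c → d + o + c ≡ d + c + o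
      lem₂ = ℕ-solve
      step : ∀ i → D₁ i + (C₂ i + 0) + r i ≡ C₁ i + C₂ i + o i
      step i = trans (lem₁ (D₁ i) (C₂ i) (r i)) (trans (cong (_+ C₂ i) (exchange x y i)) (lem₂ (C₁ i) (o i) (C₂ i)))

    rowSum : Fin s × List (Item s) → ℕ
    rowSum ρ = sumOver EI (proj₂ ρ)

    row-edges : ∀ ρ → sumOver (λ p → sumOver (cycleSum F) (proj₂ p)) (row ρ) ≡ rowSum ρ
    row-edges (j , items) = trans (sumOver-map _ (λ i → pt j (hole i) , concatMap (cyclesOf i) items) indices)
      (trans (sumOver-cong (λ i → sumOver-concatMap (cycleSum F) (cyclesOf i) items) indices)
             (sumOver-swap (λ i t → sumOver (cycleSum F) (cyclesOf i t)) indices items))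

    rows-identity : sumOver rowSum rows + sumOver (λ ρ → sumOver (lossE R) (proj₂ ρ)) rows ≡ sumOver (λ ρ → sumOver (gainE N O R Φ) (proj₂ ρ)) rows
    rows-identity = sumOver-cancel (λ ρ → sumOver-cancel item (proj₂ ρ)) rows

    T L : ℕ
    T = sumOver rowSum rows
    L = sumOver (λ ρ → sumOver (lossE R) (proj₂ ρ)) rows

    -- `N-identity` splits the sums Φ x x on the left of `coverE` into near paths, round and
    -- diagonal; afterwards the near paths and the released edges cancel.
    key : T + ∑F E∞ + ∑F diag ≡ ∑F (λ x → ∑F (Φ x)) + (∑F O + ∑F O)
    key = ℕₚ.+-cancelʳ-≡ (∑F N + L) _ _ (begin
      T + ∑F E∞ + ∑F diag + (∑F N + L)                   ≡⟨ lem₁ T (∑F E∞) (∑F diag) (∑F N) L ⟩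
      T + L + (∑F N + ∑F E∞ + ∑F diag)                   ≡⟨ cong₂ _+_ rows-identity (trans (cong (_+ ∑F diag) (sym (∑F-+ N E∞))) (trans (sym (∑F-+ (λ x → N x + E∞ x) diag)) (∑F-cong N-identity))) ⟩
      G + ∑F (λ x → Φ x x)                               ≡⟨ coverE N O R Φ Φ-sym ⟩
      ∑F (λ x → ∑F (Φ x)) + ∑F N + (∑F O + ∑F O) + L     ≡⟨ lem₂ (∑F (λ x → ∑F (Φ x))) (∑F N) (∑F O + ∑F O) L ⟩
      ∑F (λ x → ∑F (Φ x)) + (∑F O + ∑F O) + (∑F N + L)   ∎)
      where
      G : ℕ
      G = sumOver (λ ρ → sumOver (gainE N O R Φ) (proj₂ ρ)) rows
      lem₁ : ∀ t e d n l → t + e + d + (n + l) ≡ t + l + (n + e + d)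
      lem₁ = ℕ-solve
      lem₂ : ∀ f n o l → f + n + o + l ≡ f + o + (n + l)
      lem₂ = ℕ-solve

    edges : sumOver (λ p → sumOver (cycleSum F) (proj₂ p)) factors + ∑F (λ x → F x x) ≡ ∑F (λ x → ∑F (F x))
    edges = begin
      sumOver (cycleSum F) (proj₂ roundFactor) + sumOver E (concatMap row rows) + ∑F (λ x → F x x)
        ≡⟨ cong₂ _+_ (cong₂ _+_ roundSum (trans (sumOver-concatMap E row rows) (sumOver-cong row-edges rows))) (∑F-pt (λ x → F x x)) ⟩
      ∑F E∞ + T + (F ∞ ∞ + ∑F diag)
        ≡⟨ lem₁ (∑F E∞) T (F ∞ ∞) (∑F diag) ⟩
      F ∞ ∞ + (T + ∑F E∞ + ∑F diag)
        ≡⟨ cong (F ∞ ∞ +_) key ⟩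
      F ∞ ∞ + (∑F (λ x → ∑F (Φ x)) + (∑F O + ∑F O))
        ≡⟨ lem₂ (F ∞ ∞) (∑F (λ x → ∑F (Φ x))) (∑F O) ⟩
      F ∞ ∞ + ∑F O + (∑F O + ∑F (λ x → ∑F (Φ x)))
        ≡⟨ cong₂ _+_ (sym (∑F-pt (F ∞))) (trans (sym (∑F-+ O (λ x → ∑F (Φ x)))) (∑F-cong rowOf)) ⟩
      ∑F (F ∞) + ∑F (λ x → ∑F (λ v → ∑F (F (pt x v))))
        ≡⟨ ∑F-pt (λ v → ∑F (F v)) ⟨
      ∑F (λ v → ∑F (F v)) ∎
      where
      E : Fin u × List (List (Fin u)) → ℕ
      E p = sumOver (cycleSum F) (proj₂ p)
      roundSum : sumOver (cycleSum F) (proj₂ roundFactor) ≡ ∑F E∞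
      roundSum = trans (sumOver-map (cycleSum F) (λ x → map (pt x) round) (allFin s)) (sumOver-allFin E∞)
      lem₁ : ∀ e t o d → e + t + (o + d) ≡ o + (t + e + d)
      lem₁ = ℕ-solve
      lem₂ : ∀ f p o → f + (p + (o + o)) ≡ f + o + (o + p)
      lem₂ = ℕ-solve
      rowOf : ∀ x → O x + ∑F (Φ x) ≡ ∑F (λ v → ∑F (F (pt x v)))
      rowOf x = begin
        O x + ∑F (λ y → ∑F (λ v → ∑F (λ w → F (pt x v) (pt y w))))
          ≡⟨ cong₂ _+_ (∑F-cong (λ v → F-sym ∞ (pt x v))) (∑F-swap (λ y v → ∑F (λ w → F (pt x v) (pt y w)))) ⟩
        ∑F (λ v → F (pt x v) ∞) + ∑F (λ v → ∑F (λ y → ∑F (λ w → F (pt x v) (pt y w))))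
          ≡⟨ ∑F-+ (λ v → F (pt x v) ∞) (λ v → ∑F (λ y → ∑F (λ w → F (pt x v) (pt y w)))) ⟨
        ∑F (λ v → F (pt x v) ∞ + ∑F (λ y → ∑F (λ w → F (pt x v) (pt y w))))
          ≡⟨ ∑F-cong (λ v → sym (∑F-pt (F (pt x v)))) ⟩
        ∑F (λ v → ∑F (F (pt x v))) ∎

  assembly : NearFactorization u a
  assembly = record { factors = factors ; lengths = lengths ; covers = covers ; edges = λ F F-sym → Edges.edges F F-sym }

-- Schemes for every positive number of groups

∑-doubled : ∀ n (f : ℕ → ℕ) → ∑ n (λ i → f i + f i) ≡ ∑ n f + ∑ n f
∑-doubled n f = ∑-+ n f f

-- With two groups a single transfer suffices: group 1 receives the hole vertex of group 0, which is
-- completed by ∞, and the one `pair∞` releases precisely the edges needed.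
scheme₂ : Scheme 2
scheme₂ = record
  { rows   = (zero , pair∞ zero (suc zero) ∷ []) ∷ (suc zero , single∞ zero ∷ single (suc zero) zero ∷ []) ∷ []
  ; coverV = (λ S h o → lem₁ (S zero) (S (suc zero)) (h zero) o) ∷ (λ S h o → lem₂ (S zero) (S (suc zero)) (h zero) (h (suc zero)) o) ∷ []
  ; coverE = λ N O R Φ Φ-sym → trans (lem₃ (N zero) (N (suc zero)) (O zero) (O (suc zero)) (R zero (suc zero)) (Φ zero zero) (Φ zero (suc zero)) (Φ (suc zero) (suc zero)))
      (cong (λ k → Φ zero zero + (Φ zero (suc zero) + 0) + (k + (Φ (suc zero) (suc zero) + 0) + 0) + (N zero + (N (suc zero) + 0))
                 + (O zero + (O (suc zero) + 0) + (O zero + (O (suc zero) + 0))) + (R zero (suc zero) + 0 + 0)) (Φ-sym zero (suc zero)))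
  }
  where
  lem₁ : ∀ a b h o → a + b + o + 0 + h ≡ a + (b + 0) + o + (h + 0)
  lem₁ = ℕ-solve
  lem₂ : ∀ a b h k o → a + o + (b + h + 0) + k ≡ a + (b + 0) + o + (h + (k + 0))
  lem₂ = ℕ-solve
  lem₃ : ∀ n₀ n₁ o₀ o₁ r p q t →
    q + q + (o₁ + o₁) + 0 + (n₀ + (o₀ + o₀) + (n₁ + r + 0) + 0) + (p + (t + 0))
      ≡ p + (q + 0) + (q + (t + 0) + 0) + (n₀ + (n₁ + 0)) + (o₀ + (o₁ + 0) + (o₀ + (o₁ + 0))) + (r + 0 + 0)
  lem₃ = ℕ-solve

module _ (n : ℕ) where
  open OddCycle n

  schemeOdd : Scheme N
  schemeOdd = record { rows = applyUpTo row N ; coverV = Allₚ.applyUpTo⁺₂ row N (λ c → coverV (⁺ c)) ; coverE = coverE }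
    where
    P : ℤ → Fin N
    P = ι N
    pairs : ℤ → ℕ → Item N
    pairs c i = pair (P (c +ᶻ ⁺ suc i)) (P (c - ⁺ suc i))
    items : ℤ → List (Item N)
    items c = single∞ (P c) ∷ applyUpTo (pairs c) n
    row : ℕ → Fin N × List (Item N)
    row c = P (⁺ c) , items (⁺ c)
    coverV : ∀ c (S h : Fin N → ℕ) o → sumOver (gainV S h o) (items c) + h (P c) ≡ ∑F S + o + sumOver (lossV h) (items c)
    coverV c S h o = begin
      S (P c) + o + sumOver (gainV S h o) (applyUpTo (pairs c) n) + h (P c)
        ≡⟨ cong (λ k → S (P c) + o + k + h (P c)) (sumOver-applyUpTo (gainV S h o) (pairs c) n) ⟩
      S (P c) + o + X + h (P c)
        ≡⟨ lem (S (P c)) o X (h (P c)) ⟩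
      X + S (P c) + o + (h (P c) + 0)
        ≡⟨ cong₂ (λ k l → k + o + (h (P c) + l)) (trans (∑ℤ-around (S ∘ P) (λ z → cong S (ι-periodic N z)) c) (sym (∑F-ι N S)))
                 (sym (trans (sumOver-applyUpTo (lossV h) (pairs c) n) (∑-0 n))) ⟩
      ∑F S + o + (h (P c) + sumOver (lossV h) (applyUpTo (pairs c) n)) ∎
      where
      X : ℕ
      X = ∑ n (λ i → S (P (c +ᶻ ⁺ suc i)) + S (P (c - ⁺ suc i)))
      lem : ∀ s o x h → s + o + x + h ≡ x + s + o + (h + 0)
      lem = ℕ-solve
    coverE : ∀ M O R Φ → Symmetric Φ →
      sumOver (λ ρ → sumOver (gainE M O R Φ) (proj₂ ρ)) (applyUpTo row N) + ∑F (λ x → Φ x x)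
        ≡ ∑F (λ x → ∑F (Φ x)) + ∑F M + (∑F O + ∑F O) + sumOver (λ ρ → sumOver (lossE R) (proj₂ ρ)) (applyUpTo row N)
    coverE M O R Φ Φ-sym = begin
      sumOver (λ ρ → sumOver (gainE M O R Φ) (proj₂ ρ)) (applyUpTo row N) + ∑F (λ x → Φ x x)
        ≡⟨ cong₂ _+_ (trans (sumOver-applyUpTo (λ ρ → sumOver (gainE M O R Φ) (proj₂ ρ)) row N) (∑-cong N rowSum)) (∑F-ι N (λ x → Φ x x)) ⟩
      ∑ N (λ c → M (p c) + (O (p c) + O (p c)) + (X c + X c)) + diag
        ≡⟨ cong (_+ diag) (trans (∑-+ N (λ c → M (p c) + (O (p c) + O (p c))) (λ c → X c + X c))
             (cong₂ _+_ (trans (∑-+ N (M ∘ p) (λ c → O (p c) + O (p c))) (cong (∑ N (M ∘ p) +_) (∑-doubled N (O ∘ p)))) (∑-doubled N X))) ⟩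
      ∑ N (M ∘ p) + (∑ N (O ∘ p) + ∑ N (O ∘ p)) + (∑ N X + ∑ N X) + diag
        ≡⟨ lem (∑ N (M ∘ p)) (∑ N (O ∘ p) + ∑ N (O ∘ p)) (∑ N X + ∑ N X) diag ⟩
      (∑ N X + ∑ N X + diag) + ∑ N (M ∘ p) + (∑ N (O ∘ p) + ∑ N (O ∘ p)) + 0
        ≡⟨ cong₂ _+_ (cong₂ _+_ (cong₂ _+_
             (trans (pairs-around (λ x y → Φ (P x) (P y)) (λ x y → Φ-sym (P x) (P y)) (λ x y → cong (Φ (P x)) (ι-periodic N y)))
                    (trans (∑ℤ-cong N (λ x → sym (∑F-ι N (Φ (P x))))) (sym (∑F-ι N (λ x → ∑F (Φ x))))))
             (sym (∑F-ι N M))) (cong₂ _+_ (sym (∑F-ι N O)) (sym (∑F-ι N O))))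
             (sym (trans (sumOver-applyUpTo (λ ρ → sumOver (lossE R) (proj₂ ρ)) row N) (trans (∑-cong N (λ c → trans (sumOver-applyUpTo (lossE R) (pairs (⁺ c)) n) (∑-0 n))) (∑-0 N)))) ⟩
      ∑F (λ x → ∑F (Φ x)) + ∑F M + (∑F O + ∑F O) + sumOver (λ ρ → sumOver (lossE R) (proj₂ ρ)) (applyUpTo row N) ∎
      where
      p : ℕ → Fin N
      p c = P (⁺ c)
      diag : ℕ
      diag = ∑ℤ N (λ j → Φ (P j) (P j))
      X : ℕ → ℕ
      X c = ∑ n (λ i → Φ (P (⁺ c +ᶻ ⁺ suc i)) (P (⁺ c - ⁺ suc i)))
      rowSum : ∀ c → sumOver (gainE M O R Φ) (items (⁺ c)) ≡ M (p c) + (O (p c) + O (p c)) + (X c + X c)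
      rowSum c = cong (M (p c) + (O (p c) + O (p c)) +_) (trans (sumOver-applyUpTo (gainE M O R Φ) (pairs (⁺ c)) n)
        (∑-doubled n (λ i → Φ (P (⁺ c +ᶻ ⁺ suc i)) (P (⁺ c - ⁺ suc i)))))
      lem : ∀ m o x d → m + o + x + d ≡ x + d + m + o + 0
      lem = ℕ-solve

module _ (n' : ℕ) where
  private
    n : ℕ
    n = suc n'
  open OddCycle n

  -- `Y` stands outside the cyclic order of the other N groups. With the hole in group c these are
  -- matched by x + y = 2c + 1, and the fixed group c + n + 1 is matched with `Y`. Now c itself is
  -- matched, with c + 1, so its hole vertex is replaced by ∞. This releases R c (c+1), which
  -- `stays` spends in the row of `Y`.
  schemeEven : Scheme (suc N)
  schemeEven = record
    { rows   = (Y , itemsY) ∷ applyUpTo row N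
    ; coverV = coverY ∷ Allₚ.applyUpTo⁺₂ row N (λ c → coverV (⁺ c))
    ; coverE = coverE
    }
    where
    P : ℤ → Fin (suc N)
    P z = suc (ι N z)
    P-periodic : Periodic N P
    P-periodic z = cong suc (ι-periodic N z)
    Y : Fin (suc N)
    Y = zero
    ∑F-P : ∀ (f : Fin (suc N) → ℕ) → ∑F f ≡ f Y + ∑ℤ N (f ∘ P)
    ∑F-P f = cong (f Y +_) (∑F-ι N (f ∘ suc))
    stays : ℕ → Item (suc N)
    stays c = single (P (⁺ c)) (P (⁺ c - ⁺ 1))
    itemsY : List (Item (suc N))
    itemsY = single∞ Y ∷ applyUpTo stays N
    pairs : ℤ → ℕ → Item (suc N)
    pairs c i = pair (P (c +ᶻ ⁺ suc (suc i))) (P (c - ⁺ suc i))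
    items : ℤ → List (Item (suc N))
    items c = pair∞ (P c) (P (c +ᶻ ⁺ 1)) ∷ pair (P (c +ᶻ ⁺ suc n)) Y ∷ applyUpTo (pairs c) n'
    row : ℕ → Fin (suc N) × List (Item (suc N))
    row c = P (⁺ c) , items (⁺ c)

    coverY : ∀ (S h : Fin (suc N) → ℕ) o → sumOver (gainV S h o) itemsY + h Y ≡ ∑F S + o + sumOver (lossV h) itemsY
    coverY S h o = begin
      S Y + o + sumOver (gainV S h o) (applyUpTo stays N) + h Y
        ≡⟨ cong (λ k → S Y + o + k + h Y) (trans (sumOver-applyUpTo (gainV S h o) stays N) (∑-+ N (λ c → S (P (⁺ c))) (λ c → h (P (⁺ c - ⁺ 1))))) ⟩
      S Y + o + (∑ℤ N (S ∘ P) + ∑ℤ N (λ z → h (P (z - ⁺ 1)))) + h Y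
        ≡⟨ cong (λ k → S Y + o + (∑ℤ N (S ∘ P) + k) + h Y) (∑ℤ-shift N (h ∘ P) (λ z → cong h (P-periodic z)) (- ⁺ 1)) ⟩
      S Y + o + (∑ℤ N (S ∘ P) + ∑ℤ N (h ∘ P)) + h Y
        ≡⟨ lem (S Y) o (∑ℤ N (S ∘ P)) (∑ℤ N (h ∘ P)) (h Y) ⟩
      S Y + ∑ℤ N (S ∘ P) + o + (h Y + ∑ℤ N (h ∘ P))
        ≡⟨ cong₂ (λ k l → k + o + (h Y + l)) (sym (∑F-P S)) (sym (sumOver-applyUpTo (lossV h) stays N)) ⟩
      ∑F S + o + (h Y + sumOver (lossV h) (applyUpTo stays N)) ∎
      where
      lem : ∀ s o x y h → s + o + (x + y) + h ≡ s + x + o + (h + y)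
      lem = ℕ-solve

    coverV : ∀ c (S h : Fin (suc N) → ℕ) o → sumOver (gainV S h o) (items c) + h (P c) ≡ ∑F S + o + sumOver (lossV h) (items c)
    coverV c S h o = begin
      s₀ + s₁ + o + (s₂ + S Y + sumOver (gainV S h o) (applyUpTo (pairs c) n')) + h (P c)
        ≡⟨ cong (λ k → s₀ + s₁ + o + (s₂ + S Y + k) + h (P c)) (sumOver-applyUpTo (gainV S h o) (pairs c) n') ⟩
      s₀ + s₁ + o + (s₂ + S Y + X) + h (P c)
        ≡⟨ lem s₀ s₁ o s₂ (S Y) X (h (P c)) ⟩
      S Y + (s₁ + s₀ + X + s₂) + o + (h (P c) + 0)
        ≡⟨ cong₂ (λ k l → S Y + k + o + (h (P c) + l))
             (trans (cong (λ k → s₁ + S (P k) + X + s₂) (sym (ℤₚ.+-identityʳ c))) (∑ℤ-around½ (S ∘ P) (λ z → cong S (P-periodic z)) c))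
             (sym (trans (sumOver-applyUpTo (lossV h) (pairs c) n') (∑-0 n'))) ⟩
      S Y + ∑ℤ N (S ∘ P) + o + (h (P c) + sumOver (lossV h) (applyUpTo (pairs c) n'))
        ≡⟨ cong (λ k → k + o + (h (P c) + sumOver (lossV h) (applyUpTo (pairs c) n'))) (sym (∑F-P S)) ⟩
      ∑F S + o + (h (P c) + sumOver (lossV h) (applyUpTo (pairs c) n')) ∎
      where
      s₀ s₁ s₂ X : ℕ
      s₀ = S (P c)
      s₁ = S (P (c +ᶻ ⁺ 1))
      s₂ = S (P (c +ᶻ ⁺ suc n))
      X  = ∑ n' (λ i → S (P (c +ᶻ ⁺ suc (suc i))) + S (P (c - ⁺ suc i)))
      lem : ∀ a b o c y x h → a + b + o + (c + y + x) + h ≡ y + (b + a + x + c) + o + (h + 0)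
      lem = ℕ-solve

    coverE : ∀ M O R Φ → Symmetric Φ →
      sumOver (gainE M O R Φ) itemsY + sumOver (λ ρ → sumOver (gainE M O R Φ) (proj₂ ρ)) (applyUpTo row N) + ∑F (λ x → Φ x x)
        ≡ ∑F (λ x → ∑F (Φ x)) + ∑F M + (∑F O + ∑F O) + (sumOver (lossE R) itemsY + sumOver (λ ρ → sumOver (lossE R) (proj₂ ρ)) (applyUpTo row N))
    coverE M O R Φ Φ-sym = begin
      sumOver (gainE M O R Φ) itemsY + sumOver (λ ρ → sumOver (gainE M O R Φ) (proj₂ ρ)) (applyUpTo row N) + ∑F (λ x → Φ x x)
        ≡⟨ cong₂ _+_ (cong₂ _+_ rowY (trans (sumOver-applyUpTo (λ ρ → sumOver (gainE M O R Φ) (proj₂ ρ)) row N) (trans (∑-cong N rowSum) rowsSum))) (∑F-P (λ x → Φ x x)) ⟩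
      M Y + (O Y + O Y) + (∑M + ∑R) + (X + X + (∑O + ∑O) + (Z + Z)) + (Φ Y Y + diag)
        ≡⟨ lem (M Y) (O Y) ∑M ∑R X ∑O Z (Φ Y Y) diag ⟩
      Φ Y Y + Z + (Z + (X + X + diag)) + (M Y + ∑M) + (O Y + ∑O + (O Y + ∑O)) + (0 + ∑R)
        ≡⟨ cong₂ _+_ (cong₂ _+_ (cong₂ _+_ total (sym (∑F-P M))) (cong₂ _+_ (sym (∑F-P O)) (sym (∑F-P O)))) (cong₂ _+_ (sym lossY) (sym lossRows)) ⟩
      ∑F (λ x → ∑F (Φ x)) + ∑F M + (∑F O + ∑F O) + (sumOver (lossE R) itemsY + sumOver (λ ρ → sumOver (lossE R) (proj₂ ρ)) (applyUpTo row N)) ∎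
      where
      x₀ : ℕ → ℕ
      x₀ c = Φ (P (⁺ c)) (P (⁺ c +ᶻ ⁺ 1))
      xs : ℕ → ℕ
      xs c = ∑ n' (λ i → Φ (P (⁺ c +ᶻ ⁺ suc (suc i))) (P (⁺ c - ⁺ suc i)))
      zs : ℕ → ℕ
      zs c = Φ (P (⁺ c +ᶻ ⁺ suc n)) Y
      os : ℕ → ℕ
      os c = O (P (⁺ c +ᶻ ⁺ 1))
      ∑M ∑O ∑R X Z diag : ℕ
      ∑M = ∑ℤ N (M ∘ P)
      ∑O = ∑ℤ N (O ∘ P)
      ∑R = ∑ℤ N (λ c → R (P c) (P (c +ᶻ ⁺ 1)))
      X  = ∑ N (λ c → x₀ c + xs c)
      Z  = ∑ℤ N (λ c → Φ (P c) Y)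
      diag = ∑ℤ N (λ c → Φ (P c) (P c))
      rowY : sumOver (gainE M O R Φ) itemsY ≡ M Y + (O Y + O Y) + (∑M + ∑R)
      rowY = cong (M Y + (O Y + O Y) +_) (trans (sumOver-applyUpTo (gainE M O R Φ) stays N)
        (trans (∑-+ N (λ c → M (P (⁺ c))) (λ c → R (P (⁺ c - ⁺ 1)) (P (⁺ c)))) (cong (∑M +_) shifted)))
        where
        back : ∀ (z : ℤ) → z ≡ z - ⁺ 1 +ᶻ ⁺ 1
        back = solve-∀
        -- Spent edges are indexed by the receiving group and released ones by the giving group,
        -- hence the shift by one.
        shifted : ∑ℤ N (λ c → R (P (c - ⁺ 1)) (P c)) ≡ ∑R
        shifted = trans (∑ℤ-cong N (λ z → cong (λ k → R (P (z - ⁺ 1)) (P k)) (back z)))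
          (∑ℤ-shift N (λ c → R (P c) (P (c +ᶻ ⁺ 1))) (λ z → cong₂ R (P-periodic z) (Periodic-shift N P (⁺ 1) P-periodic z)) (- ⁺ 1))
      rowSum : ∀ c → sumOver (gainE M O R Φ) (items (⁺ c)) ≡ (x₀ c + xs c) + (x₀ c + xs c) + (os c + os c) + (zs c + zs c)
      rowSum c = trans (cong (λ k → x₀ c + x₀ c + (os c + os c) + (zs c + zs c + k)) (trans (sumOver-applyUpTo (gainE M O R Φ) (pairs (⁺ c)) n')
                   (∑-doubled n' (λ i → Φ (P (⁺ c +ᶻ ⁺ suc (suc i))) (P (⁺ c - ⁺ suc i))))))
                 (arrange (x₀ c) (os c) (zs c) (xs c))
        where
        arrange : ∀ x o z y → x + x + (o + o) + (z + z + (y + y)) ≡ (x + y) + (x + y) + (o + o) + (z + z)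
        arrange = ℕ-solve
      rowsSum : ∑ N (λ c → (x₀ c + xs c) + (x₀ c + xs c) + (os c + os c) + (zs c + zs c)) ≡ X + X + (∑O + ∑O) + (Z + Z)
      rowsSum = trans (∑-+ N (λ c → (x₀ c + xs c) + (x₀ c + xs c) + (os c + os c)) (λ c → zs c + zs c)) (cong₂ _+_
        (trans (∑-+ N (λ c → (x₀ c + xs c) + (x₀ c + xs c)) (λ c → os c + os c)) (cong₂ _+_ (∑-doubled N (λ c → x₀ c + xs c))
          (trans (∑-doubled N os) (cong₂ _+_ shiftO shiftO))))
        (trans (∑-doubled N zs) (cong₂ _+_ shiftZ shiftZ)))
        where
        shiftO : ∑ N os ≡ ∑O
        shiftO = ∑ℤ-shift N (O ∘ P) (λ z → cong O (P-periodic z)) (⁺ 1)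
        shiftZ : ∑ N zs ≡ Z
        shiftZ = ∑ℤ-shift N (λ c → Φ (P c) Y) (λ z → cong (λ v → Φ v Y) (P-periodic z)) (⁺ suc n)
      -- The pair c, c + 1 is the innermost one around c + ½, listed in the opposite order.
      X-around : X ≡ ∑ℤ N (λ j → ∑ n (λ i → Φ (P (j +ᶻ ⁺ suc i)) (P (j - ⁺ i))))
      X-around = ∑-cong N (λ c → cong (_+ xs c) (trans (Φ-sym (P (⁺ c)) (P (⁺ c +ᶻ ⁺ 1)))
        (cong (λ k → Φ (P (⁺ c +ᶻ ⁺ 1)) (P k)) (sym (ℤₚ.+-identityʳ (⁺ c))))))
      total : Φ Y Y + Z + (Z + (X + X + diag)) ≡ ∑F (λ x → ∑F (Φ x))
      total = begin
        Φ Y Y + Z + (Z + (X + X + diag))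
          ≡⟨ cong (λ k → Φ Y Y + Z + (Z + k)) (trans (cong (λ k → k + k + diag) X-around)
               (pairs-around½ (λ x y → Φ (P x) (P y)) (λ x y → Φ-sym (P x) (P y)) (λ x y → cong (Φ (P x)) (P-periodic y)))) ⟩
        Φ Y Y + Z + (Z + ∑ℤ N (λ x → ∑ℤ N (λ y → Φ (P x) (P y))))
          ≡⟨ cong₂ _+_ (cong (Φ Y Y +_) (∑ℤ-cong N (λ c → Φ-sym (P c) Y))) (sym (∑-+ N (λ c → Φ (P (⁺ c)) Y) (λ c → ∑ℤ N (λ y → Φ (P (⁺ c)) (P y))))) ⟩
        Φ Y Y + ∑ℤ N (λ c → Φ Y (P c)) + ∑ℤ N (λ x → Φ (P x) Y + ∑ℤ N (λ y → Φ (P x) (P y)))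
          ≡⟨ cong₂ _+_ (sym (∑F-P (Φ Y))) (∑ℤ-cong N (λ x → sym (∑F-P (Φ (P x))))) ⟩
        ∑F (Φ Y) + ∑ℤ N (λ x → ∑F (Φ (P x)))
          ≡⟨ ∑F-P (λ x → ∑F (Φ x)) ⟨
        ∑F (λ x → ∑F (Φ x)) ∎
      lossY : sumOver (lossE R) itemsY ≡ 0
      lossY = trans (sumOver-applyUpTo (lossE R) stays N) (∑-0 N)
      lossRows : sumOver (λ ρ → sumOver (lossE R) (proj₂ ρ)) (applyUpTo row N) ≡ ∑R
      lossRows = trans (sumOver-applyUpTo (λ ρ → sumOver (lossE R) (proj₂ ρ)) row N) (∑-cong N (λ c →
        trans (cong (R (P (⁺ c)) (P (⁺ c +ᶻ ⁺ 1)) +_) (trans (sumOver-applyUpTo (lossE R) (pairs (⁺ c)) n') (∑-0 n'))) (ℕₚ.+-identityʳ _)))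
      lem : ∀ m o ms r x os z p d → m + (o + o) + (ms + r) + (x + x + (os + os) + (z + z)) + (p + d)
        ≡ p + z + (z + (x + x + d)) + (m + ms) + (o + os + (o + os)) + (0 + r)
      lem = ℕ-solve

-- Alternating walks and the zigzag

chain-cons-weave : (F : A → A → ℕ) → ∀ p (f g : ℕ → A) n →
  chain F (p ∷ weave f g n) (f n) ≡ F p (f 0) + ∑ n (λ i → F (f i) (g i) + F (g i) (f (suc i)))
chain-cons-weave F p f g zero    = sym (ℕₚ.+-identityʳ _)
chain-cons-weave F p f g (suc n) = cong (F p (f 0) +_) (chain-weave F f g (suc n))

chain-applyUpTo-last : (F : A → A → ℕ) (f : ℕ → A) → ∀ n q → chain F (applyUpTo f (suc n)) q ≡ ∑ n (λ i → F (f i) (f (suc i))) + F (f n) q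
chain-applyUpTo-last F f zero    q = refl
chain-applyUpTo-last F f (suc n) q = trans (cong (F (f 0) (f 1) +_) (chain-applyUpTo-last F (f ∘ suc) n q)) (sym (ℕₚ.+-assoc (F (f 0) (f 1)) _ _))

chain-++-applyUpTo : (F : A → A → ℕ) → ∀ xs (f : ℕ → A) n → chain F (xs ++ applyUpTo f n) (f n) ≡ chain F xs (f 0) + ∑ n (λ i → F (f i) (f (suc i)))
chain-++-applyUpTo F xs f zero    = trans (cong (λ l → chain F l (f 0)) (++-identityʳ xs)) (sym (ℕₚ.+-identityʳ _))
chain-++-applyUpTo F xs f (suc n) = trans (chain-++ F xs (f 0) _ (f (suc n))) (cong (chain F xs (f 0) +_) (chain-applyUpTo F f (suc n)))

-- The sequence 0, 1, -1, 2, -2, …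
sign zigzag : ℕ → ℤ
sign zero    = ⁺ 1
sign (suc k) = - sign k
zigzag zero    = ⁺ 0
zigzag (suc k) = zigzag k +ᶻ sign k *ᶻ ⁺ suc k

sign-even : ∀ m → sign (m + m) ≡ ⁺ 1
sign-even zero    = refl
sign-even (suc m) = trans (cong (λ k → - sign k) (ℕₚ.+-suc m m)) (trans (ℤₚ.neg-involutive (sign (m + m))) (sign-even m))

-- The zigzag has steps 1, -2, 3, -4, ...; a weight that is even in the difference does not see
-- their signs, so a zigzag path realizes each length once.
sign-even-function : (f : ℤ → ℕ) → (∀ d → f (- d) ≡ f d) → ∀ k d → f (sign k *ᶻ d) ≡ f d
sign-even-function f e zero    d = cong f (ℤₚ.*-identityˡ d)
sign-even-function f e (suc k) d = trans (cong f (sym (ℤₚ.neg-distribˡ-* (sign k) d))) (trans (e _) (sign-even-function f e k d))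

zigzag-even : ∀ m → zigzag (m + m) ≡ - ⁺ m
zigzag-odd  : ∀ m → zigzag (suc (m + m)) ≡ ⁺ suc m
zigzag-even zero    = refl
zigzag-even (suc m) = trans (cong (λ k → zigzag (suc k)) (ℕₚ.+-suc m m))
  (trans (cong₂ (λ p q → p +ᶻ - q *ᶻ ⁺ suc (suc (m + m))) (zigzag-odd m) (sign-even m)) (lem (⁺ m)))
  where
  lem : ∀ (m : ℤ) → ⁺ 1 +ᶻ m +ᶻ - (⁺ 1) *ᶻ (⁺ 2 +ᶻ (m +ᶻ m)) ≡ - (⁺ 1 +ᶻ m)
  lem = solve-∀
zigzag-odd m = trans (cong₂ (λ p q → p +ᶻ q *ᶻ ⁺ suc (m + m)) (zigzag-even m) (sign-even m)) (lem (⁺ m))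
  where
  lem : ∀ (m : ℤ) → - m +ᶻ ⁺ 1 *ᶻ (⁺ 1 +ᶻ (m +ᶻ m)) ≡ ⁺ 1 +ᶻ m
  lem = solve-∀

-- Each new term extends the interval of values by one point, alternately above and below.
zigzag-interval-odd  : ∀ m (g : ℤ → ℕ) → ∑ (suc (m + m)) (g ∘ zigzag) ≡ ∑ (suc (m + m)) (λ k → g (⁺ k - ⁺ m))
zigzag-interval-even : ∀ m (g : ℤ → ℕ) → ∑ (suc (suc (m + m))) (g ∘ zigzag) ≡ ∑ (suc (suc (m + m))) (λ k → g (⁺ k - ⁺ m))
zigzag-interval-odd zero    g = refl
zigzag-interval-odd (suc m) g = begin
  ∑ (suc (suc m + suc m)) (g ∘ zigzag)                       ≡⟨ cong (λ k → ∑ (suc (suc k)) (g ∘ zigzag)) (ℕₚ.+-suc m m) ⟩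
  ∑ (suc M) (g ∘ zigzag)                                     ≡⟨ ∑-snoc M (g ∘ zigzag) ⟩
  ∑ M (g ∘ zigzag) + g (zigzag M)                            ≡⟨ cong₂ _+_ (zigzag-interval-even m g) (cong g (trans (cong zigzag (cong suc (sym (ℕₚ.+-suc m m)))) (zigzag-even (suc m)))) ⟩
  ∑ M (λ k → g (⁺ k - ⁺ m)) + g (- ⁺ suc m)                  ≡⟨ ℕₚ.+-comm _ (g (- ⁺ suc m)) ⟩
  g (- ⁺ suc m) + ∑ M (λ k → g (⁺ k - ⁺ m))                  ≡⟨ cong₂ _+_ (cong g (sym (ℤₚ.+-identityˡ (- ⁺ suc m)))) (∑-cong M (λ k → cong g (lem (⁺ k) (⁺ m)))) ⟩
  ∑ (suc M) (λ k → g (⁺ k - ⁺ suc m))                        ≡⟨ cong (λ k → ∑ (suc (suc k)) (λ k → g (⁺ k - ⁺ suc m))) (ℕₚ.+-suc m m) ⟨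
  ∑ (suc (suc m + suc m)) (λ k → g (⁺ k - ⁺ suc m))          ∎
  where
  M : ℕ
  M = suc (suc (m + m))
  lem : ∀ (k m : ℤ) → k - m ≡ ⁺ 1 +ᶻ k - (⁺ 1 +ᶻ m)
  lem = solve-∀
zigzag-interval-even m g = trans (∑-snoc M (g ∘ zigzag)) (trans (cong₂ _+_ (zigzag-interval-odd m g)
    (cong g (trans (zigzag-odd m) (lem (⁺ m))))) (sym (∑-snoc M (λ k → g (⁺ k - ⁺ m)))))
  where
  M : ℕ
  M = suc (m + m)
  lem : ∀ (m : ℤ) → ⁺ 1 +ᶻ m ≡ ⁺ 1 +ᶻ (m +ᶻ m) - m
  lem = solve-∀

halve : ∀ n → Σ ℕ (λ m → n ≡ m + m ⊎ n ≡ suc (m + m))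
halve zero    = 0 , inj₁ refl
halve (suc n) with halve n
... | m , inj₁ refl = m , inj₂ refl
... | m , inj₂ refl = suc m , inj₁ (cong suc (sym (ℕₚ.+-suc m m)))

∑-zigzag : ∀ n (g : ℤ → ℕ) → Periodic (suc n) g → ∑ (suc n) (g ∘ zigzag) ≡ ∑ℤ (suc n) g
∑-zigzag n g p with halve n
... | m , inj₁ refl = trans (zigzag-interval-odd m g) (∑ℤ-shift (suc (m + m)) g p (- ⁺ m))
... | m , inj₂ refl = trans (zigzag-interval-even m g) (∑ℤ-shift (suc (suc (m + m))) g p (- ⁺ m))

-- The near-Hamiltonian decomposition on one group and ∞

module Points (h : ℕ) .{{_ : NonZero (h + h)}} where

  -- X_i = 2i and Y_i = 2i+1 modulo 2h, indexed by i modulo h.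
  Q X Y : ℤ → Fin (h + h)
  Q = ι (h + h)
  X z = Q (z +ᶻ z)
  Y z = Q (⁺ 1 +ᶻ (z +ᶻ z))

  Q-periodic : Periodic (h + h) Q
  Q-periodic = ι-periodic (h + h)

  X-periodic : Periodic h X
  X-periodic z = trans (cong Q (lem z (⁺ h))) (Q-periodic (z +ᶻ z))
    where
    lem : ∀ (z h : ℤ) → (z +ᶻ h) +ᶻ (z +ᶻ h) ≡ (z +ᶻ z) +ᶻ (h +ᶻ h)
    lem = solve-∀

  Y-periodic : Periodic h Y
  Y-periodic z = trans (cong Q (lem z (⁺ h))) (Q-periodic (⁺ 1 +ᶻ (z +ᶻ z)))
    where
    lem : ∀ (z h : ℤ) → ⁺ 1 +ᶻ ((z +ᶻ h) +ᶻ (z +ᶻ h)) ≡ (⁺ 1 +ᶻ (z +ᶻ z)) +ᶻ (h +ᶻ h)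
    lem = solve-∀

  ∑F-XY : ∀ f → ∑F f ≡ ∑ℤ h (f ∘ X) + ∑ℤ h (f ∘ Y)
  ∑F-XY f = trans (∑F-ι (h + h) f) (trans (∑-double h (λ t → f (Q (⁺ t)))) (∑-+ h (λ i → f (X (⁺ i))) (λ i → f (Y (⁺ i)))))

  indices : List (ℕ ⊎ ℕ)
  indices = applyUpTo inj₁ h ++ applyUpTo inj₂ h

  sumOver-indices : ∀ (f : ℕ ⊎ ℕ → ℕ) → sumOver f indices ≡ ∑ h (f ∘ inj₁) + ∑ h (f ∘ inj₂)
  sumOver-indices f = trans (sumOver-++ f (applyUpTo inj₁ h) (applyUpTo inj₂ h)) (cong₂ _+_ (sumOver-applyUpTo f inj₁ h) (sumOver-applyUpTo f inj₂ h))

module Near (h″ : ℕ) where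

  h : ℕ
  h = suc (suc h″)

  open Points h public

  c : ℤ
  c = zigzag (suc h″)

  -- The ends are consecutive residues modulo 2h in both cases: 2t+1, 2t+2 for the hole X_t, and
  -- 2(t+c), 2(t+c)+1 for the hole Y_t, since both halves of that path stop at the last zigzag
  -- offset `c`. The bands below depend on this.
  hole left right : ℕ ⊎ ℕ → Fin (h + h)
  hole  (inj₁ t) = X (⁺ t)
  hole  (inj₂ t) = Y (⁺ t)
  left  (inj₁ t) = Y (⁺ t)
  left  (inj₂ t) = X (⁺ t +ᶻ c)
  right (inj₁ t) = X (⁺ t +ᶻ ⁺ 1)
  right (inj₂ t) = Y (⁺ t +ᶻ c)

  -- near X_t = Y_t, Y_{t+1}, X_{t-1}, Y_{t+2}, X_{t-2}, … ; near Y_t runs through X_{t+z} for z along the zigzag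
  -- backwards to 0 and then through Y_{t+z} for z along the zigzag forwards from 1.
  Y↑ X↓ Xz Yz : ℤ → ℕ → Fin (h + h)
  Y↑ t k = Y (t +ᶻ ⁺ suc k)
  X↓ t k = X (t - ⁺ suc k)
  Xz t k = X (t +ᶻ zigzag (suc h″ ∸ k))
  Yz t k = Y (t +ᶻ zigzag (suc k))

  nearMid : ℕ ⊎ ℕ → List (Fin (h + h))
  nearMid (inj₁ t) = weave (Y↑ (⁺ t)) (X↓ (⁺ t)) h″ ++ Y↑ (⁺ t) h″ ∷ []
  nearMid (inj₂ t) = applyUpTo (λ k → Xz (⁺ t) (suc k)) (suc h″) ++ applyUpTo (Yz (⁺ t)) h″

  round : List (Fin (h + h))
  round = weave (λ i → X (⁺ i)) (λ i → Y (⁺ i)) h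

  near : ℕ ⊎ ℕ → List (Fin (h + h))
  near i = left i ∷ nearMid i ++ right i ∷ []

  X↓-last : ∀ t → X↓ t h″ ≡ X (t +ᶻ ⁺ 1)
  X↓-last t = trans (sym (X-periodic (t - ⁺ suc h″))) (cong X (lem t (⁺ h″)))
    where
    lem : ∀ (t n : ℤ) → t - (⁺ 1 +ᶻ n) +ᶻ (⁺ 2 +ᶻ n) ≡ t +ᶻ ⁺ 1
    lem = solve-∀

  near-length : ∀ i → suc (length (near i)) ≡ h + h
  near-length (inj₁ t) = trans (cong (2 +_) (trans (length-++ (weave (Y↑ (⁺ t)) (X↓ (⁺ t)) h″ ++ Y↑ (⁺ t) h″ ∷ []))
      (cong (_+ 1) (trans (length-++ (weave (Y↑ (⁺ t)) (X↓ (⁺ t)) h″)) (cong (_+ 1) (length-weave (Y↑ (⁺ t)) (X↓ (⁺ t)) h″)))))) (lem h″)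
    where
    lem : ∀ n → 2 + (n + n + 1 + 1) ≡ 2 + n + (2 + n)
    lem = ℕ-solve
  near-length (inj₂ t) = trans (cong (2 +_) (trans (length-++ (applyUpTo (λ k → Xz (⁺ t) (suc k)) (suc h″) ++ applyUpTo (Yz (⁺ t)) h″))
      (cong (_+ 1) (trans (length-++ (applyUpTo (λ k → Xz (⁺ t) (suc k)) (suc h″))) (cong₂ _+_ (length-applyUpTo (λ k → Xz (⁺ t) (suc k)) (suc h″)) (length-applyUpTo (Yz (⁺ t)) h″)))))) (lem h″)
    where
    lem : ∀ n → 2 + (1 + n + n + 1) ≡ 2 + n + (2 + n)
    lem = ℕ-solve

  ∑-down : ∀ (f : ℤ → ℕ) → Periodic h f → ∀ t → ∑ h (λ k → f (t - ⁺ k)) ≡ ∑ℤ h f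
  ∑-down f p t = ∑ℤ-reflect h f p t

  near-cover : ∀ i f → sumOver f (near i) + f (hole i) ≡ ∑F f
  near-cover (inj₁ n) f = begin
    f (Y t) + sumOver f ((W ++ Y↑ t h″ ∷ []) ++ X (t +ᶻ ⁺ 1) ∷ []) + f (X t)
      ≡⟨ cong (λ k → f (Y t) + k + f (X t)) (trans (sumOver-++ f (W ++ Y↑ t h″ ∷ []) _) (cong₂ _+_ (trans (sumOver-++ f W _) (cong (_+ (f (Y↑ t h″) + 0)) (sumOver-weave f (Y↑ t) (X↓ t) h″)))
           (cong (λ v → f v + 0) (sym (X↓-last t))))) ⟩
    f (Y t) + (∑ h″ (f ∘ Y↑ t) + ∑ h″ (f ∘ X↓ t) + (f (Y↑ t h″) + 0) + (f (X↓ t h″) + 0)) + f (X t)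
      ≡⟨ lem (f (Y t)) (∑ h″ (f ∘ Y↑ t)) (∑ h″ (f ∘ X↓ t)) (f (Y↑ t h″)) (f (X↓ t h″)) (f (X t)) ⟩
    f (X t) + (∑ h″ (f ∘ X↓ t) + f (X↓ t h″)) + (f (Y t) + (∑ h″ (f ∘ Y↑ t) + f (Y↑ t h″)))
      ≡⟨ cong₂ (λ p q → f (X t) + p + (f (Y t) + q)) (sym (∑-snoc h″ (f ∘ X↓ t))) (sym (∑-snoc h″ (f ∘ Y↑ t))) ⟩
    f (X t) + ∑ (suc h″) (f ∘ X↓ t) + (f (Y t) + ∑ (suc h″) (f ∘ Y↑ t))
      ≡⟨ cong₂ (λ p q → f (X p) + ∑ (suc h″) (f ∘ X↓ t) + (f (Y q) + ∑ (suc h″) (f ∘ Y↑ t))) (sym (ℤₚ.+-identityʳ t)) (sym (ℤₚ.+-identityʳ t)) ⟩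
    ∑ h (λ k → f (X (t - ⁺ k))) + ∑ h (λ k → f (Y (t +ᶻ ⁺ k)))
      ≡⟨ cong₂ _+_ (∑-down (f ∘ X) (λ z → cong f (X-periodic z)) t)
           (trans (∑-cong h (λ k → cong (f ∘ Y) (ℤₚ.+-comm t (⁺ k)))) (∑ℤ-shift h (f ∘ Y) (λ z → cong f (Y-periodic z)) t)) ⟩
    ∑ℤ h (f ∘ X) + ∑ℤ h (f ∘ Y)
      ≡⟨ ∑F-XY f ⟨
    ∑F f ∎
    where
    t : ℤ
    t = ⁺ n
    W : List (Fin (h + h))
    W = weave (Y↑ t) (X↓ t) h″
    lem : ∀ y ys xs y' x' x → y + (ys + xs + (y' + 0) + (x' + 0)) + x ≡ x + (xs + x') + (y + (ys + y'))
    lem = ℕ-solve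
  near-cover (inj₂ n) f = begin
    f (X (t +ᶻ c)) + sumOver f ((Xs ++ Ys) ++ Y (t +ᶻ c) ∷ []) + f (Y t)
      ≡⟨ cong (λ k → f (X (t +ᶻ c)) + k + f (Y t)) (trans (sumOver-++ f (Xs ++ Ys) _) (cong (_+ (f (Y (t +ᶻ c)) + 0))
           (trans (sumOver-++ f Xs Ys) (cong₂ _+_ (sumOver-applyUpTo f (λ k → Xz t (suc k)) (suc h″)) (sumOver-applyUpTo f (Yz t) h″))))) ⟩
    f (X (t +ᶻ c)) + (∑ (suc h″) (λ k → f (Xz t (suc k))) + ∑ h″ (f ∘ Yz t) + (f (Y (t +ᶻ c)) + 0)) + f (Y t)
      ≡⟨ lem (f (X (t +ᶻ c))) (∑ (suc h″) (λ k → f (Xz t (suc k)))) (∑ h″ (f ∘ Yz t)) (f (Y (t +ᶻ c))) (f (Y t)) ⟩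
    ∑ h (f ∘ Xz t) + (f (Y t) + (∑ h″ (f ∘ Yz t) + f (Y (t +ᶻ c))))
      ≡⟨ cong₂ _+_ (∑-reverse h (λ k → f (X (t +ᶻ zigzag k)))) (cong₂ (λ p q → f (Y p) + q) (sym (ℤₚ.+-identityʳ t)) (sym (∑-snoc h″ (f ∘ Yz t)))) ⟩
    ∑ h (λ k → f (X (t +ᶻ zigzag k))) + ∑ h (λ k → f (Y (t +ᶻ zigzag k)))
      ≡⟨ cong₂ _+_ (∑-t (f ∘ X) (λ z → cong f (X-periodic z))) (∑-t (f ∘ Y) (λ z → cong f (Y-periodic z))) ⟩
    ∑ℤ h (f ∘ X) + ∑ℤ h (f ∘ Y)
      ≡⟨ ∑F-XY f ⟨
    ∑F f ∎
    where
    t : ℤ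
    t = ⁺ n
    Xs Ys : List (Fin (h + h))
    Xs = applyUpTo (λ k → Xz t (suc k)) (suc h″)
    Ys = applyUpTo (Yz t) h″
    lem : ∀ x xs ys y' y → x + (xs + ys + (y' + 0)) + y ≡ x + xs + (y + (ys + y'))
    lem = ℕ-solve
    ∑-t : ∀ (g : ℤ → ℕ) → Periodic h g → ∑ h (λ k → g (t +ᶻ zigzag k)) ≡ ∑ℤ h g
    ∑-t g p = trans (∑-cong h (λ k → cong g (ℤₚ.+-comm t (zigzag k)))) (trans (∑-zigzag (suc h″) (λ z → g (z +ᶻ t)) (Periodic-shift h g t p)) (∑ℤ-shift h g p t))

  round-cover : ∀ f → sumOver f round ≡ ∑F f
  round-cover f = trans (sumOver-weave f (λ i → X (⁺ i)) (λ i → Y (⁺ i)) h) (sym (∑F-XY f))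

  ∑-holes : ∀ f → sumOver (f ∘ hole) indices ≡ ∑F f
  ∑-holes f = trans (sumOver-indices (f ∘ hole)) (sym (∑F-XY f))

  ∑-ends : ∀ f → sumOver (λ i → f (left i) + f (right i)) indices ≡ ∑F f + ∑F f
  ∑-ends f = begin
    sumOver (λ i → f (left i) + f (right i)) indices
      ≡⟨ sumOver-indices (λ i → f (left i) + f (right i)) ⟩
    ∑ h (λ t → f (Y (⁺ t)) + f (X (⁺ t +ᶻ ⁺ 1))) + ∑ h (λ t → f (X (⁺ t +ᶻ c)) + f (Y (⁺ t +ᶻ c)))
      ≡⟨ cong₂ _+_ (∑-+ h (λ t → f (Y (⁺ t))) (λ t → f (X (⁺ t +ᶻ ⁺ 1)))) (∑-+ h (λ t → f (X (⁺ t +ᶻ c))) (λ t → f (Y (⁺ t +ᶻ c)))) ⟩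
    ∑ℤ h (f ∘ Y) + ∑ℤ h (λ z → f (X (z +ᶻ ⁺ 1))) + (∑ℤ h (λ z → f (X (z +ᶻ c))) + ∑ℤ h (λ z → f (Y (z +ᶻ c))))
      ≡⟨ cong₂ _+_ (cong (∑ℤ h (f ∘ Y) +_) (shiftX (⁺ 1))) (cong₂ _+_ (shiftX c) (∑ℤ-shift h (f ∘ Y) (λ z → cong f (Y-periodic z)) c)) ⟩
    ∑ℤ h (f ∘ Y) + ∑ℤ h (f ∘ X) + (∑ℤ h (f ∘ X) + ∑ℤ h (f ∘ Y))
      ≡⟨ cong₂ _+_ (trans (ℕₚ.+-comm (∑ℤ h (f ∘ Y)) (∑ℤ h (f ∘ X))) (sym (∑F-XY f))) (sym (∑F-XY f)) ⟩
    ∑F f + ∑F f ∎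
    where
    shiftX : ∀ k → ∑ℤ h (λ z → f (X (z +ᶻ k))) ≡ ∑ℤ h (f ∘ X)
    shiftX k = ∑ℤ-shift h (f ∘ X) (λ z → cong f (X-periodic z)) k

  module _ (G : Fin (h + h) → Fin (h + h) → ℕ) (G-sym : Symmetric G) where

    private
      module α = Circulant h (λ x y → G (X x) (X y)) (λ y x → cong (λ v → G v (X y)) (X-periodic x)) (λ x y → cong (G (X x)) (X-periodic y))
      module β = Circulant h (λ x y → G (Y x) (Y y)) (λ y x → cong (λ v → G v (Y y)) (Y-periodic x)) (λ x y → cong (G (Y x)) (Y-periodic y))
      module κ = Circulant h (λ x y → G (X x) (Y y)) (λ y x → cong (λ v → G v (Y y)) (X-periodic x)) (λ x y → cong (G (X x)) (Y-periodic y))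

    chain-X : ∀ n → chain G (left (inj₁ n) ∷ nearMid (inj₁ n)) (right (inj₁ n)) ≡
      G (Y (⁺ n)) (Y (⁺ n +ᶻ ⁺ 1)) + ∑ h″ (λ k → G (X (⁺ n - ⁺ suc k)) (Y (⁺ n +ᶻ ⁺ suc k)) + G (X (⁺ n - ⁺ suc k)) (Y (⁺ n +ᶻ ⁺ suc (suc k))))
        + G (X (⁺ n - ⁺ suc h″)) (Y (⁺ n +ᶻ ⁺ suc h″))
    chain-X n = trans (chain-++ G (Y t ∷ weave (Y↑ t) (X↓ t) h″) (Y↑ t h″) [] (X (t +ᶻ ⁺ 1))) (cong₂ _+_
      (trans (chain-cons-weave G (Y t) (Y↑ t) (X↓ t) h″) (cong (G (Y t) (Y↑ t 0) +_) (∑-cong h″ (λ k → cong (_+ G (X↓ t k) (Y↑ t (suc k))) (G-sym (Y↑ t k) (X↓ t k))))))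
      (trans (G-sym (Y↑ t h″) (X (t +ᶻ ⁺ 1))) (cong (λ v → G v (Y↑ t h″)) (sym (X↓-last t)))))
      where
      t : ℤ
      t = ⁺ n

    chain-Y : ∀ n → chain G (left (inj₂ n) ∷ nearMid (inj₂ n)) (right (inj₂ n)) ≡
      ∑ (suc h″) (λ k → G (X (⁺ n +ᶻ zigzag k)) (X (⁺ n +ᶻ zigzag (suc k)))) + G (X (⁺ n +ᶻ ⁺ 0)) (Y (⁺ n +ᶻ ⁺ 1))
        + ∑ h″ (λ k → G (Y (⁺ n +ᶻ zigzag (suc k))) (Y (⁺ n +ᶻ zigzag (suc (suc k)))))
    chain-Y n = trans (chain-++-applyUpTo G (applyUpTo (Xz t) h) (Yz t) h″) (cong (_+ ∑ h″ (λ k → G (Yz t k) (Yz t (suc k))))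
      (trans (chain-applyUpTo-last G (Xz t) (suc h″) (Yz t 0)) (cong₂ _+_
        (trans (∑-cong-< (suc h″) (λ k k<h → trans (cong (λ j → G (X (t +ᶻ zigzag j)) (Xz t (suc k))) (ℕₚ.+-∸-assoc 1 (ℕₚ.≤-pred k<h))) (G-sym _ _)))
               (∑-reverse (suc h″) (λ j → G (X (t +ᶻ zigzag j)) (X (t +ᶻ zigzag (suc j))))))
        (cong (λ j → G (X (t +ᶻ zigzag j)) (Yz t 0)) (ℕₚ.n∸n≡0 (suc h″))))))
      where
      t : ℤ
      t = ⁺ n

    -- The weave moves its two indices apart alternately, so the XY-edges have the integer
    -- differences 2, 3, ..., 2h-2. The initial edge supplies the YY-difference 1.
    sum-X : ∑ h (λ n → chain G (left (inj₁ n) ∷ nearMid (inj₁ n)) (right (inj₁ n))) ≡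
      β.Ψ (⁺ 1) + ∑ h″ (λ k → κ.Ψ (⁺ (suc k + suc k)) + κ.Ψ (⁺ suc (suc k + suc k))) + κ.Ψ (⁺ (suc h″ + suc h″))
    sum-X = begin
      ∑ h (λ n → chain G (left (inj₁ n) ∷ nearMid (inj₁ n)) (right (inj₁ n)))
        ≡⟨ ∑-cong h chain-X ⟩
      ∑ h (λ n → D₁ n + ∑ h″ (λ k → D₂ n k + D₃ n k) + D₂ n h″)
        ≡⟨ trans (∑-+ h (λ n → D₁ n + ∑ h″ (λ k → D₂ n k + D₃ n k)) (λ n → D₂ n h″)) (cong (_+ ∑ h (λ n → D₂ n h″)) (∑-+ h D₁ (λ n → ∑ h″ (λ k → D₂ n k + D₃ n k)))) ⟩
      ∑ h D₁ + ∑ h (λ n → ∑ h″ (λ k → D₂ n k + D₃ n k)) + ∑ h (λ n → D₂ n h″)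
        ≡⟨ cong₂ _+_ (cong (∑ h D₁ +_) (trans (∑-swap h h″ (λ n k → D₂ n k + D₃ n k)) (∑-cong h″ (λ k → trans (∑-+ h (λ n → D₂ n k) (λ n → D₃ n k)) (cong₂ _+_ (∑D₂ k) (∑D₃ k)))))) (∑D₂ h″) ⟩
      _ ∎
      where
      D₁ : ℕ → ℕ
      D₁ n = G (Y (⁺ n)) (Y (⁺ n +ᶻ ⁺ 1))
      D₂ D₃ : ℕ → ℕ → ℕ
      D₂ n k = G (X (⁺ n - ⁺ suc k)) (Y (⁺ n +ᶻ ⁺ suc k))
      D₃ n k = G (X (⁺ n - ⁺ suc k)) (Y (⁺ n +ᶻ ⁺ suc (suc k)))
      lem₁ : ∀ (k : ℤ) → ⁺ 1 +ᶻ k - - (⁺ 1 +ᶻ k) ≡ (⁺ 1 +ᶻ k) +ᶻ (⁺ 1 +ᶻ k)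
      lem₁ = solve-∀
      lem₂ : ∀ (k : ℤ) → ⁺ 2 +ᶻ k - - (⁺ 1 +ᶻ k) ≡ ⁺ 1 +ᶻ ((⁺ 1 +ᶻ k) +ᶻ (⁺ 1 +ᶻ k))
      lem₂ = solve-∀
      ∑D₂ : ∀ k → ∑ h (λ n → D₂ n k) ≡ κ.Ψ (⁺ (suc k + suc k))
      ∑D₂ k = trans (κ.Ψ-shift (- ⁺ suc k) (⁺ suc k)) (cong κ.Ψ (lem₁ (⁺ k)))
      ∑D₃ : ∀ k → ∑ h (λ n → D₃ n k) ≡ κ.Ψ (⁺ suc (suc k + suc k))
      ∑D₃ k = trans (κ.Ψ-shift (- ⁺ suc k) (⁺ suc (suc k))) (cong κ.Ψ (lem₂ (⁺ k)))

    -- The zigzag on X supplies the differences 1, ..., h-1. The one on Y starts at its second term,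
    -- since Y_t is the hole, and lacks the difference 1. The connecting edge supplies the
    -- XY-difference 1.
    sum-Y : ∑ h (λ n → chain G (left (inj₂ n) ∷ nearMid (inj₂ n)) (right (inj₂ n))) ≡
      ∑ (suc h″) (λ k → α.Ψ (⁺ suc k)) + κ.Ψ (⁺ 1) + ∑ h″ (λ k → β.Ψ (⁺ suc (suc k)))
    sum-Y = begin
      ∑ h (λ n → chain G (left (inj₂ n) ∷ nearMid (inj₂ n)) (right (inj₂ n)))
        ≡⟨ ∑-cong h chain-Y ⟩
      ∑ h (λ n → ∑ (suc h″) (D₁ n) + D₂ n + ∑ h″ (D₃ n))
        ≡⟨ trans (∑-+ h (λ n → ∑ (suc h″) (D₁ n) + D₂ n) (λ n → ∑ h″ (D₃ n))) (cong (_+ ∑ h (λ n → ∑ h″ (D₃ n))) (∑-+ h (λ n → ∑ (suc h″) (D₁ n)) D₂)) ⟩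
      ∑ h (λ n → ∑ (suc h″) (D₁ n)) + ∑ h D₂ + ∑ h (λ n → ∑ h″ (D₃ n))
        ≡⟨ cong₂ _+_ (cong₂ _+_ (trans (∑-swap h (suc h″) D₁) (∑-cong (suc h″) ∑D₁)) ∑D₂) (trans (∑-swap h h″ D₃) (∑-cong h″ ∑D₃)) ⟩
      _ ∎
      where
      D₁ D₃ : ℕ → ℕ → ℕ
      D₁ n k = G (X (⁺ n +ᶻ zigzag k)) (X (⁺ n +ᶻ zigzag (suc k)))
      D₃ n k = G (Y (⁺ n +ᶻ zigzag (suc k))) (Y (⁺ n +ᶻ zigzag (suc (suc k))))
      D₂ : ℕ → ℕ
      D₂ n = G (X (⁺ n +ᶻ ⁺ 0)) (Y (⁺ n +ᶻ ⁺ 1))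
      lem : ∀ (z d : ℤ) → z +ᶻ d - z ≡ d
      lem = solve-∀
      ∑D₁ : ∀ k → ∑ h (λ n → D₁ n k) ≡ α.Ψ (⁺ suc k)
      ∑D₁ k = trans (α.Ψ-shift (zigzag k) (zigzag (suc k))) (trans (cong α.Ψ (lem (zigzag k) (sign k *ᶻ ⁺ suc k)))
        (sign-even-function α.Ψ (α.Ψ-neg (λ x y → G-sym (X x) (X y))) k (⁺ suc k)))
      ∑D₂ : ∑ h D₂ ≡ κ.Ψ (⁺ 1)
      ∑D₂ = κ.Ψ-shift (⁺ 0) (⁺ 1)
      ∑D₃ : ∀ k → ∑ h (λ n → D₃ n k) ≡ β.Ψ (⁺ suc (suc k))
      ∑D₃ k = trans (β.Ψ-shift (zigzag (suc k)) (zigzag (suc (suc k)))) (trans (cong β.Ψ (lem (zigzag (suc k)) (sign (suc k) *ᶻ ⁺ suc (suc k))))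
        (sign-even-function β.Ψ (β.Ψ-neg (λ x y → G-sym (Y x) (Y y))) (suc k) (⁺ suc (suc k))))

    sum-round : cycleSum G round ≡ κ.Ψ (⁺ 0) + κ.Ψ (⁺ suc (suc h″ + suc h″))
    sum-round = begin
      cycleSum G round
        ≡⟨ cycleSum-weave G (λ i → X (⁺ i)) (λ i → Y (⁺ i)) h (X-periodic (⁺ 0)) ⟩
      ∑ h (λ i → G (X (⁺ i)) (Y (⁺ i)) + G (Y (⁺ i)) (X (⁺ suc i)))
        ≡⟨ ∑-+ h (λ i → G (X (⁺ i)) (Y (⁺ i))) (λ i → G (Y (⁺ i)) (X (⁺ suc i))) ⟩
      ∑ h (λ i → G (X (⁺ i)) (Y (⁺ i))) + ∑ h (λ i → G (Y (⁺ i)) (X (⁺ suc i)))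
        ≡⟨ cong₂ _+_ (∑-cong h (λ i → cong (G (X (⁺ i)) ∘ Y) (sym (ℤₚ.+-identityʳ (⁺ i)))))
             (∑-cong h (λ i → trans (G-sym (Y (⁺ i)) (X (⁺ suc i))) (cong₂ (λ p q → G (X p) (Y q)) (ℤₚ.+-comm (⁺ 1) (⁺ i)) (sym (ℤₚ.+-identityʳ (⁺ i)))))) ⟩
      κ.Ψ (⁺ 0) + ∑ℤ h (λ z → G (X (z +ᶻ ⁺ 1)) (Y (z +ᶻ ⁺ 0)))
        -- The difference -1 is written as 2h-1, the integer missing from the list 0, ..., 2h-2.
        ≡⟨ cong (κ.Ψ (⁺ 0) +_) (trans (κ.Ψ-shift (⁺ 1) (⁺ 0)) (trans (sym (κ.Ψ-periodic (⁺ 0 - ⁺ 1))) (trans (sym (κ.Ψ-periodic (⁺ 0 - ⁺ 1 +ᶻ ⁺ h))) (cong κ.Ψ (lem (⁺ h″)))))) ⟩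
      κ.Ψ (⁺ 0) + κ.Ψ (⁺ suc (suc h″ + suc h″)) ∎
      where
      lem : ∀ (n : ℤ) → ⁺ 0 - ⁺ 1 +ᶻ (⁺ 2 +ᶻ n) +ᶻ (⁺ 2 +ᶻ n) ≡ ⁺ 1 +ᶻ ((⁺ 1 +ᶻ n) +ᶻ (⁺ 1 +ᶻ n))
      lem = solve-∀

    -- The XY-differences of all three sources are the integers 0, ..., 2h-1, so each residue modulo
    -- h occurs twice.
    ∑κ : κ.Ψ (⁺ 0) + κ.Ψ (⁺ 1) + (∑ h″ (λ k → κ.Ψ (⁺ (suc k + suc k)) + κ.Ψ (⁺ suc (suc k + suc k)))
           + (κ.Ψ (⁺ (suc h″ + suc h″)) + κ.Ψ (⁺ suc (suc h″ + suc h″)))) ≡ ∑ℤ h κ.Ψ + ∑ℤ h κ.Ψ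
    ∑κ = begin
      _ ≡⟨ cong (κ.Ψ (⁺ 0) + κ.Ψ (⁺ 1) +_) (sym (∑-snoc h″ (λ k → κ.Ψ (⁺ (suc k + suc k)) + κ.Ψ (⁺ suc (suc k + suc k))))) ⟩
      ∑ h (λ k → κ.Ψ (⁺ (k + k)) + κ.Ψ (⁺ suc (k + k)))   ≡⟨ ∑-double h (λ k → κ.Ψ (⁺ k)) ⟨
      ∑ (h + h) (λ k → κ.Ψ (⁺ k))                         ≡⟨ ∑-split h h (λ k → κ.Ψ (⁺ k)) ⟩
      ∑ℤ h κ.Ψ + ∑ h (λ k → κ.Ψ (⁺ (h + k)))              ≡⟨ cong (∑ℤ h κ.Ψ +_) (∑-cong h (λ k → trans (cong κ.Ψ (ℤₚ.+-comm (⁺ h) (⁺ k))) (κ.Ψ-periodic (⁺ k)))) ⟩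
      ∑ℤ h κ.Ψ + ∑ℤ h κ.Ψ                                 ∎

    -- Inside X or inside Y, the differences d and -d give the same edges, so one full set of
    -- differences covers each edge twice; between X and Y two full sets are needed.
    near-edges : sumOver (λ i → chain G (left i ∷ nearMid i) (right i)) indices + cycleSum G round + ∑F (λ v → G v v) ≡ ∑F (λ v → ∑F (G v))
    near-edges = begin
      sumOver (λ i → chain G (left i ∷ nearMid i) (right i)) indices + cycleSum G round + ∑F (λ v → G v v)
        ≡⟨ cong₂ _+_ (cong₂ _+_ (trans (sumOver-indices (λ i → chain G (left i ∷ nearMid i) (right i))) (cong₂ _+_ sum-X sum-Y)) sum-round)
             (trans (∑F-XY (λ v → G v v)) (cong₂ _+_ (∑ℤ-cong h (λ z → cong (G (X z) ∘ X) (sym (ℤₚ.+-identityʳ z)))) (∑ℤ-cong h (λ z → cong (G (Y z) ∘ Y) (sym (ℤₚ.+-identityʳ z)))))) ⟩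
      β.Ψ (⁺ 1) + κs + κe + (αs + κ.Ψ (⁺ 1) + βs) + (κ.Ψ (⁺ 0) + κo) + (α.Ψ (⁺ 0) + β.Ψ (⁺ 0))
        ≡⟨ lem (β.Ψ (⁺ 1)) κs κe αs (κ.Ψ (⁺ 1)) βs (κ.Ψ (⁺ 0)) κo (α.Ψ (⁺ 0)) (β.Ψ (⁺ 0)) ⟩
      (α.Ψ (⁺ 0) + αs) + (κ.Ψ (⁺ 0) + κ.Ψ (⁺ 1) + (κs + (κe + κo))) + (β.Ψ (⁺ 0) + (β.Ψ (⁺ 1) + βs))
        ≡⟨ cong₂ _+_ (cong₂ _+_ α.∑ℤ-Ψ (trans ∑κ (cong₂ _+_ κ.∑ℤ-Ψ κ.∑ℤ-Ψ))) β.∑ℤ-Ψ ⟩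
      XX + (XY + XY) + YY
        ≡⟨ lem' XX XY YY ⟩
      (XX + XY) + (XY + YY)
        ≡⟨ cong₂ _+_ (sym (∑-+ h (λ x → ∑ℤ h (λ y → G (X (⁺ x)) (X y))) (λ x → ∑ℤ h (λ y → G (X (⁺ x)) (Y y)))))
             (trans (cong (_+ YY) (trans (∑-swap h h (λ x y → G (X (⁺ x)) (Y (⁺ y)))) (∑-cong h (λ y → ∑-cong h (λ x → G-sym (X (⁺ x)) (Y (⁺ y)))))))
                    (sym (∑-+ h (λ x → ∑ℤ h (λ y → G (Y (⁺ x)) (X y))) (λ x → ∑ℤ h (λ y → G (Y (⁺ x)) (Y y)))))) ⟩
      ∑ℤ h (λ x → ∑ℤ h (λ y → G (X x) (X y)) + ∑ℤ h (λ y → G (X x) (Y y))) + ∑ℤ h (λ x → ∑ℤ h (λ y → G (Y x) (X y)) + ∑ℤ h (λ y → G (Y x) (Y y)))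
        ≡⟨ cong₂ _+_ (∑ℤ-cong h (λ x → sym (∑F-XY (G (X x))))) (∑ℤ-cong h (λ x → sym (∑F-XY (G (Y x))))) ⟩
      ∑ℤ h (λ x → ∑F (G (X x))) + ∑ℤ h (λ x → ∑F (G (Y x)))
        ≡⟨ ∑F-XY (λ v → ∑F (G v)) ⟨
      ∑F (λ v → ∑F (G v)) ∎
      where
      κs κe κo αs βs XX XY YY : ℕ
      κs = ∑ h″ (λ k → κ.Ψ (⁺ (suc k + suc k)) + κ.Ψ (⁺ suc (suc k + suc k)))
      κe = κ.Ψ (⁺ (suc h″ + suc h″))
      κo = κ.Ψ (⁺ suc (suc h″ + suc h″))
      αs = ∑ (suc h″) (λ k → α.Ψ (⁺ suc k))
      βs = ∑ h″ (λ k → β.Ψ (⁺ suc (suc k)))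
      XX = ∑ℤ h (λ x → ∑ℤ h (λ y → G (X x) (X y)))
      XY = ∑ℤ h (λ x → ∑ℤ h (λ y → G (X x) (Y y)))
      YY = ∑ℤ h (λ x → ∑ℤ h (λ y → G (Y x) (Y y)))
      lem : ∀ b₁ ks ke as k₁ bs k₀ ko a₀ b₀ → b₁ + ks + ke + (as + k₁ + bs) + (k₀ + ko) + (a₀ + b₀)
        ≡ (a₀ + as) + (k₀ + k₁ + (ks + (ke + ko))) + (b₀ + (b₁ + bs))
      lem = ℕ-solve
      lem' : ∀ x y z → x + (y + y) + z ≡ (x + y) + (y + z)
      lem' = ℕ-solve

-- Factorizing K_{2h,2h}(2) by bands

∑-rotate : ∀ n (f : ℕ → ℕ) → f n ≡ f 0 → ∑ n (f ∘ suc) ≡ ∑ n f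
∑-rotate n f e = ℕₚ.+-cancelˡ-≡ (f 0) (∑ n (f ∘ suc)) (∑ n f) (trans (∑-snoc n f) (trans (cong (∑ n f +_) e) (ℕₚ.+-comm (∑ n f) (f 0))))

weave-snoc : (f g : ℕ → A) → ∀ n → weave f g (suc n) ≡ (weave f g n ++ f n ∷ []) ++ g n ∷ []
weave-snoc f g zero    = refl
weave-snoc f g (suc n) = cong (λ l → f 0 ∷ g 0 ∷ l) (weave-snoc (f ∘ suc) (g ∘ suc) n)

Periodic-multiple : ∀ n (f : ℤ → ℕ) → Periodic n f → ∀ q z → f (z - ⁺ (q * n)) ≡ f z
Periodic-multiple n f p zero    z = cong f (ℤₚ.+-identityʳ z)
Periodic-multiple n f p (suc q) z = trans (sym (p _)) (trans (cong f (lem z (⁺ n) (⁺ (q * n)))) (Periodic-multiple n f p q z))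
  where
  lem : ∀ (z n m : ℤ) → z - (n +ᶻ m) +ᶻ n ≡ z - m
  lem = solve-∀

Periodic-% : ∀ n .{{_ : NonZero n}} (f : ℤ → ℕ) → Periodic n f → ∀ z k → f (z - ⁺ (k % n)) ≡ f (z - ⁺ k)
Periodic-% n f p z k = sym (trans (cong f (trans (cong (λ j → z - ⁺ j) (m≡m%n+[m/n]*n k n)) (lem z (⁺ (k % n)) (⁺ (k / n * n)))))
    (Periodic-multiple n f p (k / n) (z - ⁺ (k % n))))
  where
  lem : ∀ (z r m : ℤ) → z - (r +ᶻ m) ≡ z - r - m
  lem = solve-∀

module Bands (h″ : ℕ) where
  open Near h″

  V² : Set
  V² = Fin (h + h) ⊎ Fin (h + h)

  ∑F-Q : ∀ f → ∑F f ≡ ∑ℤ h (λ b → f (Q b) + f (Q (b +ᶻ ⁺ h)))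
  ∑F-Q f = trans (∑F-ι (h + h) f) (trans (∑-split h h (λ b → f (Q (⁺ b)))) (trans
    (cong (∑ h (λ b → f (Q (⁺ b))) +_) (∑-cong h (λ b → cong (f ∘ Q) (ℤₚ.+-comm (⁺ h) (⁺ b)))))
    (sym (∑-+ h (λ b → f (Q (⁺ b))) (λ b → f (Q (⁺ b +ᶻ ⁺ h)))))))

  fold-periodic : ∀ (f : Fin (h + h) → ℕ) → Periodic h (λ b → f (Q b) + f (Q (b +ᶻ ⁺ h)))
  fold-periodic f b = trans (ℕₚ.+-comm (f (Q (b +ᶻ ⁺ h))) _) (cong (_+ f (Q (b +ᶻ ⁺ h)))
    (cong f (trans (cong Q (ℤₚ.+-assoc b (⁺ h) (⁺ h))) (Q-periodic b))))

  -- The k-th Q-vertex of the band with parameter t: one of the two residues mod 2h above 2t - (k+1) mod h.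
  band : ℤ → ℤ → ℕ → Fin (h + h)
  band l t k = Q ((t +ᶻ t) - ⁺ (suc k % h) +ᶻ l)

  band-periodic : ∀ l k → Periodic h (λ t → band l t k)
  band-periodic l k t = trans (cong Q (lem t (⁺ h) (⁺ (suc k % h)) l)) (Q-periodic ((t +ᶻ t) - ⁺ (suc k % h) +ᶻ l))
    where
    lem : ∀ (t h r l : ℤ) → (t +ᶻ h) +ᶻ (t +ᶻ h) - r +ᶻ l ≡ (t +ᶻ t) - r +ᶻ l +ᶻ (h +ᶻ h)
    lem = solve-∀

  band-wrap : ∀ l t → band l t h ≡ band l t 0
  band-wrap l t = cong (λ r → Q ((t +ᶻ t) - ⁺ r +ᶻ l)) ([m+n]%n≡m%n 1 h)

  -- A band and its translate by h pick both residues over the same class modulo h, so the sum is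
  -- blind to the reduction of `suc k`.
  two-bands : ∀ (f : Fin (h + h) → ℕ) t k →
    f (band (⁺ 0) t k) + f (band (⁺ h) t k) ≡ f (Q ((t +ᶻ t) - ⁺ suc k)) + f (Q ((t +ᶻ t) - ⁺ suc k +ᶻ ⁺ h))
  two-bands f t k = trans (cong (λ z → f (Q z) + f (band (⁺ h) t k)) (ℤₚ.+-identityʳ ((t +ᶻ t) - ⁺ (suc k % h))))
    (Periodic-% h (λ b → f (Q b) + f (Q (b +ᶻ ⁺ h))) (fold-periodic f) (t +ᶻ t) (suc k))

  ∑-two-bands : ∀ (f : Fin (h + h) → ℕ) t → ∑ h (λ k → f (band (⁺ 0) t k)) + ∑ h (λ k → f (band (⁺ h) t k)) ≡ ∑F f
  ∑-two-bands f t = begin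
    ∑ h (λ k → f (band (⁺ 0) t k)) + ∑ h (λ k → f (band (⁺ h) t k))      ≡⟨ ∑-+ h (λ k → f (band (⁺ 0) t k)) (λ k → f (band (⁺ h) t k)) ⟨
    ∑ h (λ k → f (band (⁺ 0) t k) + f (band (⁺ h) t k))                  ≡⟨ ∑-cong h (λ k → trans (two-bands f t k) (cong (λ z → f (Q z) + f (Q (z +ᶻ ⁺ h))) (lem t (⁺ k)))) ⟩
    ∑ℤ h (λ z → φ ((t +ᶻ t) - ⁺ 1 - z))                                  ≡⟨ ∑ℤ-reflect h φ (fold-periodic f) ((t +ᶻ t) - ⁺ 1) ⟩
    ∑ℤ h φ                                                               ≡⟨ ∑F-Q f ⟨
    ∑F f                                                                 ∎
    where
    φ : ℤ → ℕ
    φ b = f (Q b) + f (Q (b +ᶻ ⁺ h))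
    lem : ∀ (t k : ℤ) → (t +ᶻ t) - (⁺ 1 +ᶻ k) ≡ (t +ᶻ t) - ⁺ 1 - k
    lem = solve-∀

  module _ (G : V² → V² → ℕ) (G-sym : Symmetric G) (r : ℤ → Fin (h + h)) (r-periodic : Periodic h r) (e : ℤ) where

    bandTerm : ℤ → ℤ → ℕ → ℕ
    bandTerm l t k = G (inj₁ (r (t - e - ⁺ k))) (inj₂ (band l t k)) + G (inj₂ (band l t k)) (inj₁ (r (t - e - ⁺ suc k)))

    bandSum : ℤ → ℤ → ℕ
    bandSum l t = ∑ h (bandTerm l t)

    r-wrap : ∀ t → r (t - ⁺ h) ≡ r t
    r-wrap t = trans (sym (r-periodic _)) (cong r (lem t (⁺ h)))
      where
      lem : ∀ (t h : ℤ) → t - h +ᶻ h ≡ t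
      lem = solve-∀

    r-shift : ∀ k t → r (t +ᶻ ⁺ h - e - k) ≡ r (t - e - k)
    r-shift k t = trans (cong r (lem t (⁺ h) e k)) (r-periodic _)
      where
      lem : ∀ (t h e k : ℤ) → t +ᶻ h - e - k ≡ t - e - k +ᶻ h
      lem = solve-∀

    bandSum-periodic : ∀ l → Periodic h (bandSum l)
    bandSum-periodic l t = ∑-cong h (λ k → cong₂ _+_
      (cong₂ (λ v w → G (inj₁ v) (inj₂ w)) (r-shift (⁺ k) t) (band-periodic l k t))
      (cong₂ (λ v w → G (inj₂ w) (inj₁ v)) (r-shift (⁺ suc k) t) (band-periodic l k t)))

    cycleSum-band : ∀ l t → cycleSum G (weave (λ k → inj₁ (r (t - e - ⁺ k))) (λ k → inj₂ (band l t k)) h) ≡ bandSum l t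
    cycleSum-band l t = cycleSum-weave G (λ k → inj₁ (r (t - e - ⁺ k))) (λ k → inj₂ (band l t k)) h
      (cong inj₁ (trans (r-wrap (t - e)) (cong r (sym (ℤₚ.+-identityʳ _)))))

    -- The same cycle started one step later; a hole Y_i occupies this later position, between the
    -- residues 2t-1 and 2t-2.
    cycleSum-band-rotated : ∀ l t → cycleSum G (weave (λ k → inj₁ (r (t - e - ⁺ suc k))) (λ k → inj₂ (band l t (suc k))) h) ≡ bandSum l t
    cycleSum-band-rotated l t = trans
      (cycleSum-weave G (λ k → inj₁ (r (t - e - ⁺ suc k))) (λ k → inj₂ (band l t (suc k))) h (cong inj₁ (wrap 1)))
      (∑-rotate h (bandTerm l t) (cong₂ _+_
        (cong₂ (λ v w → G (inj₁ v) (inj₂ w)) (wrap 0) (band-wrap l t))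
        (cong₂ (λ v w → G (inj₂ w) (inj₁ v)) (wrap 1) (band-wrap l t))))
      where
      lem : ∀ (x h i : ℤ) → x - (i +ᶻ h) ≡ x - i - h
      lem = solve-∀
      wrap : ∀ i → r (t - e - ⁺ (i + h)) ≡ r (t - e - ⁺ i)
      wrap i = trans (cong r (lem (t - e) (⁺ h) (⁺ i))) (r-wrap (t - e - ⁺ i))

    rowTotal : ℕ
    rowTotal = ∑ℤ h (λ p → ∑F (λ w → G (inj₁ (r p)) (inj₂ w)))

    private
      G' : ℤ → ℤ → ℕ
      G' p b = G (inj₁ (r p)) (inj₂ (Q b)) + G (inj₁ (r p)) (inj₂ (Q (b +ᶻ ⁺ h)))

      G'-periodicʳ : ∀ p → Periodic h (G' p)
      G'-periodicʳ p = fold-periodic (λ w → G (inj₁ (r p)) (inj₂ w))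

      G'-diagonal-periodic : ∀ x → Periodic h (λ p → G' p (p +ᶻ x))
      G'-diagonal-periodic x p = trans (cong (λ v → G (inj₁ v) (inj₂ (Q (p +ᶻ ⁺ h +ᶻ x))) + G (inj₁ v) (inj₂ (Q (p +ᶻ ⁺ h +ᶻ x +ᶻ ⁺ h)))) (r-periodic p))
        (Periodic-shift h (G' p) x (G'-periodicʳ p) p)

      diagonals : ∀ x → ∑ℤ h (λ t → ∑ℤ h (λ p → G' p (p +ᶻ (t +ᶻ x)))) ≡ rowTotal
      diagonals x = trans (∑-swap h h (λ t p → G' (⁺ p) (⁺ p +ᶻ (⁺ t +ᶻ x)))) (∑ℤ-cong h (λ p → begin
        ∑ℤ h (λ t → G' p (p +ᶻ (t +ᶻ x)))   ≡⟨ ∑ℤ-cong h (λ t → cong (G' p) (lem p t x)) ⟩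
        ∑ℤ h (λ t → G' p (t +ᶻ (p +ᶻ x)))   ≡⟨ ∑ℤ-shift h (G' p) (G'-periodicʳ p) (p +ᶻ x) ⟩
        ∑ℤ h (G' p)                         ≡⟨ ∑F-Q (λ w → G (inj₁ (r p)) (inj₂ w)) ⟨
        ∑F (λ w → G (inj₁ (r p)) (inj₂ w))  ∎))
        where
        lem : ∀ (p t x : ℤ) → p +ᶻ (t +ᶻ x) ≡ t +ᶻ (p +ᶻ x)
        lem = solve-∀

    -- Along a cycle the row index t - e - k and the residue 2t - (k+1) fall together, so the
    -- difference between them is constant: t + e - 1 for one edge at each band vertex and t + e for
    -- the other. With both bands only classes modulo h count, and as t varies each of the two kinds
    -- of edge sweeps out every diagonal once.
    bandSums : ∑ℤ h (bandSum (⁺ 0)) + ∑ℤ h (bandSum (⁺ h)) ≡ rowTotal + rowTotal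
    bandSums = begin
      ∑ℤ h (bandSum (⁺ 0)) + ∑ℤ h (bandSum (⁺ h))
        ≡⟨ ∑-+ h (λ t → bandSum (⁺ 0) (⁺ t)) (λ t → bandSum (⁺ h) (⁺ t)) ⟨
      ∑ℤ h (λ t → bandSum (⁺ 0) t + bandSum (⁺ h) t)
        ≡⟨ ∑ℤ-cong h (λ t → trans (sym (∑-+ h (bandTerm (⁺ 0) t) (bandTerm (⁺ h) t))) (∑-cong h (term t))) ⟩
      ∑ℤ h (λ t → ∑ h (λ k → G' (t - e - ⁺ k) ((t +ᶻ t) - ⁺ suc k) + G' (t - e - ⁺ suc k) ((t +ᶻ t) - ⁺ suc k)))
        ≡⟨ ∑ℤ-cong h (λ t → trans (∑-+ h (λ k → G' (t - e - ⁺ k) ((t +ᶻ t) - ⁺ suc k)) (λ k → G' (t - e - ⁺ suc k) ((t +ᶻ t) - ⁺ suc k))) (cong₂ _+_ (first t) (second t))) ⟩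
      ∑ℤ h (λ t → ∑ℤ h (λ p → G' p (p +ᶻ (t +ᶻ (e - ⁺ 1)))) + ∑ℤ h (λ p → G' p (p +ᶻ (t +ᶻ e))))
        ≡⟨ ∑-+ h (λ t → ∑ℤ h (λ p → G' p (p +ᶻ (⁺ t +ᶻ (e - ⁺ 1))))) (λ t → ∑ℤ h (λ p → G' p (p +ᶻ (⁺ t +ᶻ e)))) ⟩
      ∑ℤ h (λ t → ∑ℤ h (λ p → G' p (p +ᶻ (t +ᶻ (e - ⁺ 1))))) + ∑ℤ h (λ t → ∑ℤ h (λ p → G' p (p +ᶻ (t +ᶻ e))))
        ≡⟨ cong₂ _+_ (diagonals (e - ⁺ 1)) (diagonals e) ⟩
      rowTotal + rowTotal ∎
      where
      term : ∀ t k → bandTerm (⁺ 0) t k + bandTerm (⁺ h) t k ≡ G' (t - e - ⁺ k) ((t +ᶻ t) - ⁺ suc k) + G' (t - e - ⁺ suc k) ((t +ᶻ t) - ⁺ suc k)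
      term t k = trans (+-exchange (G (inj₁ v) (inj₂ (band (⁺ 0) t k))) (G (inj₂ (band (⁺ 0) t k)) (inj₁ v')) (G (inj₁ v) (inj₂ (band (⁺ h) t k))) (G (inj₂ (band (⁺ h) t k)) (inj₁ v')))
        (cong₂ _+_ (two-bands (λ w → G (inj₁ v) (inj₂ w)) t k)
          (trans (cong₂ _+_ (G-sym (inj₂ (band (⁺ 0) t k)) (inj₁ v')) (G-sym (inj₂ (band (⁺ h) t k)) (inj₁ v'))) (two-bands (λ w → G (inj₁ v') (inj₂ w)) t k)))
        where
        v v' : Fin (h + h)
        v  = r (t - e - ⁺ k)
        v' = r (t - e - ⁺ suc k)
      lem₁ : ∀ (t e k : ℤ) → (t +ᶻ t) - (⁺ 1 +ᶻ k) ≡ t - e - k +ᶻ (t +ᶻ (e - ⁺ 1))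
      lem₁ = solve-∀
      lem₂ : ∀ (t e k : ℤ) → (t +ᶻ t) - (⁺ 1 +ᶻ k) ≡ t - e - ⁺ 1 - k +ᶻ (t +ᶻ e)
      lem₂ = solve-∀
      lem₃ : ∀ (t e k : ℤ) → t - e - (⁺ 1 +ᶻ k) ≡ t - e - ⁺ 1 - k
      lem₃ = solve-∀
      first : ∀ t → ∑ h (λ k → G' (t - e - ⁺ k) ((t +ᶻ t) - ⁺ suc k)) ≡ ∑ℤ h (λ p → G' p (p +ᶻ (t +ᶻ (e - ⁺ 1))))
      first t = trans (∑-cong h (λ k → cong (G' (t - e - ⁺ k)) (lem₁ t e (⁺ k))))
        (∑ℤ-reflect h (λ p → G' p (p +ᶻ (t +ᶻ (e - ⁺ 1)))) (G'-diagonal-periodic _) (t - e))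
      second : ∀ t → ∑ h (λ k → G' (t - e - ⁺ suc k) ((t +ᶻ t) - ⁺ suc k)) ≡ ∑ℤ h (λ p → G' p (p +ᶻ (t +ᶻ e)))
      second t = trans (∑-cong h (λ k → cong₂ G' (lem₃ t e (⁺ k)) (lem₂ t e (⁺ k))))
        (∑ℤ-reflect h (λ p → G' p (p +ᶻ (t +ᶻ e))) (G'-diagonal-periodic _) (t - e - ⁺ 1))

module LargeSystem (h‴ : ℕ) where
  open Near (suc h‴)
  open Bands (suc h‴)

  -- Each row keeps its offset, e = 1 for X and e = c for Y, as `bandSums` requires. Then t is fixed
  -- by the ends: t = i + 1 puts X_i between 2t-1 and 2t, and t = i + c + 1 with a rotation puts Y_i
  -- between 2t-2 and 2t-1. The complementary cycle has the other row, the other band and the same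
  -- t, so that together they cover both copies.
  crossP crossQ cross₂P cross₂Q : ℕ ⊎ ℕ → ℕ → V²
  crossP  (inj₁ i) k = inj₁ (X (⁺ i +ᶻ ⁺ 1 - ⁺ 1 - ⁺ k))
  crossP  (inj₂ i) k = inj₁ (Y (⁺ i +ᶻ (c +ᶻ ⁺ 1) - c - ⁺ suc k))
  crossQ  (inj₁ i) k = inj₂ (band (⁺ 0) (⁺ i +ᶻ ⁺ 1) k)
  crossQ  (inj₂ i) k = inj₂ (band (⁺ 0) (⁺ i +ᶻ (c +ᶻ ⁺ 1)) (suc k))
  cross₂P (inj₁ i) k = inj₁ (Y (⁺ i +ᶻ ⁺ 1 - c - ⁺ k))
  cross₂P (inj₂ i) k = inj₁ (X (⁺ i +ᶻ (c +ᶻ ⁺ 1) - ⁺ 1 - ⁺ k))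
  cross₂Q (inj₁ i) k = inj₂ (band (⁺ h) (⁺ i +ᶻ ⁺ 1) k)
  cross₂Q (inj₂ i) k = inj₂ (band (⁺ h) (⁺ i +ᶻ (c +ᶻ ⁺ 1)) k)

  crossMid cross cross₂ : ℕ ⊎ ℕ → List V²
  crossMid i = weave (crossP i ∘ suc) (crossQ i ∘ suc) (suc h‴) ++ crossP i (suc (suc h‴)) ∷ []
  cross i    = inj₂ (left i) ∷ crossMid i ++ inj₂ (right i) ∷ []
  cross₂ i   = weave (cross₂P i) (cross₂Q i) h

  start : ∀ i → inj₁ (hole i) ≡ crossP i 0
  start (inj₁ i) = cong (inj₁ ∘ X) (lem (⁺ i))
    where
    lem : ∀ (i : ℤ) → i ≡ i +ᶻ ⁺ 1 - ⁺ 1 - ⁺ 0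
    lem = solve-∀
  start (inj₂ i) = cong (inj₁ ∘ Y) (lem (⁺ i) c)
    where
    lem : ∀ (i c : ℤ) → i ≡ i +ᶻ (c +ᶻ ⁺ 1) - c - ⁺ 1
    lem = solve-∀

  first : ∀ i → inj₂ (left i) ≡ crossQ i 0
  first (inj₁ i) = cong (inj₂ ∘ Q) (lem (⁺ i))
    where
    lem : ∀ (i : ℤ) → ⁺ 1 +ᶻ (i +ᶻ i) ≡ ((i +ᶻ ⁺ 1) +ᶻ (i +ᶻ ⁺ 1)) - ⁺ 1 +ᶻ ⁺ 0
    lem = solve-∀
  -- Here `2 % h` reduces to 2, because h ≥ 3 in this module.
  first (inj₂ i) = cong (inj₂ ∘ Q) (lem (⁺ i) c)
    where
    lem : ∀ (i c : ℤ) → (i +ᶻ c) +ᶻ (i +ᶻ c) ≡ ((i +ᶻ (c +ᶻ ⁺ 1)) +ᶻ (i +ᶻ (c +ᶻ ⁺ 1))) - ⁺ 2 +ᶻ ⁺ 0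
    lem = solve-∀

  last : ∀ i → inj₂ (right i) ≡ crossQ i (suc (suc h‴))
  -- As `h % h` is 0, the last band vertex is 2t and not 2t - h, which makes it the neighbour of the
  -- first one, 2t - 1.
  last (inj₁ i) = cong (inj₂ ∘ Q) (trans (lem (⁺ i)) (cong (λ r → ((⁺ i +ᶻ ⁺ 1) +ᶻ (⁺ i +ᶻ ⁺ 1)) - ⁺ r +ᶻ ⁺ 0) (sym (n%n≡0 h))))
    where
    lem : ∀ (i : ℤ) → (i +ᶻ ⁺ 1) +ᶻ (i +ᶻ ⁺ 1) ≡ ((i +ᶻ ⁺ 1) +ᶻ (i +ᶻ ⁺ 1)) - ⁺ 0 +ᶻ ⁺ 0
    lem = solve-∀
  last (inj₂ i) = cong (inj₂ ∘ Q) (trans (lem (⁺ i) c) (cong (λ r → ((⁺ i +ᶻ (c +ᶻ ⁺ 1)) +ᶻ (⁺ i +ᶻ (c +ᶻ ⁺ 1))) - ⁺ r +ᶻ ⁺ 0) (sym ([m+n]%n≡m%n 1 h))))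
    where
    lem : ∀ (i c : ℤ) → ⁺ 1 +ᶻ ((i +ᶻ c) +ᶻ (i +ᶻ c)) ≡ ((i +ᶻ (c +ᶻ ⁺ 1)) +ᶻ (i +ᶻ (c +ᶻ ⁺ 1))) - ⁺ 1 +ᶻ ⁺ 0
    lem = solve-∀

  cross-weave : ∀ i → inj₁ (hole i) ∷ cross i ≡ weave (crossP i) (crossQ i) h
  cross-weave i = trans (cong₂ (λ p q → p ∷ q ∷ crossMid i ++ inj₂ (right i) ∷ []) (start i) (first i))
    (cong (λ l → crossP i 0 ∷ crossQ i 0 ∷ l) (trans (cong (λ q → crossMid i ++ q ∷ []) (last i)) (sym (weave-snoc (crossP i ∘ suc) (crossQ i ∘ suc) (suc h‴)))))

  cross-cover : ∀ i f → sumOver f (inj₁ (hole i) ∷ cross i) + sumOver f (cross₂ i) ≡ ∑F (f ∘ inj₁) + ∑F (f ∘ inj₂)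
  cross-cover i f = begin
    sumOver f (inj₁ (hole i) ∷ cross i) + sumOver f (cross₂ i)
      ≡⟨ cong₂ _+_ (trans (cong (sumOver f) (cross-weave i)) (sumOver-weave f (crossP i) (crossQ i) h)) (sumOver-weave f (cross₂P i) (cross₂Q i) h) ⟩
    ∑ h (f ∘ crossP i) + ∑ h (f ∘ crossQ i) + (∑ h (f ∘ cross₂P i) + ∑ h (f ∘ cross₂Q i))
      ≡⟨ +-exchange (∑ h (f ∘ crossP i)) (∑ h (f ∘ crossQ i)) (∑ h (f ∘ cross₂P i)) (∑ h (f ∘ cross₂Q i)) ⟩
    (∑ h (f ∘ crossP i) + ∑ h (f ∘ cross₂P i)) + (∑ h (f ∘ crossQ i) + ∑ h (f ∘ cross₂Q i))
      ≡⟨ cong₂ _+_ (sumP i) (sumQ i) ⟩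
    ∑F (f ∘ inj₁) + ∑F (f ∘ inj₂) ∎
    where
    downX : ∀ t → ∑ h (λ k → f (inj₁ (X (t - ⁺ k)))) ≡ ∑ℤ h (f ∘ inj₁ ∘ X)
    downX t = ∑-down (f ∘ inj₁ ∘ X) (λ z → cong (f ∘ inj₁) (X-periodic z)) t
    downY : ∀ t → ∑ h (λ k → f (inj₁ (Y (t - ⁺ k)))) ≡ ∑ℤ h (f ∘ inj₁ ∘ Y)
    downY t = ∑-down (f ∘ inj₁ ∘ Y) (λ z → cong (f ∘ inj₁) (Y-periodic z)) t
    lem : ∀ (t k : ℤ) → t - (⁺ 1 +ᶻ k) ≡ t - ⁺ 1 - k
    lem = solve-∀
    sumP : ∀ i → ∑ h (f ∘ crossP i) + ∑ h (f ∘ cross₂P i) ≡ ∑F (f ∘ inj₁)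
    sumP (inj₁ i) = trans (cong₂ _+_ (downX (⁺ i +ᶻ ⁺ 1 - ⁺ 1)) (downY (⁺ i +ᶻ ⁺ 1 - c))) (sym (∑F-XY (f ∘ inj₁)))
    sumP (inj₂ i) = trans (ℕₚ.+-comm (∑ h (f ∘ crossP (inj₂ i))) _) (trans (cong₂ _+_ (downX (⁺ i +ᶻ (c +ᶻ ⁺ 1) - ⁺ 1))
      (trans (∑-cong h (λ k → cong (f ∘ inj₁ ∘ Y) (lem (⁺ i +ᶻ (c +ᶻ ⁺ 1) - c) (⁺ k)))) (downY (⁺ i +ᶻ (c +ᶻ ⁺ 1) - c - ⁺ 1)))) (sym (∑F-XY (f ∘ inj₁))))
    sumQ : ∀ i → ∑ h (f ∘ crossQ i) + ∑ h (f ∘ cross₂Q i) ≡ ∑F (f ∘ inj₂)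
    sumQ (inj₁ i) = ∑-two-bands (f ∘ inj₂) (⁺ i +ᶻ ⁺ 1)
    sumQ (inj₂ i) = trans (cong (_+ ∑ h (f ∘ cross₂Q (inj₂ i))) (∑-rotate h (λ k → f (inj₂ (band (⁺ 0) t k))) (cong (f ∘ inj₂) (band-wrap (⁺ 0) t))))
      (∑-two-bands (f ∘ inj₂) t)
      where
      t : ℤ
      t = ⁺ i +ᶻ (c +ᶻ ⁺ 1)

  -- Each row meets one band in `cross` and the other in `cross₂` of the opposite kind of hole.
  -- Their parameters t differ by a shift, which is immaterial after summation over i, so `bandSums`
  -- applies row by row.
  cross-edges : ∀ G → Symmetric G →
    sumOver (λ i → cycleSum G (inj₁ (hole i) ∷ cross i) + cycleSum G (cross₂ i)) indices
      ≡ ∑F (λ v → ∑F (λ w → G (inj₁ v) (inj₂ w))) + ∑F (λ v → ∑F (λ w → G (inj₁ v) (inj₂ w)))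
  cross-edges G G-sym = begin
    sumOver (λ i → cycleSum G (inj₁ (hole i) ∷ cross i) + cycleSum G (cross₂ i)) indices
      ≡⟨ sumOver-cong (λ i → cong (λ l → cycleSum G l + cycleSum G (cross₂ i)) (cross-weave i)) indices ⟩
    sumOver (λ i → cycleSum G (weave (crossP i) (crossQ i) h) + cycleSum G (cross₂ i)) indices
      ≡⟨ sumOver-indices (λ i → cycleSum G (weave (crossP i) (crossQ i) h) + cycleSum G (cross₂ i)) ⟩
    ∑ h (λ i → cycleSum G (weave (crossP (inj₁ i)) (crossQ (inj₁ i)) h) + cycleSum G (cross₂ (inj₁ i)))
      + ∑ h (λ i → cycleSum G (weave (crossP (inj₂ i)) (crossQ (inj₂ i)) h) + cycleSum G (cross₂ (inj₂ i)))
      ≡⟨ cong₂ _+_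
           (∑-cong h (λ i → cong₂ _+_ (cycleSum-band G G-sym X X-periodic (⁺ 1) (⁺ 0) (⁺ i +ᶻ ⁺ 1)) (cycleSum-band G G-sym Y Y-periodic c (⁺ h) (⁺ i +ᶻ ⁺ 1))))
           (∑-cong h (λ i → cong₂ _+_ (cycleSum-band-rotated G G-sym Y Y-periodic c (⁺ 0) (⁺ i +ᶻ (c +ᶻ ⁺ 1))) (cycleSum-band G G-sym X X-periodic (⁺ 1) (⁺ h) (⁺ i +ᶻ (c +ᶻ ⁺ 1))))) ⟩
    ∑ℤ h (λ i → BX (⁺ 0) (i +ᶻ ⁺ 1) + BY (⁺ h) (i +ᶻ ⁺ 1)) + ∑ℤ h (λ i → BY (⁺ 0) (i +ᶻ (c +ᶻ ⁺ 1)) + BX (⁺ h) (i +ᶻ (c +ᶻ ⁺ 1)))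
      ≡⟨ cong₂ _+_ (trans (∑-+ h (λ i → BX (⁺ 0) (⁺ i +ᶻ ⁺ 1)) (λ i → BY (⁺ h) (⁺ i +ᶻ ⁺ 1))) (cong₂ _+_ (shiftX (⁺ 0) (⁺ 1)) (shiftY (⁺ h) (⁺ 1))))
                   (trans (∑-+ h (λ i → BY (⁺ 0) (⁺ i +ᶻ (c +ᶻ ⁺ 1))) (λ i → BX (⁺ h) (⁺ i +ᶻ (c +ᶻ ⁺ 1)))) (cong₂ _+_ (shiftY (⁺ 0) (c +ᶻ ⁺ 1)) (shiftX (⁺ h) (c +ᶻ ⁺ 1)))) ⟩
    (∑ℤ h (BX (⁺ 0)) + ∑ℤ h (BY (⁺ h))) + (∑ℤ h (BY (⁺ 0)) + ∑ℤ h (BX (⁺ h)))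
      ≡⟨ lem₁ (∑ℤ h (BX (⁺ 0))) (∑ℤ h (BY (⁺ h))) (∑ℤ h (BY (⁺ 0))) (∑ℤ h (BX (⁺ h))) ⟩
    (∑ℤ h (BX (⁺ 0)) + ∑ℤ h (BX (⁺ h))) + (∑ℤ h (BY (⁺ 0)) + ∑ℤ h (BY (⁺ h)))
      ≡⟨ cong₂ _+_ (bandSums G G-sym X X-periodic (⁺ 1)) (bandSums G G-sym Y Y-periodic c) ⟩
    (TX + TX) + (TY + TY)
      ≡⟨ +-exchange TX TX TY TY ⟩
    (TX + TY) + (TX + TY)
      ≡⟨ cong (λ k → k + k) (sym (∑F-XY (λ v → ∑F (λ w → G (inj₁ v) (inj₂ w))))) ⟩
    _ ∎
    where
    BX BY : ℤ → ℤ → ℕ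
    BX = bandSum G G-sym X X-periodic (⁺ 1)
    BY = bandSum G G-sym Y Y-periodic c
    TX TY : ℕ
    TX = rowTotal G G-sym X X-periodic (⁺ 1)
    TY = rowTotal G G-sym Y Y-periodic c
    shiftX : ∀ l k → ∑ℤ h (λ t → BX l (t +ᶻ k)) ≡ ∑ℤ h (BX l)
    shiftX l k = ∑ℤ-shift h (BX l) (bandSum-periodic G G-sym X X-periodic (⁺ 1) l) k
    shiftY : ∀ l k → ∑ℤ h (λ t → BY l (t +ᶻ k)) ≡ ∑ℤ h (BY l)
    shiftY l k = ∑ℤ-shift h (BY l) (bandSum-periodic G G-sym Y Y-periodic c l) k
    lem₁ : ∀ a b c d → (a + b) + (c + d) ≡ (a + d) + (c + b)
    lem₁ = ℕ-solve

  system : System (h + h)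
  system = record
    { I = ℕ ⊎ ℕ ; indices = indices ; hole = hole ; left = left ; right = right
    ; nearMid = nearMid ; crossMid = crossMid ; cross₂ = cross₂ ; round = round
    ; ∑-holes = ∑-holes ; ∑-ends = ∑-ends ; near-length = near-length
    ; cross-length = λ i → trans (cong length (cross-weave i)) (length-weave (crossP i) (crossQ i) h)
    ; cross₂-length = λ i → length-weave (cross₂P i) (cross₂Q i) h
    ; round-length = length-weave (λ i → X (⁺ i)) (λ i → Y (⁺ i)) h
    ; near-cover = near-cover ; cross-cover = cross-cover ; round-cover = round-cover
    ; near-edges = near-edges ; cross-edges = cross-edges
    }

-- For h = 2 the bands of LargeSystem do not give distinct end pairs, so the 4-cycles are chosen directly.
module SmallSystem where
  open Near 0

  V² : Set
  V² = Fin (h + h) ⊎ Fin (h + h)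

  -- A 4-cycle is all of K_{2,2}, here between a row and the residues 2i+e, 2i+e+1. The ends 2i+1,
  -- 2i+2 and 2i+2, 2i+3 dictate the offsets 1 and 2; adding 2 to an offset gives the complementary
  -- pair of residues.
  straight : (ℤ → Fin (h + h)) → ℤ → ℕ → List V²
  straight r e i = weave (λ k → inj₁ (r (⁺ i +ᶻ ⁺ k))) (λ k → inj₂ (Q ((⁺ i +ᶻ ⁺ i) +ᶻ ⁺ k +ᶻ e))) 2

  crossMid cross cross₂ : ℕ ⊎ ℕ → List V²
  crossMid (inj₁ i) = inj₁ (X (⁺ i +ᶻ ⁺ 1)) ∷ []
  crossMid (inj₂ i) = inj₁ (Y (⁺ i +ᶻ ⁺ 1)) ∷ []
  cross i           = inj₂ (left i) ∷ crossMid i ++ inj₂ (right i) ∷ []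
  cross₂ (inj₁ i)   = straight Y (⁺ 3) i
  cross₂ (inj₂ i)   = straight X (⁺ 4) i

  cross₁ : ℕ ⊎ ℕ → List V²
  cross₁ (inj₁ i)   = straight X (⁺ 1) i
  cross₁ (inj₂ i)   = straight Y (⁺ 2) i

  cross-straight : ∀ i → inj₁ (hole i) ∷ cross i ≡ cross₁ i
  cross-straight (inj₁ i) = cong₂ (λ p l → inj₁ (X p) ∷ l) (sym (ℤₚ.+-identityʳ (⁺ i)))
    (cong₂ (λ p q → inj₂ (Q p) ∷ inj₁ (X (⁺ i +ᶻ ⁺ 1)) ∷ inj₂ (Q q) ∷ []) (lem₁ (⁺ i)) (lem₂ (⁺ i)))
    where
    lem₁ : ∀ (i : ℤ) → ⁺ 1 +ᶻ (i +ᶻ i) ≡ (i +ᶻ i) +ᶻ ⁺ 0 +ᶻ ⁺ 1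
    lem₁ = solve-∀
    lem₂ : ∀ (i : ℤ) → (i +ᶻ ⁺ 1) +ᶻ (i +ᶻ ⁺ 1) ≡ (i +ᶻ i) +ᶻ ⁺ 1 +ᶻ ⁺ 1
    lem₂ = solve-∀
  cross-straight (inj₂ i) = cong₂ (λ p l → inj₁ (Y p) ∷ l) (sym (ℤₚ.+-identityʳ (⁺ i)))
    (cong₂ (λ p q → inj₂ (Q p) ∷ inj₁ (Y (⁺ i +ᶻ ⁺ 1)) ∷ inj₂ (Q q) ∷ []) (lem₁ (⁺ i)) (lem₂ (⁺ i)))
    where
    lem₁ : ∀ (i : ℤ) → (i +ᶻ ⁺ 1) +ᶻ (i +ᶻ ⁺ 1) ≡ (i +ᶻ i) +ᶻ ⁺ 0 +ᶻ ⁺ 2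
    lem₁ = solve-∀
    lem₂ : ∀ (i : ℤ) → ⁺ 1 +ᶻ ((i +ᶻ ⁺ 1) +ᶻ (i +ᶻ ⁺ 1)) ≡ (i +ᶻ i) +ᶻ ⁺ 1 +ᶻ ⁺ 2
    lem₂ = solve-∀

  module _ (f : V² → ℕ) where

    straight-cover : ∀ r r' → Periodic 2 r → Periodic 2 r' → ∀ e i →
      sumOver f (straight r e i) + sumOver f (straight r' (⁺ 2 +ᶻ e) i) ≡ (∑ℤ 2 (f ∘ inj₁ ∘ r) + ∑ℤ 2 (f ∘ inj₁ ∘ r')) + ∑F (f ∘ inj₂)
    straight-cover r r' p p' e i = begin
      sumOver f (straight r e i) + sumOver f (straight r' (⁺ 2 +ᶻ e) i)
        ≡⟨ cong₂ _+_ (sumOver-weave f (row r) (col e) 2) (sumOver-weave f (row r') (col (⁺ 2 +ᶻ e)) 2) ⟩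
      (∑ 2 (f ∘ row r) + ∑ 2 (f ∘ col e)) + (∑ 2 (f ∘ row r') + ∑ 2 (f ∘ col (⁺ 2 +ᶻ e)))
        ≡⟨ +-exchange (∑ 2 (f ∘ row r)) (∑ 2 (f ∘ col e)) (∑ 2 (f ∘ row r')) (∑ 2 (f ∘ col (⁺ 2 +ᶻ e))) ⟩
      (∑ 2 (f ∘ row r) + ∑ 2 (f ∘ row r')) + (∑ 2 (f ∘ col e) + ∑ 2 (f ∘ col (⁺ 2 +ᶻ e)))
        ≡⟨ cong₂ _+_ (cong₂ _+_ (rows r p) (rows r' p')) cols ⟩
      _ ∎
      where
      row : (ℤ → Fin (h + h)) → ℕ → V²
      row r k = inj₁ (r (⁺ i +ᶻ ⁺ k))
      col : ℤ → ℕ → V²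
      col e k = inj₂ (Q ((⁺ i +ᶻ ⁺ i) +ᶻ ⁺ k +ᶻ e))
      rows : ∀ r → Periodic 2 r → ∑ 2 (f ∘ row r) ≡ ∑ℤ 2 (f ∘ inj₁ ∘ r)
      rows r p = trans (∑-cong 2 (λ k → cong (f ∘ inj₁ ∘ r) (ℤₚ.+-comm (⁺ i) (⁺ k)))) (∑ℤ-shift 2 (f ∘ inj₁ ∘ r) (λ z → cong (f ∘ inj₁) (p z)) (⁺ i))
      lem₁ : ∀ (i k e : ℤ) → (i +ᶻ i) +ᶻ k +ᶻ e ≡ k +ᶻ ((i +ᶻ i) +ᶻ e)
      lem₁ = solve-∀
      lem₂ : ∀ (i k e : ℤ) → (i +ᶻ i) +ᶻ k +ᶻ (⁺ 2 +ᶻ e) ≡ (⁺ 2 +ᶻ k) +ᶻ ((i +ᶻ i) +ᶻ e)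
      lem₂ = solve-∀
      g : ℕ → ℕ
      g b = f (inj₂ (Q (⁺ b +ᶻ ((⁺ i +ᶻ ⁺ i) +ᶻ e))))
      cols : ∑ 2 (f ∘ col e) + ∑ 2 (f ∘ col (⁺ 2 +ᶻ e)) ≡ ∑F (f ∘ inj₂)
      cols = begin
        ∑ 2 (f ∘ col e) + ∑ 2 (f ∘ col (⁺ 2 +ᶻ e))
          ≡⟨ cong₂ _+_ (∑-cong 2 (λ k → cong (f ∘ inj₂ ∘ Q) (lem₁ (⁺ i) (⁺ k) e))) (∑-cong 2 (λ k → cong (f ∘ inj₂ ∘ Q) (lem₂ (⁺ i) (⁺ k) e))) ⟩
        ∑ 2 g + ∑ 2 (λ k → g (2 + k))
          ≡⟨ ∑-split 2 2 g ⟨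
        ∑ 4 g
          ≡⟨ ∑ℤ-shift 4 (f ∘ inj₂ ∘ Q) (λ z → cong (f ∘ inj₂) (Q-periodic z)) ((⁺ i +ᶻ ⁺ i) +ᶻ e) ⟩
        ∑ℤ 4 (f ∘ inj₂ ∘ Q)
          ≡⟨ ∑F-ι 4 (f ∘ inj₂) ⟨
        ∑F (f ∘ inj₂) ∎

  cross-cover : ∀ i f → sumOver f (inj₁ (hole i) ∷ cross i) + sumOver f (cross₂ i) ≡ ∑F (f ∘ inj₁) + ∑F (f ∘ inj₂)
  cross-cover (inj₁ i) f = trans (cong (λ l → sumOver f l + sumOver f (cross₂ (inj₁ i))) (cross-straight (inj₁ i)))
    (trans (straight-cover f X Y X-periodic Y-periodic (⁺ 1) i) (cong (_+ ∑F (f ∘ inj₂)) (sym (∑F-XY (f ∘ inj₁)))))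
  cross-cover (inj₂ i) f = trans (cong (λ l → sumOver f l + sumOver f (cross₂ (inj₂ i))) (cross-straight (inj₂ i)))
    (trans (straight-cover f Y X Y-periodic X-periodic (⁺ 2) i) (cong (_+ ∑F (f ∘ inj₂)) (trans (ℕₚ.+-comm (∑ℤ 2 (f ∘ inj₁ ∘ Y)) _) (sym (∑F-XY (f ∘ inj₁))))))

  module _ (G : V² → V² → ℕ) (G-sym : Symmetric G) where

    -- For i = 0, 1 the two blocks of consecutive residues tile ℤ/4, so each edge at the row is used
    -- once; the two offsets assigned to each row then give multiplicity two.
    straight-edges : ∀ r → Periodic 2 r → ∀ e → ∑ 2 (λ i → cycleSum G (straight r e i)) ≡ ∑ℤ 2 (λ p → ∑F (λ w → G (inj₁ (r p)) (inj₂ w)))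
    straight-edges r r-periodic e = begin
      ∑ 2 (λ i → cycleSum G (straight r e i))
        ≡⟨ ∑-cong 2 (λ i → trans (cycleSum-weave G (row i) (col i) 2 (cong inj₁ (trans (r-periodic (⁺ i)) (cong r (sym (ℤₚ.+-identityʳ (⁺ i))))))) (∑-cong 2 (rowPair i))) ⟩
      ∑ 2 (λ i → ∑ 2 (λ k → ∑ℤ 2 (λ p → g p (⁺ i +ᶻ ⁺ i +ᶻ ⁺ k))))
        ≡⟨ ∑-cong 2 (λ i → ∑-swap 2 2 (λ k p → g (⁺ p) (⁺ i +ᶻ ⁺ i +ᶻ ⁺ k))) ⟩
      ∑ 2 (λ i → ∑ℤ 2 (λ p → ∑ 2 (λ k → g p (⁺ i +ᶻ ⁺ i +ᶻ ⁺ k))))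
        ≡⟨ ∑-swap 2 2 (λ i p → ∑ 2 (λ k → g (⁺ p) (⁺ i +ᶻ ⁺ i +ᶻ ⁺ k))) ⟩
      ∑ℤ 2 (λ p → ∑ 2 (λ i → ∑ 2 (λ k → g p (⁺ i +ᶻ ⁺ i +ᶻ ⁺ k))))
        ≡⟨ ∑ℤ-cong 2 columns ⟩
      ∑ℤ 2 (λ p → ∑F (λ w → G (inj₁ (r p)) (inj₂ w))) ∎
      where
      row col : ℕ → ℕ → V²
      row i k = inj₁ (r (⁺ i +ᶻ ⁺ k))
      col i k = inj₂ (Q ((⁺ i +ᶻ ⁺ i) +ᶻ ⁺ k +ᶻ e))
      g : ℤ → ℤ → ℕ
      g p b = G (inj₁ (r p)) (inj₂ (Q (b +ᶻ e)))
      rowPair : ∀ i k → G (row i k) (col i k) + G (col i k) (row i (suc k)) ≡ ∑ℤ 2 (λ p → g p (⁺ i +ᶻ ⁺ i +ᶻ ⁺ k))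
      rowPair i k = begin
        G (row i k) (col i k) + G (col i k) (row i (suc k))
          ≡⟨ cong₂ _+_ (cong (λ z → G (inj₁ (r z)) (col i k)) (sym (ℤₚ.+-identityˡ (⁺ i +ᶻ ⁺ k))))
               (trans (G-sym (col i k) (row i (suc k))) (trans (cong (λ z → G (inj₁ (r z)) (col i k)) (lem (⁺ i) (⁺ k))) (sym (ℕₚ.+-identityʳ _)))) ⟩
        ∑ℤ 2 (λ p → G (inj₁ (r (p +ᶻ (⁺ i +ᶻ ⁺ k)))) (col i k))
          ≡⟨ ∑ℤ-shift 2 (λ p → G (inj₁ (r p)) (col i k)) (λ p → cong (λ v → G (inj₁ v) (col i k)) (r-periodic p)) (⁺ i +ᶻ ⁺ k) ⟩
        ∑ℤ 2 (λ p → g p (⁺ i +ᶻ ⁺ i +ᶻ ⁺ k)) ∎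
        where
        lem : ∀ (i k : ℤ) → i +ᶻ (⁺ 1 +ᶻ k) ≡ ⁺ 1 +ᶻ (i +ᶻ k)
        lem = solve-∀
      columns : ∀ p → ∑ 2 (λ i → ∑ 2 (λ k → g p (⁺ i +ᶻ ⁺ i +ᶻ ⁺ k))) ≡ ∑F (λ w → G (inj₁ (r p)) (inj₂ w))
      columns p = begin
        ∑ 2 (λ i → ∑ 2 (λ k → g p (⁺ i +ᶻ ⁺ i +ᶻ ⁺ k)))
          ≡⟨ ∑-cong 2 (λ i → cong₂ _+_ (cong (g p) (ℤₚ.+-identityʳ (⁺ i +ᶻ ⁺ i))) (trans (ℕₚ.+-identityʳ _) (cong (g p) (ℤₚ.+-comm (⁺ i +ᶻ ⁺ i) (⁺ 1))))) ⟩
        ∑ 2 (λ i → g p (⁺ (i + i)) + g p (⁺ suc (i + i)))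
          ≡⟨ ∑-double 2 (λ b → g p (⁺ b)) ⟨
        ∑ 4 (λ b → g p (⁺ b))
          ≡⟨ ∑ℤ-shift 4 (λ z → G (inj₁ (r p)) (inj₂ (Q z))) (λ z → cong (G (inj₁ (r p)) ∘ inj₂) (Q-periodic z)) e ⟩
        ∑ℤ 4 (λ z → G (inj₁ (r p)) (inj₂ (Q z)))
          ≡⟨ ∑F-ι 4 (λ w → G (inj₁ (r p)) (inj₂ w)) ⟨
        ∑F (λ w → G (inj₁ (r p)) (inj₂ w)) ∎

    cross-edges : sumOver (λ i → cycleSum G (inj₁ (hole i) ∷ cross i) + cycleSum G (cross₂ i)) indices
      ≡ ∑F (λ v → ∑F (λ w → G (inj₁ v) (inj₂ w))) + ∑F (λ v → ∑F (λ w → G (inj₁ v) (inj₂ w)))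
    cross-edges = begin
      sumOver (λ i → cycleSum G (inj₁ (hole i) ∷ cross i) + cycleSum G (cross₂ i)) indices
        ≡⟨ sumOver-cong (λ i → cong (λ l → cycleSum G l + cycleSum G (cross₂ i)) (cross-straight i)) indices ⟩
      sumOver (λ i → cycleSum G (cross₁ i) + cycleSum G (cross₂ i)) indices
        ≡⟨ sumOver-indices (λ i → cycleSum G (cross₁ i) + cycleSum G (cross₂ i)) ⟩
      ∑ 2 (λ i → cycleSum G (straight X (⁺ 1) i) + cycleSum G (straight Y (⁺ 3) i)) + ∑ 2 (λ i → cycleSum G (straight Y (⁺ 2) i) + cycleSum G (straight X (⁺ 4) i))
        ≡⟨ cong₂ _+_ (trans (∑-+ 2 (λ i → cycleSum G (straight X (⁺ 1) i)) (λ i → cycleSum G (straight Y (⁺ 3) i)))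
                            (cong₂ _+_ (straight-edges X X-periodic (⁺ 1)) (straight-edges Y Y-periodic (⁺ 3))))
                     (trans (∑-+ 2 (λ i → cycleSum G (straight Y (⁺ 2) i)) (λ i → cycleSum G (straight X (⁺ 4) i)))
                            (trans (cong₂ _+_ (straight-edges Y Y-periodic (⁺ 2)) (straight-edges X X-periodic (⁺ 4))) (ℕₚ.+-comm TY TX))) ⟩
      (TX + TY) + (TX + TY)
        ≡⟨ cong (λ k → k + k) (sym (∑F-XY (λ v → ∑F (λ w → G (inj₁ v) (inj₂ w))))) ⟩
      _ ∎
      where
      TX TY : ℕ
      TX = ∑ℤ 2 (λ p → ∑F (λ w → G (inj₁ (X p)) (inj₂ w)))
      TY = ∑ℤ 2 (λ p → ∑F (λ w → G (inj₁ (Y p)) (inj₂ w)))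

  system : System 4
  system = record
    { I = ℕ ⊎ ℕ ; indices = indices ; hole = hole ; left = left ; right = right
    ; nearMid = nearMid ; crossMid = crossMid ; cross₂ = cross₂ ; round = round
    ; ∑-holes = ∑-holes ; ∑-ends = ∑-ends ; near-length = near-length
    ; cross-length = λ { (inj₁ i) → refl ; (inj₂ i) → refl }
    ; cross₂-length = λ { (inj₁ i) → refl ; (inj₂ i) → refl }
    ; round-length = refl
    ; near-cover = near-cover ; cross-cover = cross-cover ; round-cover = round-cover
    ; near-edges = near-edges ; cross-edges = cross-edges
    }

-- Existence of the base factorization and the theorem

edgeless : ∀ {a} → NearFactorization 1 a
edgeless = record { factors = [] ; lengths = [] ; covers = [] ; edges = λ F _ → sym (ℕₚ.+-identityʳ _) }

scheme-exists : ∀ s .{{_ : NonZero s}} → Scheme s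
scheme-exists s with halve s
... | n           , inj₂ refl = schemeOdd n
... | suc zero    , inj₁ refl = scheme₂
... | suc (suc n) , inj₁ refl = subst Scheme (cong suc (sym (ℕₚ.+-suc (suc n) (suc n)))) (schemeEven n)

near-factorization : ∀ h .{{_ : NonZero h}} s → NearFactorization (suc (s * (h + h))) (h + h)
near-factorization h                   zero      = edgeless
near-factorization 1                   s@(suc _) = subst (λ n → NearFactorization (suc n) 2)
  (trans (cong (s +_) (sym (ℕₚ.+-identityʳ s))) (ℕₚ.*-comm 2 s)) (OddCycle.nearMatching s)
near-factorization 2                   s@(suc _) = Assembly.assembly SmallSystem.system (scheme-exists s)
near-factorization (suc (suc (suc h))) s@(suc _) = Assembly.assembly (LargeSystem.system h) (scheme-exists s)

arcs-exist : ∀ h .{{_ : NonZero h}} s m n → ARCSExists (suc (s * (h + h))) (suc m * suc (n + n)) (suc (n + n) * (h + h)) 2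
arcs-exist h s m n = Tensor.tensor {h = h} (near-factorization h s) (LiftConstruction.liftSystem m n)

divides-of-congruent : ∀ {g b} → g ≡ b [mod 2 * b ] → b ∣ g
divides-of-congruent {g} {b} c = Signed.∣⇒∣ᵤ (subst (Signed._∣_ (⁺ b)) (lem (⁺ g) (⁺ b))
  (Signed.∣m∣n⇒∣m+n {⁺ b} {⁺ g - ⁺ b} {⁺ b} (Signed.∣ᵤ⇒∣ (∣-trans (n∣m*n 2) c)) Signed.∣-refl))
  where
  lem : ∀ (x y : ℤ) → x - y +ᶻ y ≡ x
  lem = solve-∀

theorem4p7 : (u g k : ℕ) (ps : List ℕ) (i : ℕ) →
    1 ≤ u → 1 ≤ g →
    All Prime ps → k ≡ product ps → 6 ≤ k → 2 ∣ k →
    1 ≤ i → i < length ps →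
    2 ∈ take i ps →
    u ≡ 1 [mod product (take i ps) ] →
    ¬ (2 ∣ g) →
    g ≡ product (drop i ps) [mod 2 * product (drop i ps) ] →
    ARCSExists u g k 2
theorem4p7 (suc u) g k ps i _ 1≤g primes k≡ _ _ _ _ 2∈ u≡1 2∤g g≡b
  with ∈⇒∣product 2∈ | u≡1 | divides-of-congruent {g} g≡b | halve (product (drop i ps))
-- An even b would make g even, and so would m = 0. What remains is b = 2n + 1 with at least one
-- copy of ℤ/b.
... | divides h a≡ | divides s u≡ | divides m g≡ | n , inj₁ b≡ =
  ⊥-elim (2∤g (∣-trans (divides n (trans b≡ (trans (cong (n +_) (sym (ℕₚ.+-identityʳ n))) (ℕₚ.*-comm 2 n)))) (divides m g≡)))
... | divides h a≡ | divides s u≡ | divides zero refl | n , inj₂ b≡ = ⊥-elim (2∤g (divides 0 refl))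
... | divides h a≡ | divides s u≡ | divides (suc m) g≡ | n , inj₂ b≡ =
  subst (λ u → ARCSExists u g k 2) (cong suc (sym (trans u≡ (cong (s *_) a≡h+h))))
    (subst₂ (λ g k → ARCSExists (suc (s * (h + h))) g k 2) (sym (trans g≡ (cong (suc m *_) b≡))) (sym k≡ba) (arcs-exist h {{h≢0}} s m n))
  where
  a≡h+h : product (take i ps) ≡ h + h
  a≡h+h = trans a≡ (trans (ℕₚ.*-comm h 2) (cong (h +_) (ℕₚ.+-identityʳ h)))
  k≡ba : k ≡ suc (n + n) * (h + h)
  k≡ba = trans k≡ (trans (cong product (sym (take++drop≡id i ps))) (trans (product-++ (take i ps) (drop i ps))
    (trans (ℕₚ.*-comm (product (take i ps)) (product (drop i ps))) (cong₂ _*_ b≡ a≡h+h))))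
  h≢0 : NonZero h
  h≢0 = ℕₚ.m*n≢0⇒m≢0 h {{subst NonZero a≡ (product≢0 (All.map prime⇒nonZero (Allₚ.take⁺ i primes)))}}
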